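{- Let $G$ be a 3-connected graph, let $\tau$ be a 4-tangle in $G$ that is not cubic, and let $N_1,N_2$ be maximal 3-chops of $G$. For $i=1,2$ let $\sigma_i$ be a splitting star of $N_i$ with $\sigma_i\subseteq\tau$. Then the torsos of $\sigma_1$ and $\sigma_2$ are internally 4-connected and isomorphic to each other.
   Context: All graphs are finite and simple. A separation of $G$ is a set $\{A,B\}$ with $A\cup B=V(G)$ and no edge between $A\setminus B$ and $B\setminus A$; its order is $|A\cap B|$, its separator $A\cap B$; proper if $A\setminus B\ne\emptyset\ne B\setminus A$. Orientations $(A,B),(B,A)$; $(A,B)\le(C,D)$ iff $A\subseteq C$ and $B\supseteq D$. Two separations are nested if they have orientations $(A,B),(C,D)$ with $(A,B)\le(C,D)$; a set is nested if pairwise nested. A proper separation $\{A,B\}$ of order 3 of a 3-connected graph is claw-free if both $G[A]$ and $G[B]$ contain a cycle. A finite set $S$ of proper separations of order 3 is claw-freeable if it can be enumerated $s_0,\dots,s_n$ such that each $s_i$ is claw-free or there is $j<i$ with the separators of $s_j,s_i$ sharing at least two vertices. A 3-chop is a claw-freeable nested set of proper separations of order 3; maximal if not properly contained in another 3-chop. A set $\sigma=\{(A_i,B_i):i\in I\}$ of oriented separations is a star if $(A_i,B_i)\le(B_j,A_j)$ for $i\ne j$; its bag is $\bigcap_iB_i$ ($=V(G)$ if $I=\emptyset$); its torso is obtained from $G[\bigcap_iB_i]$ by making each $A_i\cap B_i$ a clique. A splitting star of $N$ is a star $\sigma$ of orientations of elements of $N$ such that for every $\{C,D\}\in N$ some $(A_i,B_i)\in\sigma$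 has $(C,D)\le(A_i,B_i)$ or $(D,C)\le(A_i,B_i)$. A $k$-tangle in $G$ is a set of oriented separations of order $<k$ containing exactly one orientation of every separation of order $<k$, and no three (not necessarily distinct) elements $(A_1,B_1),(A_2,B_2),(A_3,B_3)$ with $G[A_1]\cup G[A_2]\cup G[A_3]=G$. A 4-set $X\subseteq V(G)$ is cubic in $G$ if the set of neighbourhoods of the components of $G-X$ equals the set of 3-subsets of $X$. A 4-tangle $\tau$ in a 3-connected graph is cubic if it includes a star of oriented separations of order 3 whose bag is a cubic vertex set in $G$. A graph is internally 4-connected if it is 3-connected, has more than four vertices, and for every 3-set $S$ with $G-S$ disconnected, $S$ is independent and $G-S$ has exactly two components, one a single vertex. -}

module Defs where

open import Data.Nat using (ℕ; _<_; _≤_; _>_)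
open import Data.Bool using (Bool; true; false)
open import Data.Fin using (Fin)
open import Data.Fin.Subset using (Subset; _∈_; _∉_; _⊆_; _∩_; _∪_; _─_; ∣_∣; ⊤)
open import Data.List using (List; []; _∷_; _++_; length; foldr; lookup)
open import Data.List.Relation.Unary.All using (All)
open import Data.List.Relation.Unary.Any using (Any)
open import Data.List.Relation.Unary.Unique.Propositional using (Unique)
open import Data.Product using (Σ; ∃; ∃-syntax; _×_; _,_; proj₁; proj₂)
open import Data.Sum using (_⊎_)
open import Data.Unit using () renaming (⊤ to ⊤′)
open import Data.Empty using (⊥)
open import Relation.Nullary using (¬_)
open import Relation.Binary.PropositionalEquality using (_≡_; _≢_)
import Data.Fin as F

record Graph : Set where
  field
    n     : ℕ
    adj   : Fin n → Fin n → Bool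
    sym   : ∀ u v → adj u v ≡ adj v u
    irref : ∀ v → adj v v ≡ false

open Graph public

-- Generic notions for a "graph" given by a vertex set P ⊆ Fin m and an
-- adjacency relation E (only edges with both ends in P matter).

module _ {m : ℕ} (E : Fin m → Fin m → Set) where

  data Reach (X : Subset m) : Fin m → Fin m → Set where
    here : ∀ {u} → u ∈ X → Reach X u u
    step : ∀ {u w v} → u ∈ X → E u w → Reach X w v → Reach X u v

  Connected : Subset m → Set
  Connected X = ∀ u v → u ∈ X → v ∈ X → Reach X u v

  IsComponent : Subset m → Subset m → Set
  IsComponent X C =
    (∃[ v ] v ∈ C) × C ⊆ X × Connected C ×
    (∀ u w → u ∈ C → w ∈ X → E u w → w ∈ C)

  KConnected : ℕ → Subset m → Set
  KConnected k P = ∣ P ∣ > k × (∀ S → S ⊆ P → ∣ S ∣ < k → Connected (P ─ S))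

  InternallyFourConnected : Subset m → Set
  InternallyFourConnected P =
    KConnected 3 P × ∣ P ∣ > 4 ×
    (∀ S → S ⊆ P → ∣ S ∣ ≡ 3 → ¬ Connected (P ─ S) →
       (∀ u v → u ∈ S → v ∈ S → ¬ E u v) ×
       (Σ (Subset m) λ C₁ → Σ (Subset m) λ C₂ →
          IsComponent (P ─ S) C₁ × IsComponent (P ─ S) C₂ × C₁ ≢ C₂ ×
          (∀ C → IsComponent (P ─ S) C → C ≡ C₁ ⊎ C ≡ C₂) ×
          ∣ C₁ ∣ ≡ 1))

  AdjChain : List (Fin m) → Set
  AdjChain []           = ⊤′
  AdjChain (x ∷ [])     = ⊤′
  AdjChain (x ∷ y ∷ xs) = E x y × AdjChain (y ∷ xs)

  HasCycle : Subset m → Set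
  HasCycle X = Σ (Fin m) λ x → Σ (List (Fin m)) λ xs →
    2 ≤ length xs × Unique (x ∷ xs) × All (_∈ X) (x ∷ xs) ×
    AdjChain (x ∷ xs ++ x ∷ [])

  Isomorphic : Subset m → (Fin m → Fin m → Set) → Subset m → Set
  Isomorphic P F Q = Σ (Fin m → Fin m) λ f → Σ (Fin m → Fin m) λ g →
    (∀ v → v ∈ P → f v ∈ Q) × (∀ v → v ∈ Q → g v ∈ P) ×
    (∀ v → v ∈ P → g (f v) ≡ v) × (∀ v → v ∈ Q → f (g v) ≡ v) ×
    (∀ u v → u ∈ P → v ∈ P → (E u v → F (f u) (f v)) × (F (f u) (f v) → E u v))

module _ (G : Graph) where

  private
    V = Fin (n G)

  Edge : V → V → Set
  Edge u v = adj G u v ≡ true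

  -- oriented separations are ordered pairs (A , B); a separation {A,B} is
  -- represented by either of its orientations
  OSep : Set
  OSep = Subset (n G) × Subset (n G)

  swap : OSep → OSep
  swap (A , B) = (B , A)

  IsSeparation : OSep → Set
  IsSeparation (A , B) =
    (A ∪ B ≡ ⊤) × (∀ u v → u ∈ A ─ B → v ∈ B ─ A → ¬ Edge u v)

  order : OSep → ℕ
  order (A , B) = ∣ A ∩ B ∣

  separator : OSep → Subset (n G)
  separator (A , B) = A ∩ B

  Proper : OSep → Set
  Proper (A , B) = (∃[ v ] v ∈ A ─ B) × (∃[ v ] v ∈ B ─ A)

  _≤ₛ_ : OSep → OSep → Set
  (A , B) ≤ₛ (C , D) = A ⊆ C × D ⊆ B

  Nested : OSep → OSep → Set
  Nested s t = s ≤ₛ t ⊎ s ≤ₛ swap t ⊎ swap s ≤ₛ t ⊎ swap s ≤ₛ swap t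

  ThreeConnected : Set
  ThreeConnected = KConnected Edge 3 ⊤

  Proper3 : OSep → Set
  Proper3 s = IsSeparation s × Proper s × order s ≡ 3

  ClawFree : OSep → Set
  ClawFree (A , B) = HasCycle Edge A × HasCycle Edge B

  -- finite sets of (unoriented) separations: lists, membership up to swap
  _∈ₛ_ : OSep → List OSep → Set
  s ∈ₛ N = Any (λ t → t ≡ s ⊎ t ≡ swap s) N

  _⊆ₛ_ : List OSep → List OSep → Set
  N ⊆ₛ M = ∀ s → s ∈ₛ N → s ∈ₛ M

  ClawFreeable : List OSep → Set
  ClawFreeable S = Σ (List OSep) λ L → L ⊆ₛ S × S ⊆ₛ L ×
    (∀ (i : Fin (length L)) → ClawFree (lookup L i) ⊎
       (Σ (Fin (length L)) λ j → F.toℕ j < F.toℕ i ×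
          2 ≤ ∣ separator (lookup L j) ∩ separator (lookup L i) ∣))

  ThreeChop : List OSep → Set
  ThreeChop N = All Proper3 N ×
    (∀ s t → s ∈ₛ N → t ∈ₛ N → Nested s t) × ClawFreeable N

  MaximalThreeChop : List OSep → Set
  MaximalThreeChop N = ThreeChop N × (∀ M → ThreeChop M → N ⊆ₛ M → M ⊆ₛ N)

  -- stars of oriented separations (lists; membership is literal)
  open import Data.List.Membership.Propositional using () renaming (_∈_ to _∈ₗ_)

  Star : List OSep → Set
  Star σ = ∀ s t → s ∈ₗ σ → t ∈ₗ σ → s ≢ t → s ≤ₛ swap t

  bag : List OSep → Subset (n G)
  bag σ = foldr (λ s acc → proj₂ s ∩ acc) ⊤ σ

  TorsoEdge : List OSep → V → V → Set
  TorsoEdge σ u v = Edge u v ⊎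
    (u ≢ v × Σ OSep λ s → s ∈ₗ σ × u ∈ separator s × v ∈ separator s)

  SplittingStar : List OSep → List OSep → Set
  SplittingStar N σ = Star σ × (∀ s → s ∈ₗ σ → s ∈ₛ N) ×
    (∀ t → t ∈ₛ N → Σ OSep λ s → s ∈ₗ σ × (t ≤ₛ s ⊎ swap t ≤ₛ s))

  OSepSet : Set₁
  OSepSet = OSep → Set

  CoversG : OSep → OSep → OSep → Set
  CoversG (A₁ , _) (A₂ , _) (A₃ , _) =
    (A₁ ∪ A₂ ∪ A₃ ≡ ⊤) ×
    (∀ u v → Edge u v → (u ∈ A₁ × v ∈ A₁) ⊎ (u ∈ A₂ × v ∈ A₂) ⊎ (u ∈ A₃ × v ∈ A₃))

  Tangle : ℕ → OSepSet → Set
  Tangle k τ =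
    (∀ s → τ s → IsSeparation s × order s < k) ×
    (∀ s → IsSeparation s → order s < k → τ s ⊎ τ (swap s)) ×
    (∀ s → IsSeparation s → order s < k → τ s → τ (swap s) → ⊥) ×
    (∀ s₁ s₂ s₃ → τ s₁ → τ s₂ → τ s₃ → ¬ CoversG s₁ s₂ s₃)

  NbhdIs : Subset (n G) → Subset (n G) → Set
  NbhdIs C Y = ∀ v → (v ∈ Y → v ∉ C × Σ V λ u → u ∈ C × Edge u v) ×
                     (v ∉ C → Σ V (λ u → u ∈ C × Edge u v) → v ∈ Y)

  Cubic : Subset (n G) → Set
  Cubic X = ∣ X ∣ ≡ 4 ×
    (∀ C Y → IsComponent Edge (⊤ ─ X) C → NbhdIs C Y → Y ⊆ X × ∣ Y ∣ ≡ 3) ×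
    (∀ Y → Y ⊆ X → ∣ Y ∣ ≡ 3 →
       Σ (Subset (n G)) λ C → IsComponent Edge (⊤ ─ X) C × NbhdIs C Y)

  CubicTangle : OSepSet → Set
  CubicTangle τ = Σ (List OSep) λ σ →
    Star σ × All τ σ × All (λ s → order s ≡ 3) σ × Cubic (bag σ)

{-# OPTIONS --safe #-}
-- Contract a set R with three neighbours: delete R and make N(R) a clique. With the sets on the small
-- side of the tangle as the sets R that may be contracted, and only if R ∪ N(R) does not induce a claw,
-- this is a rewriting system on graphs. Take two contractible sets R and S. If |N(R ∪ S)| ≤ 3, then
-- both contractions extend to that of R ∪ S. Otherwise R and S are disjoint by submodularity, and either
-- the two contractions commute or R and S are joined by a single edge xy and have no common neighbour;
-- then contracting S ∖ y after R and R ∖ x after S gives two graphs that are exchanged by swapping x and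
-- y. Each side needs at most one further step, so normal forms are unique up to isomorphism.
--
-- The enumeration of a 3-chop is a rewriting sequence from G to the torso, and a contractible set of
-- the torso of a maximal 3-chop would lift to a separation extending the chop; so both torsos are normal
-- forms. A normal form with more than four vertices is internally 4-connected. If the torso had at most
-- four vertices, either the tangle would be cubic or three of its small sides would cover G.

module Submission where

open import Defs hiding (n; sym)
open import Data.Bool using (true)
import Data.Bool as Bool
open import Data.Empty using (⊥; ⊥-elim)
open import Data.Fin using (Fin; toℕ; fromℕ<)
import Data.Fin as Fin
open import Data.Fin.Properties using (any?; _≟_; toℕ<n; toℕ-fromℕ<; toℕ-injective)
open import Data.Fin.Subset
  using (Subset; _∈_; _∉_; _⊆_; _∩_; _∪_; _─_; _-_; ∣_∣; ⊤; ⁅_⁆; inside; outside) renaming (⊥ to ∅)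
open import Data.Fin.Subset.Properties
  using (_∈?_; _⊆?_; ∈⊤; x∈⁅x⁆; x∈⁅y⁆⇒x≡y; ∣⁅x⁆∣≡1; ∣⊥∣≡0; ⊆-antisym; p⊆q⇒∣p∣≤∣q∣;
         x∈p∩q⁺; x∈p∩q⁻; x∈p∪q⁺; x∈p∪q⁻; x∈p∧x∉q⇒x∈p─q; p─q⊆p; x∈p∧x≢y⇒x∈p-y)
open import Data.List using (List; []; _∷_; _++_; length; lookup)
open import Data.List.Membership.Propositional using () renaming (_∈_ to _∈ₗ_)
open import Data.List.Relation.Unary.All as All using (All; []; _∷_)
open import Data.List.Relation.Unary.AllPairs using ([]; _∷_)
open import Data.List.Relation.Unary.Any as Any using (Any; here; there)
open import Data.List.Relation.Unary.Unique.Propositional using (Unique)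
open import Data.Nat using (ℕ; zero; suc; _+_; _≤_; _<_; _>_; z≤n; s≤s; _≤?_)
open import Data.Nat.Properties
  using (≤-refl; ≤-trans; ≤-reflexive; ≤-antisym; ≤-pred; <⇒≤; <⇒≱; ≰⇒>; n≤1+n; m≤m+n;
         +-suc; +-comm; +-mono-≤; +-monoʳ-≤; +-cancelʳ-≤; suc-injective;
         m≤n⇒m<n∨m≡n; m<1+n⇒m<n∨m≡n; module ≤-Reasoning)
open import Data.Product using (Σ; ∃-syntax; _×_; _,_; proj₁; proj₂)
open import Data.Sum using (_⊎_; inj₁; inj₂; [_,_]′)
import Data.Sum as Sum
open import Data.Vec using (tabulate)
import Data.Vec as Vec
open import Data.Vec.Properties using (lookup∘tabulate; lookup⇒[]=; []=⇒lookup)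
open import Function using (_∘_; id)
open import Relation.Binary.PropositionalEquality
  using (_≡_; _≢_; refl; sym; trans; cong; cong₂; subst; subst₂)
open import Relation.Nullary using (¬_; Dec; yes; no; does)
open import Relation.Nullary.Decidable using (_×-dec_; _⊎-dec_; ¬?; dec-true)
open import Data.List.Relation.Unary.All.Properties using (¬Any⇒All¬)
open import Data.List.Relation.Unary.Any.Properties using (++⁺ˡ; ++⁺ʳ; ++⁻; lookup-index)

-- What is rewritten is a graph together with its family of small sets. A tangle could not be
-- carried along: a contraction may end in a graph on four vertices, which has no 4-tangle, since
-- the three triples through one vertex cover it. `System` therefore keeps laws that every
-- contraction preserves, and isomorphisms have to respect small sets because later steps depend on
-- them. Claws are excluded because of the edge xy. If S is just y, nothing of S is left to contract
-- after R, whereas contracting S first makes N(S) a clique. The two results agree only if the two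
-- vertices of N(S) other than x are already adjacent, and this is what the missing claw provides.
-- For a single vertex R, contractibility means an edge inside N(R). At its turn in the enumeration
-- such an edge is either an edge of G or joins two vertices of an earlier separator; these are the
-- two clauses of claw-freeability. Read backwards, an edge inside the neighbourhood of a set in the
-- torso permits the chop to be extended. The cycle required on the large side is supplied by the
-- tangle.

private variable
  m : ℕ

-- Finite subsets

abstract
  ⟪_⟫ : {A : Fin m → Set} → (∀ v → Dec (A v)) → Subset m
  ⟪ A? ⟫ = tabulate (does ∘ A?)

  ∈⟪⟫⁺ : {A : Fin m → Set} (A? : ∀ v → Dec (A v)) {v : Fin m} → A v → v ∈ ⟪ A? ⟫
  ∈⟪⟫⁺ A? {v} a = lookup⇒[]= v _ (trans (lookup∘tabulate _ v) (dec-true (A? v) a))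

  ∈⟪⟫⁻ : {A : Fin m → Set} (A? : ∀ v → Dec (A v)) {v : Fin m} → v ∈ ⟪ A? ⟫ → A v
  ∈⟪⟫⁻ A? {v} v∈ with A? v | trans (sym (lookup∘tabulate (does ∘ A?) v)) ([]=⇒lookup v∈)
  ... | yes a | _ = a

∈─⁺ : {p q : Subset m} {x : Fin m} → x ∈ p → x ∉ q → x ∈ p ─ q
∈─⁺ = x∈p∧x∉q⇒x∈p─q

x∈p─q⇒x∉q : (p q : Subset m) {x : Fin m} → x ∈ p ─ q → x ∉ q
x∈p─q⇒x∉q (_ Vec.∷ p) (outside Vec.∷ q) (Vec.there i) (Vec.there j) = x∈p─q⇒x∉q p q i j
x∈p─q⇒x∉q (_ Vec.∷ p) (inside  Vec.∷ q) (Vec.there i) (Vec.there j) = x∈p─q⇒x∉q p q i j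

∈─⁻ : {p q : Subset m} {x : Fin m} → x ∈ p ─ q → x ∈ p × x ∉ q
∈─⁻ {p = p} {q} i = p─q⊆p p q i , x∈p─q⇒x∉q p q i

infixl 5 _∖_

abstract
  _∖_ : Subset m → Subset m → Subset m
  p ∖ q = p ─ q

  ∈∖⁺ : {p q : Subset m} {x : Fin m} → x ∈ p → x ∉ q → x ∈ p ∖ q
  ∈∖⁺ = ∈─⁺

  ∈∖⁻ : {p q : Subset m} {x : Fin m} → x ∈ p ∖ q → x ∈ p × x ∉ q
  ∈∖⁻ {p = p} = ∈─⁻ {p = p}

∈∪ˡ : {p q : Subset m} {x : Fin m} → x ∈ p → x ∈ p ∪ q
∈∪ˡ i = x∈p∪q⁺ (inj₁ i)

∈∪ʳ : {p q : Subset m} {x : Fin m} → x ∈ q → x ∈ p ∪ q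
∈∪ʳ i = x∈p∪q⁺ (inj₂ i)

∈∪⁻ : {p q : Subset m} {x : Fin m} → x ∈ p ∪ q → x ∈ p ⊎ x ∈ q
∈∪⁻ {p = p} {q} = x∈p∪q⁻ p q

∈∩⁺ : {p q : Subset m} {x : Fin m} → x ∈ p → x ∈ q → x ∈ p ∩ q
∈∩⁺ i j = x∈p∩q⁺ (i , j)

∈∩⁻ : {p q : Subset m} {x : Fin m} → x ∈ p ∩ q → x ∈ p × x ∈ q
∈∩⁻ {p = p} {q} = x∈p∩q⁻ p q

meets? : (p q : Subset m) → Dec (∃[ v ] (v ∈ p × v ∈ q))
meets? p q = any? λ v → (v ∈? p) ×-dec (v ∈? q)

inhabited? : (p : Subset m) → Dec (∃[ v ] v ∈ p)
inhabited? p = any? (_∈? p)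

∣p∪q∣+∣p∩q∣ : (p q : Subset m) → ∣ p ∪ q ∣ + ∣ p ∩ q ∣ ≡ ∣ p ∣ + ∣ q ∣
∣p∪q∣+∣p∩q∣ Vec.[] Vec.[] = refl
∣p∪q∣+∣p∩q∣ (outside Vec.∷ p) (outside Vec.∷ q) = ∣p∪q∣+∣p∩q∣ p q
∣p∪q∣+∣p∩q∣ (inside Vec.∷ p) (outside Vec.∷ q) = cong suc (∣p∪q∣+∣p∩q∣ p q)
∣p∪q∣+∣p∩q∣ (outside Vec.∷ p) (inside Vec.∷ q) =
  trans (cong suc (∣p∪q∣+∣p∩q∣ p q)) (sym (+-suc ∣ p ∣ ∣ q ∣))
∣p∪q∣+∣p∩q∣ (inside Vec.∷ p) (inside Vec.∷ q) = cong suc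
  (trans (+-suc ∣ p ∪ q ∣ ∣ p ∩ q ∣) (trans (cong suc (∣p∪q∣+∣p∩q∣ p q)) (sym (+-suc ∣ p ∣ ∣ q ∣))))

∣p∪q∣≤ : (p q : Subset m) → ∣ p ∪ q ∣ ≤ ∣ p ∣ + ∣ q ∣
∣p∪q∣≤ p q = ≤-trans (m≤m+n _ _) (≤-reflexive (∣p∪q∣+∣p∩q∣ p q))

∈⇒1≤ : {p : Subset m} {x : Fin m} → x ∈ p → 1 ≤ ∣ p ∣
∈⇒1≤ {x = x} x∈p = ≤-trans (≤-reflexive (sym (∣⁅x⁆∣≡1 x)))
  (p⊆q⇒∣p∣≤∣q∣ λ y∈ → subst (_∈ _) (sym (x∈⁅y⁆⇒x≡y x y∈)) x∈p)

disjoint⇒∣p∩q∣≡0 : (p q : Subset m) → (∀ {x} → x ∈ p → x ∈ q → ⊥) → ∣ p ∩ q ∣ ≡ 0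
disjoint⇒∣p∩q∣≡0 Vec.[] Vec.[] d = refl
disjoint⇒∣p∩q∣≡0 (outside Vec.∷ p) (_ Vec.∷ q) d = disjoint⇒∣p∩q∣≡0 p q λ i j → d (Vec.there i) (Vec.there j)
disjoint⇒∣p∩q∣≡0 (inside Vec.∷ p) (outside Vec.∷ q) d = disjoint⇒∣p∩q∣≡0 p q λ i j → d (Vec.there i) (Vec.there j)
disjoint⇒∣p∩q∣≡0 (inside Vec.∷ p) (inside Vec.∷ q) d = ⊥-elim (d Vec.here Vec.here)

disjoint-∪ : (p q : Subset m) → (∀ {x} → x ∈ p → x ∈ q → ⊥) → ∣ p ∪ q ∣ ≡ ∣ p ∣ + ∣ q ∣
disjoint-∪ p q d = trans (sym (trans (cong (∣ p ∪ q ∣ +_) (disjoint⇒∣p∩q∣≡0 p q d)) (+-comm _ 0)))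
  (∣p∪q∣+∣p∩q∣ p q)

pick-outside : (p q : Subset m) → ∣ q ∣ < ∣ p ∣ → ∃[ v ] (v ∈ p × v ∉ q)
pick-outside p q q<p with any? (λ v → (v ∈? p) ×-dec ¬? (v ∈? q))
... | yes r = r
... | no ¬r = ⊥-elim (<⇒≱ q<p (p⊆q⇒∣p∣≤∣q∣ p⊆q))
  where
  p⊆q : p ⊆ q
  p⊆q {v} v∈p with v ∈? q
  ... | yes v∈q = v∈q
  ... | no v∉q = ⊥-elim (¬r (v , v∈p , v∉q))

∣─⁅⁆∣ : (p : Subset m) {x : Fin m} → x ∈ p → ∣ p ∣ ≡ suc ∣ p - x ∣
∣─⁅⁆∣ p {x} x∈p = trans (cong ∣_∣ (⊆-antisym to from))
  (trans (disjoint-∪ ⁅ x ⁆ (p - x) λ i j → proj₂ (∈─⁻ {p = p} j) i) (cong (_+ ∣ p - x ∣) (∣⁅x⁆∣≡1 x)))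
  where
  to : p ⊆ ⁅ x ⁆ ∪ (p - x)
  to {y} y∈p with y ∈? ⁅ x ⁆
  ... | yes i = ∈∪ˡ i
  ... | no i = ∈∪ʳ (∈─⁺ y∈p i)
  from : ⁅ x ⁆ ∪ (p - x) ⊆ p
  from y∈ with ∈∪⁻ {p = ⁅ x ⁆} y∈
  ... | inj₁ i = subst (_∈ p) (sym (x∈⁅y⁆⇒x≡y x i)) x∈p
  ... | inj₂ i = p─q⊆p p _ i

∈-⁻ : {p : Subset m} {x y : Fin m} → y ∈ p - x → y ∈ p × y ≢ x
∈-⁻ {p = p} {x} i = p─q⊆p p _ i , λ { refl → proj₂ (∈─⁻ {p = p} i) (x∈⁅x⁆ x) }

⊆∧≥⇒⊇ : {p q : Subset m} → p ⊆ q → ∣ q ∣ ≤ ∣ p ∣ → q ⊆ p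
⊆∧≥⇒⊇ {p = p} {q} p⊆q q≤p {v} v∈q with v ∈? p
... | yes v∈p = v∈p
... | no v∉p = ⊥-elim (<⇒≱ (≤-trans (s≤s (p⊆q⇒∣p∣≤∣q∣ p⊆q-v)) (≤-reflexive (sym (∣─⁅⁆∣ q v∈q)))) q≤p)
  where
  p⊆q-v : p ⊆ q - v
  p⊆q-v i = x∈p∧x≢y⇒x∈p-y (p⊆q i) λ { refl → v∉p i }

-- The recurring source of equalities between neighbourhoods: 3-connectivity bounds the smaller one
-- from below by 3, the order of the separations bounds the larger one from above.
squeeze : {p q : Subset m} → p ⊆ q → 3 ≤ ∣ p ∣ → ∣ q ∣ ≤ 3 → p ≡ q
squeeze p⊆q 3≤p q≤3 = ⊆-antisym p⊆q (⊆∧≥⇒⊇ p⊆q (≤-trans q≤3 3≤p))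

pick : (p : Subset m) → 1 ≤ ∣ p ∣ → ∃[ v ] v ∈ p
pick {m} p 1≤p with pick-outside p ∅ (≤-trans (s≤s (≤-reflexive (∣⊥∣≡0 m))) 1≤p)
... | v , v∈p , _ = v , v∈p

pick₂ : (p : Subset m) → 2 ≤ ∣ p ∣ → ∃[ u ] ∃[ v ] (u ∈ p × v ∈ p × u ≢ v)
pick₂ p 2≤p with pick p (≤-trans (s≤s z≤n) 2≤p)
... | u , u∈p with pick-outside p ⁅ u ⁆ (≤-trans (s≤s (≤-reflexive (∣⁅x⁆∣≡1 u))) 2≤p)
... | v , v∈p , v∉u = u , v , u∈p , v∈p , λ { refl → v∉u (x∈⁅x⁆ u) }

∣p∣≤1⇒≡ : (p : Subset m) → ∣ p ∣ ≤ 1 → ∀ {u v} → u ∈ p → v ∈ p → u ≡ v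
∣p∣≤1⇒≡ p p≤1 {u} {v} u∈p v∈p =
  x∈⁅y⁆⇒x≡y v (⊆∧≥⇒⊇ {p = ⁅ v ⁆} (λ i → subst (_∈ p) (sym (x∈⁅y⁆⇒x≡y v i)) v∈p)
    (≤-trans p≤1 (≤-reflexive (sym (∣⁅x⁆∣≡1 v)))) u∈p)

≢⇒2≤ : (p : Subset m) → ∀ {u v} → u ∈ p → v ∈ p → u ≢ v → 2 ≤ ∣ p ∣
≢⇒2≤ p u∈p v∈p u≢v with 2 ≤? ∣ p ∣
... | yes h = h
... | no h = ⊥-elim (u≢v (∣p∣≤1⇒≡ p (≤-pred (≰⇒> h)) u∈p v∈p))

∣∣-injective : (f : Fin m → Fin m) → (∀ {u v} → f u ≡ f v → u ≡ v) →
  (p : Subset m) (q : Subset m) → (∀ {v} → v ∈ p → f v ∈ q) → ∣ p ∣ ≤ ∣ q ∣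
∣∣-injective f f-inj p = go ∣ p ∣ p ≤-refl
  where
  go : ∀ j p → ∣ p ∣ ≤ j → ∀ q → (∀ {v} → v ∈ p → f v ∈ q) → ∣ p ∣ ≤ ∣ q ∣
  go zero p p≤0 q pq = ≤-trans p≤0 z≤n
  go (suc j) p p≤ q pq with 1 ≤? ∣ p ∣
  ... | no h = ≤-trans (≤-pred (≰⇒> h)) z≤n
  ... | yes h with pick p h
  ... | v , v∈p = subst₂ _≤_ (sym (∣─⁅⁆∣ p v∈p)) (sym (∣─⁅⁆∣ q (pq v∈p)))
    (s≤s (go j (p - v) (≤-pred (≤-trans (≤-reflexive (sym (∣─⁅⁆∣ p v∈p))) p≤)) (q - f v) λ i →
      x∈p∧x≢y⇒x∈p-y (pq (proj₁ (∈-⁻ {p = p} i))) (λ e → proj₂ (∈-⁻ {p = p} i) (f-inj e))))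

pre : (Fin m → Fin m) → Subset m → Subset m
pre f q = ⟪ (λ v → f v ∈? q) ⟫

∈pre⁺ : (f : Fin m → Fin m) (q : Subset m) {v : Fin m} → f v ∈ q → v ∈ pre f q
∈pre⁺ f q = ∈⟪⟫⁺ (λ v → f v ∈? q)

∈pre⁻ : (f : Fin m → Fin m) (q : Subset m) {v : Fin m} → v ∈ pre f q → f v ∈ q
∈pre⁻ f q = ∈⟪⟫⁻ (λ v → f v ∈? q)

-- Reachability

Reach-snoc : {E : Fin m → Fin m → Set} {X : Subset m} {u v w : Fin m} →
  Reach E X u v → w ∈ X → E v w → Reach E X u w
Reach-snoc (Reach.here u∈X) w∈X e = Reach.step u∈X e (Reach.here w∈X)
Reach-snoc (Reach.step u∈X e r) w∈X e′ = Reach.step u∈X e (Reach-snoc r w∈X e′)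

Reach-closed : {E : Fin m → Fin m → Set} {X C : Subset m} →
  (∀ {a b} → a ∈ C → b ∈ X → E a b → b ∈ C) → ∀ {u v} → u ∈ C → Reach E X u v → v ∈ C
Reach-start : {E : Fin m → Fin m → Set} {X : Subset m} {u v : Fin m} → Reach E X u v → u ∈ X
Reach-start (Reach.here i) = i
Reach-start (Reach.step i _ _) = i
Reach-closed cl u∈C (Reach.here _) = u∈C
Reach-closed cl u∈C (Reach.step _ e r) = Reach-closed cl (cl u∈C (Reach-start r) e) r

Reach-map : {E F : Fin m → Fin m → Set} {X Y : Subset m} → X ⊆ Y →
  (∀ {a b} → a ∈ X → b ∈ X → E a b → F a b) → ∀ {u v} → Reach E X u v → Reach F Y u v
Reach-map X⊆Y h (Reach.here i) = Reach.here (X⊆Y i)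
Reach-map X⊆Y h (Reach.step i e r) = Reach.step (X⊆Y i) (h i (Reach-start r) e) (Reach-map X⊆Y h r)

Reach-trans : {E : Fin m → Fin m → Set} {X : Subset m} {u v w : Fin m} →
  Reach E X u v → Reach E X v w → Reach E X u w
Reach-trans (Reach.here _) r = r
Reach-trans (Reach.step i e r′) r = Reach.step i e (Reach-trans r′ r)

Reach-sym : {E : Fin m → Fin m → Set} {X : Subset m} → (∀ {a b} → E a b → E b a) →
  ∀ {u v} → Reach E X u v → Reach E X v u
Reach-sym E-sym (Reach.here i) = Reach.here i
Reach-sym E-sym (Reach.step i e r) = Reach-snoc (Reach-sym E-sym r) i (E-sym e)

module _ {E : Fin m → Fin m → Set} (E? : ∀ u v → Dec (E u v)) (X : Subset m) where

  -- `reach` runs inside `C` itself, so for symmetric `E` the set is connected and, by `closed`, a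
  -- component of `X`.
  record Closure (u : Fin m) : Set where
    field
      C      : Subset m
      C⊆X    : C ⊆ X
      u∈C    : u ∈ C
      reach  : ∀ {v} → v ∈ C → Reach E C u v
      closed : ∀ {a b} → a ∈ C → b ∈ X → E a b → b ∈ C

  closure : ∀ {u} → u ∈ X → Closure u
  closure {u} u∈X = grow ∣ X ∣ ⁅ u ⁆ (p⊆q⇒∣p∣≤∣q∣ (p─q⊆p X ⁅ u ⁆))
    (λ i → subst (_∈ X) (sym (x∈⁅y⁆⇒x≡y u i)) u∈X) (x∈⁅x⁆ u)
    (λ i → subst (Reach E ⁅ u ⁆ u) (sym (x∈⁅y⁆⇒x≡y u i)) (Reach.here (x∈⁅x⁆ u)))
    where
    grow : ∀ j C → ∣ X ─ C ∣ ≤ j → C ⊆ X → u ∈ C → (∀ {v} → v ∈ C → Reach E C u v) → Closure u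
    grow j C ≤j C⊆X u∈C r
      with any? (λ a → any? (λ b → (a ∈? C) ×-dec (b ∈? X) ×-dec E? a b ×-dec ¬? (b ∈? C)))
    ... | no ¬e = record { C = C ; C⊆X = C⊆X ; u∈C = u∈C ; reach = r ; closed = cl }
      where
      cl : ∀ {a b} → a ∈ C → b ∈ X → E a b → b ∈ C
      cl {a} {b} a∈ b∈ e with b ∈? C
      ... | yes b∈C = b∈C
      ... | no b∉C = ⊥-elim (¬e (a , b , a∈ , b∈ , e , b∉C))
    grow zero C ≤0 _ _ _ | yes (a , b , _ , b∈ , _ , b∉) = ⊥-elim (<⇒≱ (∈⇒1≤ (∈─⁺ {q = C} b∈ b∉)) ≤0)
    grow (suc j) C ≤j C⊆X u∈C r | yes (a , b , a∈ , b∈ , e , b∉) =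
      grow j (C ∪ ⁅ b ⁆) smaller
        (λ i → [ C⊆X , (λ i → subst (_∈ X) (sym (x∈⁅y⁆⇒x≡y b i)) b∈) ]′ (∈∪⁻ {p = C} i))
        (∈∪ˡ u∈C)
        (λ i → [ (λ i → Reach-map ∈∪ˡ (λ _ _ e → e) (r i))
               , (λ i → subst (Reach E _ u) (sym (x∈⁅y⁆⇒x≡y b i))
                   (Reach-snoc (Reach-map ∈∪ˡ (λ _ _ e → e) (r a∈)) (∈∪ʳ {p = C} (x∈⁅x⁆ b)) e)) ]′ (∈∪⁻ {p = C} i))
      where
      smaller : ∣ X ─ (C ∪ ⁅ b ⁆) ∣ ≤ j
      smaller = ≤-pred (≤-trans (≤-trans (s≤s (p⊆q⇒∣p∣≤∣q∣ sub))
        (≤-reflexive (sym (∣─⁅⁆∣ (X ─ C) (∈─⁺ {q = C} b∈ b∉))))) ≤j)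
        where
        sub : X ─ (C ∪ ⁅ b ⁆) ⊆ (X ─ C) - b
        sub i with ∈─⁻ {p = X} i
        ... | i∈X , i∉ = ∈─⁺ (∈─⁺ i∈X (i∉ ∘ ∈∪ˡ)) (i∉ ∘ ∈∪ʳ {p = C})

  record Cut : Set where
    field
      C        : Subset m
      C⊆X      : C ⊆ X
      {u v}    : Fin m
      u∈C      : u ∈ C
      v∈X      : v ∈ X
      v∉C      : v ∉ C
      closed   : ∀ {a b} → a ∈ C → b ∈ X → E a b → b ∈ C

  -- Turns a failure of connectedness into a concrete closed part, to which the dichotomy of small
  -- sets can be applied.
  connected-or-cut : Connected E X ⊎ Cut
  connected-or-cut
    with any? (λ u → any? (λ v → u∈X×v∉closure u v))
    where
    Bad : Fin m → Fin m → Set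
    Bad u v = Σ (u ∈ X) λ u∈X → v ∈ X × v ∉ Closure.C (closure u∈X)
    u∈X×v∉closure : ∀ u v → Dec (Bad u v)
    u∈X×v∉closure u v with u ∈? X | v ∈? X
    ... | no u∉ | _ = no (u∉ ∘ proj₁)
    ... | yes _ | no v∉ = no (v∉ ∘ proj₁ ∘ proj₂)
    ... | yes u∈ | yes v∈ with v ∈? Closure.C (closure u∈)
    ... | no v∉C = yes (u∈ , v∈ , v∉C)
    ... | yes v∈C = no λ (u∈′ , _ , v∉) →
      v∉ (Reach-closed (Closure.closed (closure u∈′)) (Closure.u∈C (closure u∈′))
        (Reach-map (Closure.C⊆X (closure u∈)) (λ _ _ e → e) (Closure.reach (closure u∈) v∈C)))
  ... | yes (u , v , u∈X , v∈X , v∉) = inj₂ record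
    { C = C ; C⊆X = C⊆X ; u∈C = u∈C ; v∈X = v∈X ; v∉C = v∉ ; closed = closed }
    where open Closure (closure u∈X)
  ... | no ¬bad = inj₁ λ u v u∈ v∈ → reach′ u v u∈ v∈
    where
    reach′ : ∀ u v → u ∈ X → v ∈ X → Reach E X u v
    reach′ u v u∈ v∈ with v ∈? Closure.C (closure u∈)
    ... | yes v∈C = Reach-map (Closure.C⊆X (closure u∈)) (λ _ _ e → e) (Closure.reach (closure u∈) v∈C)
    ... | no v∉C = ⊥-elim (¬bad (u , v , u∈ , v∈ , v∉C))

-- Systems

module _ (P : Subset m) {E : Fin m → Fin m → Set} (E? : ∀ u v → Dec (E u v)) (Q : Subset m) where

  Neighbour : Fin m → Set
  Neighbour v = v ∈ P × v ∉ Q × ∃[ u ] (u ∈ Q × E u v)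

  neighbour? : ∀ v → Dec (Neighbour v)
  neighbour? v = (v ∈? P) ×-dec ¬? (v ∈? Q) ×-dec any? (λ u → (u ∈? Q) ×-dec E? u v)

  abstract
    neighbours : Subset m
    neighbours = ⟪ neighbour? ⟫

    neighbours⁺ : ∀ {v} → Neighbour v → v ∈ neighbours
    neighbours⁺ = ∈⟪⟫⁺ neighbour?

    neighbours⁻ : ∀ {v} → v ∈ neighbours → Neighbour v
    neighbours⁻ = ∈⟪⟫⁻ neighbour?

-- In the system of a tangle, Small Q says that the separation (Q ∪ N Q , V ∖ Q) belongs to the tangle.
record System (m : ℕ) : Set₁ where
  no-eta-equality
  field
    P        : Subset m
    E        : Fin m → Fin m → Set
    E?       : ∀ u v → Dec (E u v)
    E-sym    : ∀ {u v} → E u v → E v u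
    E-irrefl : ∀ {v} → ¬ E v v
    Small    : Subset m → Set

  N : Subset m → Subset m
  N Q = neighbours P E? Q

  N⁺ : ∀ Q {v} → v ∈ P × v ∉ Q × ∃[ u ] (u ∈ Q × E u v) → v ∈ N Q
  N⁺ Q = neighbours⁺ P E? Q

  N⁻ : ∀ Q {v} → v ∈ N Q → v ∈ P × v ∉ Q × ∃[ u ] (u ∈ Q × E u v)
  N⁻ Q = neighbours⁻ P E? Q

  rest : Subset m → Subset m
  rest Q = (P ∖ Q) ∖ N Q

  -- What is kept of 3-connectivity and of the tangle. Lower bounds on neighbourhoods are kept
  -- inside small sets, and the three-set axiom is kept in the forms `down`, `union`, `dich` and
  -- `proper`, each of which passes to contractions.
  field
    small⊆P : ∀ {Q} → Small Q → Q ⊆ P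
    N≤3     : ∀ {Q} → Small Q → ∣ N Q ∣ ≤ 3
    N≥3     : ∀ {Q Q′ v} → Small Q → Q′ ⊆ Q → v ∈ Q′ → 3 ≤ ∣ N Q′ ∣
    down    : ∀ {Q Q′} → Small Q → Q′ ⊆ Q → ∣ N Q′ ∣ ≤ 3 → Small Q′
    union   : ∀ {Q Q′} → Small Q → Small Q′ → ∣ N (Q ∪ Q′) ∣ ≤ 3 → Small (Q ∪ Q′)
    dich    : ∀ Q → Q ⊆ P → ∣ N Q ∣ ≤ 3 → Small Q ⊎ Small (rest Q)
    proper  : ∀ {Q} → Small Q → ∃[ v ] v ∈ rest Q

  rest⁺ : ∀ Q {v} → v ∈ P → v ∉ Q → v ∉ N Q → v ∈ rest Q
  rest⁺ Q a b c = ∈∖⁺ (∈∖⁺ a b) c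

  rest⁻ : ∀ Q {v} → v ∈ rest Q → v ∈ P × v ∉ Q × v ∉ N Q
  rest⁻ Q i with ∈∖⁻ {p = P ∖ Q} i
  ... | j , c with ∈∖⁻ {p = P} j
  ... | a , b = a , b , c

  N⊆P : ∀ Q → N Q ⊆ P
  N⊆P Q i = proj₁ (N⁻ Q i)

  N-disjoint : ∀ Q {v} → v ∈ N Q → v ∉ Q
  N-disjoint Q i = proj₁ (proj₂ (N⁻ Q i))

  N-union : ∀ Q R → N (Q ∪ R) ⊆ N Q ∪ N R
  N-union Q R i with N⁻ (Q ∪ R) i
  ... | v∈P , v∉ , u , u∈ , e with ∈∪⁻ {p = Q} u∈
  ... | inj₁ u∈Q = ∈∪ˡ (N⁺ Q (v∈P , v∉ ∘ ∈∪ˡ , u , u∈Q , e))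
  ... | inj₂ u∈R = ∈∪ʳ {p = N Q} (N⁺ R (v∈P , v∉ ∘ ∈∪ʳ {p = Q} , u , u∈R , e))

  -- Inclusion-exclusion on both sides reduces the inequality to two inclusions, one for being
  -- counted at all and one for being counted twice.
  N-submodular : ∀ Q R → ∣ N (Q ∪ R) ∣ + ∣ N (Q ∩ R) ∣ ≤ ∣ N Q ∣ + ∣ N R ∣
  N-submodular Q R = begin
    ∣ N (Q ∪ R) ∣ + ∣ N (Q ∩ R) ∣                     ≡⟨ sym (∣p∪q∣+∣p∩q∣ (N (Q ∪ R)) (N (Q ∩ R))) ⟩
    ∣ N (Q ∪ R) ∪ N (Q ∩ R) ∣ + ∣ N (Q ∪ R) ∩ N (Q ∩ R) ∣
      ≤⟨ +-mono-≤ (p⊆q⇒∣p∣≤∣q∣ ∪-sub) (p⊆q⇒∣p∣≤∣q∣ ∩-sub) ⟩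
    ∣ N Q ∪ N R ∣ + ∣ N Q ∩ N R ∣                     ≡⟨ ∣p∪q∣+∣p∩q∣ (N Q) (N R) ⟩
    ∣ N Q ∣ + ∣ N R ∣                                 ∎
    where
    open ≤-Reasoning
    ∪-sub : N (Q ∪ R) ∪ N (Q ∩ R) ⊆ N Q ∪ N R
    ∪-sub {v} i with ∈∪⁻ {p = N (Q ∪ R)} i
    ... | inj₁ j = N-union Q R j
    ... | inj₂ j with N⁻ (Q ∩ R) j
    ... | v∈P , v∉ , u , u∈ , e with ∈∩⁻ {p = Q} u∈ | v ∈? Q
    ... | u∈Q , _ | no v∉Q = ∈∪ˡ (N⁺ Q (v∈P , v∉Q , u , u∈Q , e))
    ... | _ , u∈R | yes v∈Q = ∈∪ʳ {p = N Q} (N⁺ R (v∈P , (λ v∈R → v∉ (∈∩⁺ v∈Q v∈R)) , u , u∈R , e))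
    ∩-sub : N (Q ∪ R) ∩ N (Q ∩ R) ⊆ N Q ∩ N R
    ∩-sub i with ∈∩⁻ {p = N (Q ∪ R)} i
    ... | j , j′ with N⁻ (Q ∪ R) j | N⁻ (Q ∩ R) j′
    ... | v∈P , v∉ , _ | _ , _ , u , u∈ , e with ∈∩⁻ {p = Q} u∈
    ... | u∈Q , u∈R = ∈∩⁺ (N⁺ Q (v∈P , v∉ ∘ ∈∪ˡ , u , u∈Q , e)) (N⁺ R (v∈P , v∉ ∘ ∈∪ʳ {p = Q} , u , u∈R , e))

  N-rest : ∀ Q → N (rest Q) ⊆ N Q
  N-rest Q {v} i with N⁻ (rest Q) i
  ... | v∈P , v∉ , u , u∈ , e with rest⁻ Q u∈ | v ∈? N Q | v ∈? Q
  ... | _ | yes v∈N | _ = v∈N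
  ... | _ | no v∉N | no v∉Q = ⊥-elim (v∉ (rest⁺ Q v∈P v∉Q v∉N))
  ... | u∈P , u∉Q , u∉N | no _ | yes v∈Q = ⊥-elim (u∉N (N⁺ Q (u∈P , u∉Q , v , v∈Q , E-sym e)))

  Small-resp : ∀ {Q Q′} → Small Q → Q ⊆ Q′ → Q′ ⊆ Q → Small Q′
  Small-resp s a b = subst Small (⊆-antisym a b) s

  -- For a small nonempty `R` the negation says that `R` is a single vertex whose three neighbours
  -- are pairwise non-adjacent, so that `R ∪ N R` induces a claw.
  NonClaw : Subset m → Set
  NonClaw R = (∃[ u ] ∃[ v ] (u ∈ R × v ∈ R × u ≢ v)) ⊎ (∃[ u ] ∃[ v ] (u ∈ N R × v ∈ N R × E u v))

  record Reducible (R : Subset m) : Set where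
    constructor reducible
    field
      small    : Small R
      nonempty : ∃[ v ] v ∈ R
      nonclaw  : NonClaw R

  Normal : Set
  Normal = ∀ R → ¬ Reducible R

  N≡3 : ∀ {Q v} → Small Q → v ∈ Q → ∣ N Q ∣ ≡ 3
  N≡3 s v∈Q = ≤-antisym (N≤3 s) (N≥3 s id v∈Q)

-- Contracting a small set

module Lifting (H : System m) (R : Subset m) where
  open System H

  Touches : Subset m → Set
  Touches Q = ∃[ w ] (w ∈ Q × w ∈ N R)

  -- lift Q puts R back on the side of Q; the neighbours of Q after contracting R are those of
  -- lift Q before (N′≡N-lift).
  Lifted : Subset m → Fin m → Set
  Lifted Q v = v ∈ Q ⊎ (v ∈ R × Touches Q)

  Lifted? : ∀ Q v → Dec (Lifted Q v)
  Lifted? Q v = (v ∈? Q) ⊎-dec ((v ∈? R) ×-dec meets? Q (N R))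

  abstract
    lift : Subset m → Subset m
    lift Q = ⟪ Lifted? Q ⟫

    lift⁺ : ∀ Q {v} → Lifted Q v → v ∈ lift Q
    lift⁺ Q = ∈⟪⟫⁺ (Lifted? Q)

    lift⁻ : ∀ Q {v} → v ∈ lift Q → Lifted Q v
    lift⁻ Q = ∈⟪⟫⁻ (Lifted? Q)

  lift-mono : ∀ {Q Q′} → Q ⊆ Q′ → lift Q ⊆ lift Q′
  lift-mono {Q} {Q′} s i with lift⁻ Q i
  ... | inj₁ v∈Q = lift⁺ Q′ (inj₁ (s v∈Q))
  ... | inj₂ (v∈R , w , w∈Q , w∈N) = lift⁺ Q′ (inj₂ (v∈R , w , s w∈Q , w∈N))

  P′ : Subset m
  P′ = P ∖ R

  E′ : Fin m → Fin m → Set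
  E′ u v = E u v ⊎ (u ≢ v × u ∈ N R × v ∈ N R)

  abstract
    E′? : ∀ u v → Dec (E′ u v)
    E′? u v = E? u v ⊎-dec (¬? (u ≟ v) ×-dec (u ∈? N R) ×-dec (v ∈? N R))

module Quotient (H : System m) (R : Subset m) (R-small : System.Small H R) where
  open System H
  open Lifting H R public

  NR⊆P′ : N R ⊆ P′
  NR⊆P′ i = ∈∖⁺ (N⊆P R i) (N-disjoint R i)

  lift⊆P : ∀ {Q} → Q ⊆ P′ → lift Q ⊆ P
  lift⊆P {Q} s i with lift⁻ Q i
  ... | inj₁ v∈Q = proj₁ (∈∖⁻ {p = P} (s v∈Q))
  ... | inj₂ (v∈R , _) = small⊆P R-small v∈R

  N′ : Subset m → Subset m
  N′ Q = neighbours P′ E′? Q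

  N′⊆ : ∀ {Q} → N′ Q ⊆ N (lift Q)
  N′⊆ {Q} i with neighbours⁻ P′ E′? Q i
  ... | v∈P′ , v∉Q , u , u∈Q , e with ∈∖⁻ {p = P} v∈P′
  ... | v∈P , v∉R = N⁺ (lift Q) (v∈P , v∉lift , adjacent e)
    where
    v∉lift : _ ∉ lift Q
    v∉lift j with lift⁻ Q j
    ... | inj₁ v∈Q = v∉Q v∈Q
    ... | inj₂ (v∈R , _) = v∉R v∈R
    adjacent : E′ u _ → ∃[ u ] (u ∈ lift Q × E u _)
    adjacent (inj₁ e) = u , lift⁺ Q (inj₁ u∈Q) , e
    adjacent (inj₂ (_ , u∈N , v∈N)) with N⁻ R v∈N
    ... | _ , _ , w , w∈R , e = w , lift⁺ Q (inj₂ (w∈R , u , u∈Q , u∈N)) , e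

  N′⊇ : ∀ {Q} → Q ⊆ P′ → N (lift Q) ⊆ N′ Q
  N′⊇ {Q} Q⊆P′ {v} i with N⁻ (lift Q) i
  ... | v∈P , v∉ , w , w∈ , e = neighbours⁺ P′ E′? Q (∈∖⁺ v∈P v∉R , v∉ ∘ lift⁺ Q ∘ inj₁ , adjacent (lift⁻ Q w∈))
    where
    v∉R : v ∉ R
    v∉R v∈R with lift⁻ Q w∈
    ... | inj₂ (_ , t) = v∉ (lift⁺ Q (inj₂ (v∈R , t)))
    ... | inj₁ w∈Q with ∈∖⁻ {p = P} (Q⊆P′ w∈Q)
    ... | w∈P , w∉R = v∉ (lift⁺ Q (inj₂ (v∈R , w , w∈Q , N⁺ R (w∈P , w∉R , v , v∈R , E-sym e))))
    adjacent : Lifted Q w → ∃[ u ] (u ∈ Q × E′ u v)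
    adjacent (inj₁ w∈Q) = w , w∈Q , inj₁ e
    adjacent (inj₂ (w∈R , z , z∈Q , z∈N)) =
      z , z∈Q , inj₂ ((λ { refl → v∉ (lift⁺ Q (inj₁ z∈Q)) }) , z∈N , N⁺ R (v∈P , v∉R , w , w∈R , e))

  N′≡N-lift : ∀ {Q} → Q ⊆ P′ → N′ Q ≡ N (lift Q)
  N′≡N-lift Q⊆P′ = ⊆-antisym N′⊆ (N′⊇ Q⊆P′)

  -- By `N′≡N-lift` a set and its lift have the same neighbours, so each law of the new system
  -- follows from the old law for lifts.
  Small′ : Subset m → Set
  Small′ Q = Q ⊆ P′ × Small (lift Q)

  private
    rest′ : Subset m → Subset m
    rest′ Q = (P′ ∖ Q) ∖ N′ Q

    rest′⁻ : ∀ Q {v} → v ∈ rest′ Q → v ∈ P′ × v ∉ Q × v ∉ N′ Q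
    rest′⁻ Q i with ∈∖⁻ {p = P′ ∖ Q} i
    ... | j , c with ∈∖⁻ {p = P′} j
    ... | a , b = a , b , c

    E′-sym : ∀ {u v} → E′ u v → E′ v u
    E′-sym (inj₁ e) = inj₁ (E-sym e)
    E′-sym (inj₂ (ne , a , b)) = inj₂ (ne ∘ sym , b , a)

    E′-irrefl : ∀ {v} → ¬ E′ v v
    E′-irrefl (inj₁ e) = E-irrefl e
    E′-irrefl (inj₂ (ne , _)) = ne refl

    N≥3′ : ∀ {Q Q′ v} → Small′ Q → Q′ ⊆ Q → v ∈ Q′ → 3 ≤ ∣ N′ Q′ ∣
    N≥3′ {Q′ = Q′} (Q⊆P′ , s) Q′⊆Q v∈ =
      ≤-trans (N≥3 s (lift-mono Q′⊆Q) (lift⁺ Q′ (inj₁ v∈))) (p⊆q⇒∣p∣≤∣q∣ (N′⊇ λ i → Q⊆P′ (Q′⊆Q i)))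

    down′ : ∀ {Q Q′} → Small′ Q → Q′ ⊆ Q → ∣ N′ Q′ ∣ ≤ 3 → Small′ Q′
    down′ {Q} {Q′} (Q⊆P′ , s) Q′⊆Q ≤3 =
      Q′⊆P′ , down s (lift-mono Q′⊆Q) (≤-trans (p⊆q⇒∣p∣≤∣q∣ (N′⊇ Q′⊆P′)) ≤3)
      where
      Q′⊆P′ : Q′ ⊆ P′
      Q′⊆P′ i = Q⊆P′ (Q′⊆Q i)

    union′ : ∀ {Q Q′} → Small′ Q → Small′ Q′ → ∣ N′ (Q ∪ Q′) ∣ ≤ 3 → Small′ (Q ∪ Q′)
    union′ {Q} {Q′} (Q⊆ , s) (Q′⊆ , s′) ≤3 =
      ∪⊆P′ , subst Small lift-∪ (union s s′ (subst (λ X → ∣ N X ∣ ≤ 3) (sym lift-∪)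
        (≤-trans (p⊆q⇒∣p∣≤∣q∣ (N′⊇ ∪⊆P′)) ≤3)))
      where
      ∪⊆P′ : Q ∪ Q′ ⊆ P′
      ∪⊆P′ i = [ Q⊆ , Q′⊆ ]′ (∈∪⁻ {p = Q} i)
      lift-∪ : lift Q ∪ lift Q′ ≡ lift (Q ∪ Q′)
      lift-∪ = ⊆-antisym
        (λ i → [ lift-mono ∈∪ˡ , lift-mono (∈∪ʳ {p = Q}) ]′ (∈∪⁻ {p = lift Q} i)) from
        where
        from : lift (Q ∪ Q′) ⊆ lift Q ∪ lift Q′
        from i with lift⁻ (Q ∪ Q′) i
        ... | inj₁ j = [ ∈∪ˡ ∘ lift⁺ Q ∘ inj₁ , ∈∪ʳ {p = lift Q} ∘ lift⁺ Q′ ∘ inj₁ ]′ (∈∪⁻ {p = Q} j)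
        ... | inj₂ (v∈R , w , w∈ , w∈N) with ∈∪⁻ {p = Q} w∈
        ... | inj₁ w∈Q = ∈∪ˡ (lift⁺ Q (inj₂ (v∈R , w , w∈Q , w∈N)))
        ... | inj₂ w∈Q′ = ∈∪ʳ {p = lift Q} (lift⁺ Q′ (inj₂ (v∈R , w , w∈Q′ , w∈N)))

    -- `N R` has become a clique, so `Q` and what lies beyond its neighbours cannot both meet `N R`.
    -- At most one of the two lifts therefore contains `R`, and the lift of the far part stays in
    -- `rest (lift Q)`.
    dich′ : ∀ Q → Q ⊆ P′ → ∣ N′ Q ∣ ≤ 3 → Small′ Q ⊎ Small′ (rest′ Q)
    dich′ Q Q⊆P′ ≤3 with dich (lift Q) (lift⊆P Q⊆P′) (≤-trans (p⊆q⇒∣p∣≤∣q∣ (N′⊇ Q⊆P′)) ≤3)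
    ... | inj₁ s = inj₁ (Q⊆P′ , s)
    ... | inj₂ s = inj₂ (C⊆P′ , down s C^⊆ (≤-trans (p⊆q⇒∣p∣≤∣q∣ (N′⊇ C⊆P′)) (≤-trans (p⊆q⇒∣p∣≤∣q∣ NC⊆) ≤3)))
      where
      C : Subset m
      C = rest′ Q
      C⊆P′ : C ⊆ P′
      C⊆P′ i = proj₁ (rest′⁻ Q i)
      NC⊆ : N′ C ⊆ N′ Q
      NC⊆ {v} i with neighbours⁻ P′ E′? C i
      ... | v∈P′ , v∉C , u , u∈C , e with rest′⁻ Q u∈C | v ∈? N′ Q | v ∈? Q
      ... | _ | yes j | _ = j
      ... | _ | no v∉N | no v∉Q = ⊥-elim (v∉C (∈∖⁺ (∈∖⁺ v∈P′ v∉Q) v∉N))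
      ... | u∈P′ , u∉Q , u∉N | no _ | yes v∈Q =
        ⊥-elim (u∉N (neighbours⁺ P′ E′? Q (u∈P′ , u∉Q , v , v∈Q , E′-sym e)))
      C^⊆ : lift C ⊆ rest (lift Q)
      C^⊆ {v} i with lift⁻ C i
      ... | inj₁ v∈C with rest′⁻ Q v∈C
      ... | v∈P′ , v∉Q , v∉N = rest⁺ (lift Q) (proj₁ (∈∖⁻ {p = P} v∈P′)) v∉lift (v∉N ∘ N′⊇ Q⊆P′)
        where
        v∉lift : v ∉ lift Q
        v∉lift j with lift⁻ Q j
        ... | inj₁ v∈Q = v∉Q v∈Q
        ... | inj₂ (v∈R , _) = proj₂ (∈∖⁻ {p = P} v∈P′) v∈R
      C^⊆ {v} i | inj₂ (v∈R , z , z∈C , z∈NR) with rest′⁻ Q z∈C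
      ... | z∈P′ , z∉Q , z∉N = rest⁺ (lift Q) (small⊆P R-small v∈R) v∉lift
        λ j → proj₂ (∈∖⁻ {p = P} (proj₁ (neighbours⁻ P′ E′? Q (N′⊇ Q⊆P′ j)))) v∈R
        where
        v∉lift : v ∉ lift Q
        v∉lift j with lift⁻ Q j
        ... | inj₁ v∈Q = proj₂ (∈∖⁻ {p = P} (Q⊆P′ v∈Q)) v∈R
        ... | inj₂ (_ , w , w∈Q , w∈NR) =
          z∉N (neighbours⁺ P′ E′? Q (z∈P′ , z∉Q , w , w∈Q , inj₂ ((λ { refl → z∉Q w∈Q }) , w∈NR , z∈NR)))

    -- If `Q` and its neighbours filled `P′`, a vertex beyond `lift Q` would lie in `R`, so `Q`
    -- would avoid `N R`. Then `R ∪ lift Q` has no neighbours beyond those of `lift Q`, is small by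
    -- `union`, and leaves nothing over, against `proper`.
    proper′ : ∀ {Q} → Small′ Q → ∃[ v ] v ∈ rest′ Q
    proper′ {Q} (Q⊆P′ , s) with inhabited? (rest′ Q)
    ... | yes r = r
    ... | no ¬r with proper s
    ... | v , v∈ with rest⁻ (lift Q) v∈ | v ∈? R
    ... | v∈P , v∉Q , v∉N | no v∉R =
      ⊥-elim (¬r (v , ∈∖⁺ (∈∖⁺ (∈∖⁺ v∈P v∉R) (v∉Q ∘ lift⁺ Q ∘ inj₁)) (v∉N ∘ N′⊆)))
    ... | v∈P , v∉Q , v∉N | yes v∈R = ⊥-elim (contra (proper (union R-small s ∪≤3)))
      where
      covered : ∀ {w} → w ∈ P′ → w ∉ Q → w ∈ N (lift Q)
      covered {w} w∈P′ w∉Q with w ∈? N′ Q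
      ... | yes i = N′⊆ i
      ... | no i = ⊥-elim (¬r (w , ∈∖⁺ (∈∖⁺ w∈P′ w∉Q) i))
      ∪⊆ : N (R ∪ lift Q) ⊆ N (lift Q)
      ∪⊆ {w} i with ∈∪⁻ {p = N R} (N-union R (lift Q) i)
      ... | inj₂ j = j
      ... | inj₁ j = covered (NR⊆P′ j) λ w∈Q → v∉Q (lift⁺ Q (inj₂ (v∈R , w , w∈Q , j)))
      ∪≤3 : ∣ N (R ∪ lift Q) ∣ ≤ 3
      ∪≤3 = ≤-trans (p⊆q⇒∣p∣≤∣q∣ ∪⊆) (N≤3 s)
      contra : ∃[ w ] w ∈ rest (R ∪ lift Q) → ⊥
      contra (w , w∈) with rest⁻ (R ∪ lift Q) w∈
      ... | w∈P , w∉ , w∉N with N⁻ (lift Q) (covered (∈∖⁺ w∈P (w∉ ∘ ∈∪ˡ)) (w∉ ∘ ∈∪ʳ {p = R} ∘ lift⁺ Q ∘ inj₁))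
      ... | _ , _ , u , u∈ , e = w∉N (N⁺ (R ∪ lift Q) (w∈P , w∉ , u , ∈∪ʳ {p = R} u∈ , e))

  system : System m
  system .System.P = P′
  system .System.E = E′
  system .System.E? = E′?
  system .System.E-sym = E′-sym
  system .System.E-irrefl = E′-irrefl
  system .System.Small = Small′
  system .System.small⊆P = proj₁
  system .System.N≤3 (Q⊆P′ , s) = ≤-trans (p⊆q⇒∣p∣≤∣q∣ N′⊆) (N≤3 s)
  system .System.N≥3 = N≥3′
  system .System.down = down′
  system .System.union = union′
  system .System.dich = dich′
  system .System.proper = proper′

_/_ : (H : System m) {R : Subset m} → System.Small H R → System m
H / s = Quotient.system H _ s

-- Isomorphisms of systems

open System using (P; E; Small; N; Reducible; reducible; Normal)

-- One direction of an isomorphism, so that symmetric situations need one proof. The image of a set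
-- under `to` is written as its preimage under the inverse `from`, which keeps it a decidable
-- subset.
record Half (H K : System m) (to from : Fin m → Fin m) : Set where
  field
    P→ : ∀ {v} → v ∈ P H → to v ∈ P K
    E→ : ∀ {u v} → u ∈ P H → v ∈ P H → E H u v → E K (to u) (to v)
    S→ : ∀ {Q} → Small H Q → Small K (pre from Q)

-- The maps permute all of `Fin m`, including vertices already removed from `P`; so preimages
-- compose and cancel without side conditions.
record Iso (H K : System m) : Set where
  field
    to from : Fin m → Fin m
    from∘to : ∀ v → from (to v) ≡ v
    to∘from : ∀ v → to (from v) ≡ v
    forth   : Half H K to from
    back    : Half K H from to

Iso-sym : {H K : System m} → Iso H K → Iso K H
Iso-sym i = record { to = from ; from = to ; from∘to = to∘from ; to∘from = from∘to ; forth = back ; back = forth }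
  where open Iso i

pre-∘ : (f g : Fin m → Fin m) (Q : Subset m) → pre f (pre g Q) ≡ pre (g ∘ f) Q
pre-∘ f g Q = ⊆-antisym (λ i → ∈pre⁺ (g ∘ f) Q (∈pre⁻ g Q (∈pre⁻ f (pre g Q) i)))
  (λ i → ∈pre⁺ f (pre g Q) (∈pre⁺ g Q (∈pre⁻ (g ∘ f) Q i)))

pre-id : (f : Fin m → Fin m) → (∀ v → f v ≡ v) → (Q : Subset m) → pre f Q ≡ Q
pre-id f f≗id Q = ⊆-antisym (λ {v} i → subst (_∈ Q) (f≗id v) (∈pre⁻ f Q i))
  (λ {v} i → ∈pre⁺ f Q (subst (_∈ Q) (sym (f≗id v)) i))

Half-trans : {H K L : System m} {to from to′ from′ : Fin m → Fin m} →
  Half H K to from → Half K L to′ from′ → Half H L (to′ ∘ to) (from ∘ from′)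
Half-trans {L = L} {from = from} {from′ = from′} a b = record
  { P→ = λ i → Half.P→ b (Half.P→ a i)
  ; E→ = λ i j e → Half.E→ b (Half.P→ a i) (Half.P→ a j) (Half.E→ a i j e)
  ; S→ = λ {Q} s → subst (Small L) (pre-∘ from′ from Q) (Half.S→ b (Half.S→ a s)) }

Iso-trans : {H K L : System m} → Iso H K → Iso K L → Iso H L
Iso-trans i j = record
  { to = J.to ∘ I.to ; from = I.from ∘ J.from
  ; from∘to = λ v → trans (cong I.from (J.from∘to (I.to v))) (I.from∘to v)
  ; to∘from = λ v → trans (cong J.to (I.to∘from (J.from v))) (J.to∘from v)
  ; forth = Half-trans I.forth J.forth ; back = Half-trans J.back I.back }
  where
  module I = Iso i
  module J = Iso j

Half-id : {H K : System m} → P H ⊆ P K → (∀ {u v} → u ∈ P H → v ∈ P H → E H u v → E K u v) →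
  (∀ {Q} → Small H Q → Small K Q) → Half H K id id
Half-id {K = K} p e s = record
  { P→ = p ; E→ = e ; S→ = λ {Q} h → subst (Small K) (sym (pre-id id (λ _ → refl) Q)) (s h) }

Iso-id : {H K : System m} → Half H K id id → Half K H id id → Iso H K
Iso-id a b = record { to = id ; from = id ; from∘to = λ _ → refl ; to∘from = λ _ → refl ; forth = a ; back = b }

module _ {H K : System m} (i : Iso H K) where
  open Iso i
  private
    module F = Half forth
    module B = Half back

  pre-from⊆P : ∀ {Q} → Q ⊆ P H → pre from Q ⊆ P K
  pre-from⊆P {Q} Q⊆P {v} j = subst (_∈ P K) (to∘from v) (F.P→ (Q⊆P (∈pre⁻ from Q j)))

  ∈pre-from : ∀ {Q v} → v ∈ Q → to v ∈ pre from Q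
  ∈pre-from {Q} {v} v∈Q = ∈pre⁺ from Q (subst (_∈ Q) (sym (from∘to v)) v∈Q)

  N-iso : ∀ {Q} → Q ⊆ P H → N K (pre from Q) ≡ pre from (N H Q)
  N-iso {Q} Q⊆P = ⊆-antisym forwards backwards
    where
    forwards : N K (pre from Q) ⊆ pre from (N H Q)
    forwards j with System.N⁻ K (pre from Q) j
    ... | v∈P , v∉ , u , u∈ , e = ∈pre⁺ from (N H Q) (System.N⁺ H Q
      (B.P→ v∈P , (v∉ ∘ ∈pre⁺ from Q) , from u , ∈pre⁻ from Q u∈ , B.E→ (pre-from⊆P Q⊆P u∈) v∈P e))
    backwards : pre from (N H Q) ⊆ N K (pre from Q)
    backwards {v} j with System.N⁻ H Q (∈pre⁻ from (N H Q) j)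
    ... | v∈P , v∉ , u , u∈ , e = System.N⁺ K (pre from Q)
      ( subst (_∈ P K) (to∘from v) (F.P→ v∈P) , v∉ ∘ ∈pre⁻ from Q , to u , ∈pre-from u∈
      , subst (E K (to u)) (to∘from v) (F.E→ (Q⊆P u∈) v∈P e) )

  Reducible-iso : ∀ {R} → Reducible H R → Reducible K (pre from R)
  Reducible-iso {R} (reducible s (v , v∈) nc) = reducible (F.S→ s) (to v , ∈pre-from v∈) (nonclaw nc)
    where
    ∈N : ∀ {v} → v ∈ N H R → to v ∈ N K (pre from R)
    ∈N v∈ = subst (to _ ∈_) (sym (N-iso (System.small⊆P H s))) (∈pre-from v∈)
    nonclaw : System.NonClaw H R → System.NonClaw K (pre from R)
    nonclaw (inj₁ (u , v , u∈ , v∈ , u≢v)) = inj₁ (to u , to v , ∈pre-from u∈ , ∈pre-from v∈ ,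
      λ e → u≢v (trans (sym (from∘to u)) (trans (cong from e) (from∘to v))))
    nonclaw (inj₂ (u , v , u∈ , v∈ , e)) =
      inj₂ (to u , to v , ∈N u∈ , ∈N v∈ , F.E→ (System.N⊆P H R u∈) (System.N⊆P H R v∈) e)

  -- The equation for `R*` is a hypothesis because the backward half needs `R* = R`, which is
  -- `pre to (pre from R)` only by `pre-∘` and `pre-id`.
  Half-/ : ∀ {R R*} (s : Small H R) (s* : Small K R*) → R* ≡ pre from R → Half (H / s) (K / s*) to from
  Half-/ {R} s s* refl = record
    { P→ = P→′
    ; E→ = λ { i j (inj₁ e) → inj₁ (F.E→ (proj₁ (∈∖⁻ {p = P H} i)) (proj₁ (∈∖⁻ {p = P H} j)) e)
             ; i j (inj₂ (u≢v , u∈ , v∈)) →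
                 inj₂ ((λ e → u≢v (trans (sym (from∘to _)) (trans (cong from e) (from∘to _)))) , ∈N u∈ , ∈N v∈) }
    ; S→ = S→′ }
    where
    module Q₁ = Quotient H R s
    module Q₂ = Quotient K (pre from R) s*
    ∈N : ∀ {v} → v ∈ N H R → to v ∈ N K (pre from R)
    ∈N v∈ = subst (to _ ∈_) (sym (N-iso (System.small⊆P H s))) (∈pre-from v∈)
    P→′ : ∀ {v} → v ∈ P H ∖ R → to v ∈ P K ∖ pre from R
    P→′ i with ∈∖⁻ {p = P H} i
    ... | v∈P , v∉R = ∈∖⁺ (F.P→ v∈P) λ j → v∉R (subst (_∈ R) (from∘to _) (∈pre⁻ from R j))
    S→′ : ∀ {Q} → Q₁.Small′ Q → Q₂.Small′ (pre from Q)
    S→′ {Q} (Q⊆P′ , sQ) = pre⊆ , System.Small-resp K (F.S→ sQ) lift⊆ lift⊇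
      where
      pre⊆ : pre from Q ⊆ P K ∖ pre from R
      pre⊆ {v} i = subst (_∈ P K ∖ pre from R) (to∘from v) (P→′ (Q⊆P′ (∈pre⁻ from Q i)))
      lift⊆ : pre from (Q₁.lift Q) ⊆ Q₂.lift (pre from Q)
      lift⊆ {v} i with Q₁.lift⁻ Q (∈pre⁻ from (Q₁.lift Q) i)
      ... | inj₁ j = Q₂.lift⁺ (pre from Q) (inj₁ (∈pre⁺ from Q j))
      ... | inj₂ (j , w , w∈Q , w∈N) = Q₂.lift⁺ (pre from Q)
        (inj₂ (∈pre⁺ from R j , to w , ∈pre-from w∈Q , ∈N w∈N))
      lift⊇ : Q₂.lift (pre from Q) ⊆ pre from (Q₁.lift Q)
      lift⊇ {v} i with Q₂.lift⁻ (pre from Q) i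
      ... | inj₁ j = ∈pre⁺ from (Q₁.lift Q) (Q₁.lift⁺ Q (inj₁ (∈pre⁻ from Q j)))
      ... | inj₂ (j , w , w∈Q , w∈N) = ∈pre⁺ from (Q₁.lift Q) (Q₁.lift⁺ Q
        (inj₂ (∈pre⁻ from R j , from w , ∈pre⁻ from Q w∈Q ,
               ∈pre⁻ from (N H R) (subst (w ∈_) (N-iso (System.small⊆P H s)) w∈N))))

Iso-/ : {H K : System m} (i : Iso H K) {R : Subset m} (s : Small H R) (s* : Small K (pre (Iso.from i) R)) →
  Iso (H / s) (K / s*)
Iso-/ i {R} s s* = record
  { to = to ; from = from ; from∘to = from∘to ; to∘from = to∘from
  ; forth = Half-/ i s s* refl
  ; back = Half-/ (Iso-sym i) s* s (sym (trans (pre-∘ to from R) (pre-id (from ∘ to) from∘to R))) }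
  where open Iso i

-- Reduction sequences

infix 4 _⇒*_

data _⇒*_ {m : ℕ} : System m → System m → Set₁ where
  done : ∀ {H T} → Iso H T → H ⇒* T
  step : ∀ {H T R} (r : Reducible H R) → (H / Reducible.small r) ⇒* T → H ⇒* T

transport : {H K T : System m} → Iso H K → H ⇒* T → K ⇒* T
transport i (done j) = done (Iso-trans (Iso-sym i) j)
transport i (step r rest) =
  step (Reducible-iso i r) (transport (Iso-/ i (Reducible.small r) (Reducible.small (Reducible-iso i r))) rest)

infix 4 _⇒?_

_⇒?_ : System m → System m → Set
H ⇒? K = Iso H K ⊎ Σ (Subset _) λ R → Σ (Reducible H R) λ r → Iso (H / Reducible.small r) K

⇒?-⇒* : {H K T : System m} → H ⇒? K → K ⇒* T → H ⇒* T
⇒?-⇒* (inj₁ i) t = transport (Iso-sym i) t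
⇒?-⇒* (inj₂ (_ , r , i)) t = step r (transport (Iso-sym i) t)

-- Confluence

Iso-refl : {H : System m} → Iso H H
Iso-refl = Iso-id (Half-id id (λ _ _ e → e) id) (Half-id id (λ _ _ e → e) id)

⇒?-Iso : {H K L : System m} → H ⇒? K → Iso K L → H ⇒? L
⇒?-Iso (inj₁ i) j = inj₁ (Iso-trans i j)
⇒?-Iso (inj₂ (R , r , i)) j = inj₂ (R , r , Iso-trans i j)

Joinable : System m → System m → Set₁
Joinable {m} H H′ = Σ (System m) λ K → H ⇒? K × H′ ⇒? K

∣p∣≤1+∣p-x∣ : (p : Subset m) (x : Fin m) → ∣ p ∣ ≤ suc ∣ p - x ∣
∣p∣≤1+∣p-x∣ p x with x ∈? p
... | yes i = ≤-reflexive (∣─⁅⁆∣ p i)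
... | no i = ≤-trans (p⊆q⇒∣p∣≤∣q∣ {q = p - x} λ j → x∈p∧x≢y⇒x∈p-y j λ { refl → i j }) (n≤1+n _)

module Nested⊆ {H : System m} {R M : Subset m} (R-small : Small H R) (M-small : Small H M) (R⊆M : R ⊆ M)
  (R-nonempty : ∃[ v ] v ∈ R) where
  open System H using (N⁺; N⁻; small⊆P; N≥3; N≤3; down; E-sym; Small-resp)
  open Quotient H R R-small using (lift; lift⁺; lift⁻; N′≡N-lift; P′)

  D : Subset m
  D = M ∖ R

  D⊆P′ : D ⊆ P′
  D⊆P′ i with ∈∖⁻ {p = M} i
  ... | v∈M , v∉R = ∈∖⁺ (small⊆P M-small v∈M) v∉R

  lift-D⊆M : lift D ⊆ M
  lift-D⊆M i with lift⁻ D i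
  ... | inj₁ j = proj₁ (∈∖⁻ {p = M} j)
  ... | inj₂ (v∈R , _) = R⊆M v∈R

  N-lift-D⊆ : N H (lift D) ⊆ N H M
  N-lift-D⊆ {v} i with N⁻ (lift D) i
  ... | v∈P , v∉ , w , w∈ , e = N⁺ M (v∈P , v∉M , w , lift-D⊆M w∈ , e)
    where
    v∉M : v ∉ M
    v∉M v∈M with v ∈? R
    ... | no v∉R = v∉ (lift⁺ D (inj₁ (∈∖⁺ v∈M v∉R)))
    ... | yes v∈R with lift⁻ D w∈
    ... | inj₂ (_ , t) = v∉ (lift⁺ D (inj₂ (v∈R , t)))
    ... | inj₁ w∈D with ∈∖⁻ {p = M} w∈D
    ... | w∈M , w∉R =
      v∉ (lift⁺ D (inj₂ (v∈R , w , w∈D , N⁺ R (small⊆P M-small w∈M , w∉R , v , v∈R , E-sym e))))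

  D-small : Small (H / R-small) D
  D-small = D⊆P′ , down M-small lift-D⊆M (≤-trans (p⊆q⇒∣p∣≤∣q∣ N-lift-D⊆) (N≤3 M-small))

  N-D : ∀ {d} → d ∈ D → N (H / R-small) D ≡ N H M
  N-D d∈D = trans (N′≡N-lift D⊆P′)
    (squeeze N-lift-D⊆ (N≥3 M-small lift-D⊆M (lift⁺ D (inj₁ d∈D))) (N≤3 M-small))

  -- If `D` is a single `d`, at least two of the three vertices of `N R` differ from `d`. They lie
  -- in `N H M`, the neighbourhood of `D`, and the contraction of `R` has made them adjacent.
  D-reducible : ∃[ d ] d ∈ D → Reducible (H / R-small) D
  D-reducible (d , d∈D) = reducible D-small (d , d∈D) nonclaw
    where
    nonclaw : System.NonClaw (H / R-small) D
    nonclaw with any? (λ d′ → (d′ ∈? D) ×-dec ¬? (d′ ≟ d))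
    ... | yes (d′ , d′∈D , d′≢d) = inj₁ (d′ , d , d′∈D , d∈D , d′≢d)
    ... | no only-d with pick₂ (N H R - d)
                           (≤-pred (≤-trans (N≥3 R-small id (proj₂ R-nonempty)) (∣p∣≤1+∣p-x∣ (N H R) d)))
    ... | u , v , u∈ , v∈ , u≢v with ∈-⁻ {p = N H R} u∈ | ∈-⁻ {p = N H R} v∈
    ... | u∈N , u≢d | v∈N , v≢d = inj₂ (u , v , ∈N-D u∈N u≢d , ∈N-D v∈N v≢d , inj₂ (u≢v , u∈N , v∈N))
      where
      ∈N-D : ∀ {w} → w ∈ N H R → w ≢ d → w ∈ N (H / R-small) D
      ∈N-D {w} w∈N w≢d with N⁻ R w∈N | w ∈? M
      ... | _ , w∉R , _ | yes w∈M = ⊥-elim (only-d (w , ∈∖⁺ w∈M w∉R , w≢d))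
      ... | w∈P , _ , r , r∈R , e | no w∉M = subst (w ∈_) (sym (N-D d∈D)) (N⁺ M (w∈P , w∉M , r , R⊆M r∈R , e))

  module _ {d} (d∈D : d ∈ D) where
    private
      module Q₂ = Quotient (H / R-small) D D-small

      NR⊆D∪NM : ∀ {w} → w ∈ N H R → w ∈ D ⊎ w ∈ N H M
      NR⊆D∪NM {w} w∈N with N⁻ R w∈N | w ∈? M
      ... | _ , w∉R , _ | yes w∈M = inj₁ (∈∖⁺ w∈M w∉R)
      ... | w∈P , _ , r , r∈R , e | no w∉M = inj₂ (N⁺ M (w∈P , w∉M , r , R⊆M r∈R , e))

      module Q₃ = Quotient H M M-small

      P⊆ : Q₂.P′ ⊆ Q₃.P′
      P⊆ i with ∈∖⁻ {p = P′} i
      ... | j , v∉D with ∈∖⁻ {p = P H} j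
      ... | v∈P , v∉R = ∈∖⁺ v∈P λ v∈M → v∉D (∈∖⁺ v∈M v∉R)

      P⊇ : Q₃.P′ ⊆ Q₂.P′
      P⊇ i with ∈∖⁻ {p = P H} i
      ... | v∈P , v∉M = ∈∖⁺ (∈∖⁺ v∈P (v∉M ∘ R⊆M)) λ j → v∉M (proj₁ (∈∖⁻ {p = M} j))

      ∈NM : ∀ {v} → v ∈ Q₂.P′ → v ∈ N H R → v ∈ N H M
      ∈NM v∈ v∈N with NR⊆D∪NM v∈N
      ... | inj₂ j = j
      ... | inj₁ j = ⊥-elim (proj₂ (∈∖⁻ {p = P′} v∈) j)

      E⊆ : ∀ {u v} → u ∈ Q₂.P′ → v ∈ Q₂.P′ → Q₂.E′ u v → Q₃.E′ u v
      E⊆ _ _ (inj₁ (inj₁ e)) = inj₁ e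
      E⊆ i j (inj₁ (inj₂ (u≢v , a , b))) = inj₂ (u≢v , ∈NM i a , ∈NM j b)
      E⊆ _ _ (inj₂ (u≢v , a , b)) = inj₂ (u≢v , subst (_ ∈_) (N-D d∈D) a , subst (_ ∈_) (N-D d∈D) b)

      E⊇ : ∀ {u v} → Q₃.E′ u v → Q₂.E′ u v
      E⊇ (inj₁ e) = inj₁ (inj₁ e)
      E⊇ (inj₂ (u≢v , a , b)) = inj₂ (u≢v , subst (_ ∈_) (sym (N-D d∈D)) a , subst (_ ∈_) (sym (N-D d∈D)) b)

      lift⊆ : ∀ {Q} → Q ⊆ Q₂.P′ → lift (Q₂.lift Q) ⊆ Q₃.lift Q
      lift⊆ {Q} Q⊆ i with lift⁻ (Q₂.lift Q) i
      lift⊆ {Q} Q⊆ i | inj₁ j with Q₂.lift⁻ Q j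
      ... | inj₁ v∈Q = Q₃.lift⁺ Q (inj₁ v∈Q)
      ... | inj₂ (v∈D , w , w∈Q , w∈N) =
        Q₃.lift⁺ Q (inj₂ (proj₁ (∈∖⁻ {p = M} v∈D) , w , w∈Q , subst (w ∈_) (N-D d∈D) w∈N))
      lift⊆ {Q} Q⊆ i | inj₂ (v∈R , w , w∈ , w∈N) with Q₂.lift⁻ Q w∈
      ... | inj₁ w∈Q = Q₃.lift⁺ Q (inj₂ (R⊆M v∈R , w , w∈Q , ∈NM (Q⊆ w∈Q) w∈N))
      ... | inj₂ (_ , z , z∈Q , z∈N) =
        Q₃.lift⁺ Q (inj₂ (R⊆M v∈R , z , z∈Q , subst (z ∈_) (N-D d∈D) z∈N))

      lift⊇ : ∀ {Q} → Q₃.lift Q ⊆ lift (Q₂.lift Q)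
      lift⊇ {Q} {v} i with Q₃.lift⁻ Q i
      ... | inj₁ v∈Q = lift⁺ (Q₂.lift Q) (inj₁ (Q₂.lift⁺ Q (inj₁ v∈Q)))
      ... | inj₂ (v∈M , w , w∈Q , w∈N) = split (v ∈? R)
        where
        w∈N-D : w ∈ N (H / R-small) D
        w∈N-D = subst (w ∈_) (sym (N-D d∈D)) w∈N
        split : Dec (v ∈ R) → v ∈ lift (Q₂.lift Q)
        split (no v∉R) = lift⁺ (Q₂.lift Q) (inj₁ (Q₂.lift⁺ Q (inj₂ (∈∖⁺ v∈M v∉R , w , w∈Q , w∈N-D))))
        split (yes v∈R) with meets? D (N H R)
        ... | yes (z , z∈D , z∈N) =
          lift⁺ (Q₂.lift Q) (inj₂ (v∈R , z , Q₂.lift⁺ Q (inj₂ (z∈D , w , w∈Q , w∈N-D)) , z∈N))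
        -- If `D` avoids `N R`, then all of `N R` lies in `N M`. Counting makes the two equal, so
        -- `w` itself touches `R`.
        ... | no ¬meet = lift⁺ (Q₂.lift Q) (inj₂ (v∈R , w , Q₂.lift⁺ Q (inj₁ w∈Q) , NM⊆NR w∈N))
          where
          NM⊆NR : N H M ⊆ N H R
          NM⊆NR = ⊆∧≥⇒⊇ (λ {z} j → [ (λ z∈D → ⊥-elim (¬meet (z , z∈D , j))) , id ]′ (NR⊆D∪NM j))
            (≤-trans (N≤3 M-small) (N≥3 R-small id (proj₂ R-nonempty)))

    collapse : Iso ((H / R-small) / D-small) (H / M-small)
    collapse = Iso-id
      (Half-id P⊆ E⊆ λ { (Q⊆ , _ , s) → (λ i → P⊆ (Q⊆ i)) , Small-resp s (lift⊆ Q⊆) lift⊇ })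
      (Half-id P⊇ (λ _ _ → E⊇) λ { (Q⊆ , s) → (λ i → P⊇ (Q⊆ i))
        , Quotient.lift⊆P (H / R-small) D D-small (λ i → P⊇ (Q⊆ i))
        , Small-resp s lift⊇ (lift⊆ λ i → P⊇ (Q⊆ i)) })

  join : (H / R-small) ⇒? (H / M-small)
  join with inhabited? D
  ... | yes d = inj₂ (D , D-reducible d , collapse (proj₂ d))
  ... | no ¬d = inj₁ (same (⊆-antisym R⊆M M⊆R))
    where
    M⊆R : M ⊆ R
    M⊆R {v} v∈M with v ∈? R
    ... | yes v∈R = v∈R
    ... | no v∉R = ⊥-elim (¬d (v , ∈∖⁺ v∈M v∉R))
    same : ∀ {M} {M-small : Small H M} → R ≡ M → Iso (H / R-small) (H / M-small)
    same refl = Iso-id (Half-id id (λ _ _ e → e) id) (Half-id id (λ _ _ e → e) id)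

-- Meeting `N R` is the only way in which `lift` could enlarge `S`. Here `lift S` is `S`, so
-- smallness and neighbours survive the contraction of `R`.
module Far {H : System m} {R S : Subset m} (R-small : Small H R) (S-small : Small H S)
  (disjoint : ∀ {v} → v ∈ R → v ∈ S → ⊥) (apart : ∀ {v} → v ∈ S → v ∈ N H R → ⊥) where
  open Quotient H R R-small

  lift-S⊆ : lift S ⊆ S
  lift-S⊆ i with lift⁻ S i
  ... | inj₁ j = j
  ... | inj₂ (_ , w , w∈S , w∈N) = ⊥-elim (apart w∈S w∈N)

  S⊆lift : S ⊆ lift S
  S⊆lift i = lift⁺ S (inj₁ i)

  S⊆P′ : S ⊆ P′
  S⊆P′ i = ∈∖⁺ (System.small⊆P H S-small i) λ j → disjoint j i

  small : Small (H / R-small) S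
  small = S⊆P′ , System.Small-resp H S-small S⊆lift lift-S⊆

  N-S : N (H / R-small) S ≡ N H S
  N-S = trans (N′≡N-lift S⊆P′) (cong (N H) (⊆-antisym lift-S⊆ S⊆lift))

  reducible-S : Reducible H S → Reducible (H / R-small) S
  reducible-S (reducible _ ne nc) = reducible small ne (nonclaw nc)
    where
    nonclaw : System.NonClaw H S → System.NonClaw (H / R-small) S
    nonclaw (inj₁ two) = inj₁ two
    nonclaw (inj₂ (u , v , u∈ , v∈ , e)) =
      inj₂ (u , v , subst (u ∈_) (sym N-S) u∈ , subst (v ∈_) (sym N-S) v∈ , inj₁ e)

module _ {H : System m} {R S : Subset m} (R-small : Small H R) (S-small : Small H S)
  (disjoint : ∀ {v} → v ∈ R → v ∈ S → ⊥)
  (apart : ∀ {v} → v ∈ S → v ∈ N H R → ⊥) (apart′ : ∀ {v} → v ∈ R → v ∈ N H S → ⊥) where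
  private
    module RS = Far {H = H} R-small S-small disjoint apart
    module SR = Far {H = H} S-small R-small (λ i j → disjoint j i) apart′
    module A = Quotient H R R-small
    module B = Quotient (H / R-small) S RS.small
    module A′ = Quotient H S S-small
    module B′ = Quotient (H / S-small) R SR.small

  Half-far : Half ((H / R-small) / RS.small) ((H / S-small) / SR.small) id id
  Half-far = Half-id P⊆ (λ _ _ → E⊆) λ { {Q} (Q⊆ , _ , s) →
      (λ i → P⊆ (Q⊆ i)) , B′.lift⊆P (λ i → P⊆ (Q⊆ i)) , System.Small-resp H s (lift⊆ {Q}) (lift⊇ {Q}) }
    where
    P⊆ : B.P′ ⊆ B′.P′
    P⊆ i with ∈∖⁻ {p = A.P′} i
    ... | j , v∉S with ∈∖⁻ {p = P H} j
    ... | v∈P , v∉R = ∈∖⁺ (∈∖⁺ v∈P v∉S) v∉R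
    E⊆ : ∀ {u v} → B.E′ u v → B′.E′ u v
    E⊆ (inj₁ (inj₁ e)) = inj₁ (inj₁ e)
    E⊆ (inj₁ (inj₂ (u≢v , a , b))) = inj₂ (u≢v , subst (_ ∈_) (sym SR.N-S) a , subst (_ ∈_) (sym SR.N-S) b)
    E⊆ (inj₂ (u≢v , a , b)) = inj₁ (inj₂ (u≢v , subst (_ ∈_) RS.N-S a , subst (_ ∈_) RS.N-S b))
    lift⊆ : ∀ {Q} → A.lift (B.lift Q) ⊆ A′.lift (B′.lift Q)
    lift⊆ {Q} i with A.lift⁻ (B.lift Q) i
    lift⊆ {Q} i | inj₁ j with B.lift⁻ Q j
    ... | inj₁ v∈Q = A′.lift⁺ (B′.lift Q) (inj₁ (B′.lift⁺ Q (inj₁ v∈Q)))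
    ... | inj₂ (v∈S , w , w∈Q , w∈N) =
      A′.lift⁺ (B′.lift Q) (inj₂ (v∈S , w , B′.lift⁺ Q (inj₁ w∈Q) , subst (w ∈_) RS.N-S w∈N))
    lift⊆ {Q} i | inj₂ (v∈R , w , w∈ , w∈N) with B.lift⁻ Q w∈
    ... | inj₁ w∈Q =
      A′.lift⁺ (B′.lift Q) (inj₁ (B′.lift⁺ Q (inj₂ (v∈R , w , w∈Q , subst (w ∈_) (sym SR.N-S) w∈N))))
    ... | inj₂ (w∈S , _) = ⊥-elim (apart w∈S w∈N)
    lift⊇ : ∀ {Q} → A′.lift (B′.lift Q) ⊆ A.lift (B.lift Q)
    lift⊇ {Q} i with A′.lift⁻ (B′.lift Q) i
    lift⊇ {Q} i | inj₁ j with B′.lift⁻ Q j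
    ... | inj₁ v∈Q = A.lift⁺ (B.lift Q) (inj₁ (B.lift⁺ Q (inj₁ v∈Q)))
    ... | inj₂ (v∈R , w , w∈Q , w∈N) =
      A.lift⁺ (B.lift Q) (inj₂ (v∈R , w , B.lift⁺ Q (inj₁ w∈Q) , subst (w ∈_) SR.N-S w∈N))
    lift⊇ {Q} i | inj₂ (v∈S , w , w∈ , w∈N) with B′.lift⁻ Q w∈
    ... | inj₁ w∈Q =
      A.lift⁺ (B.lift Q) (inj₁ (B.lift⁺ Q (inj₂ (v∈S , w , w∈Q , subst (w ∈_) (sym RS.N-S) w∈N))))
    ... | inj₂ (w∈R , _) = ⊥-elim (apart′ w∈R w∈N)

-- xy is the only edge between R and S. Contracting R and then S′ = S ∖ y keeps y, contracting S and
-- then R ∖ x keeps x; in both cases the survivor is adjacent to exactly A ∪ B (Edge-K).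
record Crossing (H : System m) (R S : Subset m) (x y : Fin m) : Set where
  field
    disjoint   : ∀ {v} → v ∈ R → v ∈ S → ⊥
    x∈R        : x ∈ R
    y∈S        : y ∈ S
    x∈NS       : x ∈ N H S
    y∈NR       : y ∈ N H R
    only-x     : ∀ {v} → v ∈ R → v ∈ N H S → v ≡ x
    only-y     : ∀ {v} → v ∈ S → v ∈ N H R → v ≡ y
    N-disjoint : ∀ {v} → v ∈ N H R → v ∈ N H S → ⊥

Crossing-sym : {H : System m} {R S : Subset m} {x y : Fin m} → Crossing H R S x y → Crossing H S R y x
Crossing-sym c = record
  { disjoint = λ i j → disjoint j i ; x∈R = y∈S ; y∈S = x∈R ; x∈NS = y∈NR ; y∈NR = x∈NS
  ; only-x = only-y ; only-y = only-x ; N-disjoint = λ i j → N-disjoint j i }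
  where open Crossing c

module Cross {H : System m} {R S : Subset m} {x y : Fin m}
  (R-red : Reducible H R) (S-red : Reducible H S) (c : Crossing H R S x y) where
  open System H using (N⁺; N⁻; small⊆P; N≥3; N≡3; down; E-sym; E-irrefl)
  open Reducible R-red public using () renaming (small to R-small)
  open Reducible S-red using () renaming (small to S-small; nonclaw to S-nonclaw)
  open Crossing c
  open Quotient H R R-small using (lift; lift⁺; lift⁻; N′≡N-lift; P′)

  S′ : Subset m
  S′ = S ∖ ⁅ y ⁆

  S′⁺ : ∀ {v} → v ∈ S → v ≢ y → v ∈ S′
  S′⁺ i ne = ∈∖⁺ i λ j → ne (x∈⁅y⁆⇒x≡y y j)

  S′⁻ : ∀ {v} → v ∈ S′ → v ∈ S × v ≢ y
  S′⁻ i with ∈∖⁻ {p = S} i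
  ... | v∈S , v∉ = v∈S , λ { refl → v∉ (x∈⁅x⁆ y) }

  A B : Subset m
  A = N H R - y
  B = N H S - x

  A⁻ : ∀ {v} → v ∈ A → v ∈ N H R × v ≢ y
  A⁻ = ∈-⁻ {p = N H R}

  B⁻ : ∀ {v} → v ∈ B → v ∈ N H S × v ≢ x
  B⁻ = ∈-⁻ {p = N H S}

  ∣B∣≡2 : ∣ B ∣ ≡ 2
  ∣B∣≡2 = suc-injective (trans (sym (∣─⁅⁆∣ (N H S) x∈NS)) (N≡3 S-small y∈S))

  third : ∀ {p q r} → p ≢ q → p ≢ r → q ≢ r → p ∈ B → q ∈ B → r ∈ B → ⊥
  third {p} pq pr qr p∈ q∈ r∈ = <⇒≱ (s≤s (≢⇒2≤ (B - p) (x∈p∧x≢y⇒x∈p-y q∈ (pq ∘ sym))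
    (x∈p∧x≢y⇒x∈p-y r∈ (pr ∘ sym)) qr)) (≤-reflexive (trans (sym (∣─⁅⁆∣ B p∈)) ∣B∣≡2))

  S′⊆P′ : S′ ⊆ P′
  S′⊆P′ i with S′⁻ i
  ... | v∈S , _ = ∈∖⁺ (small⊆P S-small v∈S) λ j → disjoint j v∈S

  S′-apart : ∀ {v} → v ∈ S′ → v ∈ N H R → ⊥
  S′-apart i j with S′⁻ i
  ... | v∈S , v≢y = v≢y (only-y v∈S j)

  lift-S′⊆ : lift S′ ⊆ S′
  lift-S′⊆ i with lift⁻ S′ i
  ... | inj₁ j = j
  ... | inj₂ (_ , w , w∈ , w∈N) = ⊥-elim (S′-apart w∈ w∈N)

  lift-S′≡ : lift S′ ≡ S′
  lift-S′≡ = ⊆-antisym lift-S′⊆ λ i → lift⁺ S′ (inj₁ i)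

  N-S′⊆ : N H S′ ⊆ B ∪ ⁅ y ⁆
  N-S′⊆ {v} i with N⁻ S′ i | v ≟ y
  ... | _ | yes refl = ∈∪ʳ {p = B} (x∈⁅x⁆ y)
  ... | v∈P , v∉S′ , s , s∈S′ , e | no v≢y =
    ∈∪ˡ (x∈p∧x≢y⇒x∈p-y (N⁺ S (v∈P , (λ j → v∉S′ (S′⁺ j v≢y)) , s , s∈S , e)) v≢x)
    where
    s∈S : s ∈ S
    s∈S = proj₁ (S′⁻ s∈S′)
    v≢x : v ≢ x
    v≢x refl = S′-apart s∈S′ (N⁺ R (small⊆P S-small s∈S , (λ j → disjoint j s∈S) , v , x∈R , E-sym e))

  ∣B∪y∣≤3 : ∣ B ∪ ⁅ y ⁆ ∣ ≤ 3
  ∣B∪y∣≤3 = ≤-trans (∣p∪q∣≤ B ⁅ y ⁆) (≤-reflexive (cong₂ _+_ ∣B∣≡2 (∣⁅x⁆∣≡1 y)))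

  S′-down : Small H S′
  S′-down = down S-small (λ i → proj₁ (S′⁻ i)) (≤-trans (p⊆q⇒∣p∣≤∣q∣ N-S′⊆) ∣B∪y∣≤3)

  S′-small : Small (H / R-small) S′
  S′-small = S′⊆P′ , subst (Small H) (sym lift-S′≡) S′-down

  N′-S′ : N (H / R-small) S′ ≡ N H S′
  N′-S′ = trans (N′≡N-lift S′⊆P′) (cong (N H) lift-S′≡)

  N-S′ : ∀ {s} → s ∈ S′ → N (H / R-small) S′ ≡ B ∪ ⁅ y ⁆
  N-S′ s∈ = trans N′-S′ (squeeze N-S′⊆ (N≥3 S-small (λ i → proj₁ (S′⁻ i)) s∈) ∣B∪y∣≤3)

  y∈N-S′ : ∀ {s} → s ∈ S′ → y ∈ N (H / R-small) S′
  y∈N-S′ s∈ = subst (y ∈_) (sym (N-S′ s∈)) (∈∪ʳ {p = B} (x∈⁅x⁆ y))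

  B⊆N-S′ : ∀ {s} → s ∈ S′ → B ⊆ N (H / R-small) S′
  B⊆N-S′ s∈ i = subst (_ ∈_) (sym (N-S′ s∈)) (∈∪ˡ i)

  N-S′⁻ : ∀ {v} → v ∈ N (H / R-small) S′ → v ∈ B ⊎ v ≡ y
  N-S′⁻ i with ∈∪⁻ {p = B} (N-S′⊆ (subst (_ ∈_) N′-S′ i))
  ... | inj₁ j = inj₁ j
  ... | inj₂ j = inj₂ (x∈⁅y⁆⇒x≡y y j)

  K : System m
  K = (H / R-small) / S′-small

  private
    module Q₂ = Quotient (H / R-small) S′ S′-small

  -- If `S′` is a single `s`, the required edge starts at `y`: since `⁅ y ⁆` lies in the small `S`,
  -- there are three neighbours of `y`, hence one besides `x` and `s`, and it belongs to `B`. Both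
  -- `y` and `B` are in the neighbourhood of `S′`.
  S′-reducible : ∃[ s ] s ∈ S′ → Reducible (H / R-small) S′
  S′-reducible (s , s∈) = reducible S′-small (s , s∈) nonclaw
    where
    nonclaw : System.NonClaw (H / R-small) S′
    nonclaw with any? (λ s′ → (s′ ∈? S′) ×-dec ¬? (s′ ≟ s))
    ... | yes (s′ , s′∈ , ne) = inj₁ (s′ , s , s′∈ , s∈ , ne)
    ... | no only-s
      with pick-outside (N H ⁅ y ⁆) (⁅ x ⁆ ∪ ⁅ s ⁆)
        (≤-trans (s≤s (≤-trans (∣p∪q∣≤ ⁅ x ⁆ ⁅ s ⁆) (≤-reflexive (cong₂ _+_ (∣⁅x⁆∣≡1 x) (∣⁅x⁆∣≡1 s)))))
          (N≥3 S-small (λ i → subst (_∈ S) (sym (x∈⁅y⁆⇒x≡y y i)) y∈S) (x∈⁅x⁆ y)))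
    ... | b , b∈N , b∉ with N⁻ ⁅ y ⁆ b∈N
    ... | b∈P , b∉y , u , u∈ , e with x∈⁅y⁆⇒x≡y y u∈
    ... | refl = inj₂ (y , b , y∈N-S′ s∈ , B⊆N-S′ s∈ b∈B , inj₁ e)
      where
      b∉S : b ∉ S
      b∉S b∈S with b ≟ s
      ... | yes refl = b∉ (∈∪ʳ {p = ⁅ x ⁆} (x∈⁅x⁆ b))
      ... | no b≢s = only-s (b , S′⁺ b∈S (λ { refl → b∉y (x∈⁅x⁆ b) }) , b≢s)
      b∈B : b ∈ B
      b∈B = x∈p∧x≢y⇒x∈p-y (N⁺ S (b∈P , b∉S , y , y∈S , e)) λ { refl → b∉ (∈∪ˡ (x∈⁅x⁆ b)) }

  reduces : (H / R-small) ⇒? K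
  reduces with inhabited? S′
  ... | yes s = inj₂ (S′ , S′-reducible s , Iso-refl)
  ... | no ¬s = inj₁ (Iso-id
    (Half-id (λ i → ∈∖⁺ i λ j → ¬s (_ , j)) (λ _ _ → inj₁)
      λ (Q⊆ , s) → (λ i → ∈∖⁺ (Q⊆ i) λ j → ¬s (_ , j))
        , System.Small-resp (H / R-small) (Q⊆ , s) (Q₂.lift⁺ _ ∘ inj₁) lift⊆)
    (Half-id (λ i → proj₁ (∈∖⁻ {p = P′} i)) (λ { _ _ (inj₁ e) → e ; _ _ (inj₂ (_ , i , _)) → ⊥-elim (no-N i) })
      λ (Q⊆ , s) → System.Small-resp (H / R-small) s lift⊆ (Q₂.lift⁺ _ ∘ inj₁)))
    where
    lift⊆ : ∀ {Q} → Q₂.lift Q ⊆ Q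
    lift⊆ {Q} i with Q₂.lift⁻ Q i
    ... | inj₁ j = j
    ... | inj₂ (j , _) = ⊥-elim (¬s (_ , j))
    no-N : ∀ {v} → v ∉ N (H / R-small) S′
    no-N i with System.N⁻ (H / R-small) S′ i
    ... | _ , _ , s , s∈ , _ = ¬s (s , s∈)

  P-K⁻ : ∀ {v} → v ∈ P K → v ∈ P H × v ∉ R × v ∉ S′
  P-K⁻ i with ∈∖⁻ {p = P′} i
  ... | j , v∉S′ with ∈∖⁻ {p = P H} j
  ... | v∈P , v∉R = v∈P , v∉R , v∉S′

  P-K⁺ : ∀ {v} → v ∈ P H → v ∉ R → v ∉ S′ → v ∈ P K
  P-K⁺ a b c = ∈∖⁺ (∈∖⁺ a b) c

  -- `A` and `B` play equal roles here, so exchanging `R` with `S` only exchanges constructors in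
  -- pairs.
  data Edge-K : Fin m → Fin m → Set where
    hub-A  : ∀ {v} → v ∈ A → Edge-K y v
    hub-B  : ∀ {v} → v ∈ B → Edge-K y v
    A-hub  : ∀ {v} → v ∈ A → Edge-K v y
    B-hub  : ∀ {v} → v ∈ B → Edge-K v y
    edge   : ∀ {u v} → u ≢ y → v ≢ y → E H u v → Edge-K u v
    edge-A : ∀ {u v} → u ≢ v → u ∈ A → v ∈ A → Edge-K u v
    edge-B : ∀ {u v} → u ≢ v → u ∈ B → v ∈ B → Edge-K u v

  private
    nbr-y : ∀ {v} → v ∈ P K → E H y v → v ∈ B
    nbr-y {v} i e with P-K⁻ i
    ... | v∈P , v∉R , v∉S′ = x∈p∧x≢y⇒x∈p-y
      (N⁺ S (v∈P , (λ j → v∉S′ (S′⁺ j λ { refl → E-irrefl e })) , y , y∈S , e)) λ { refl → v∉R x∈R }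

  E-K⇒ : ∀ {u v} → u ∈ P K → v ∈ P K → E K u v → Edge-K u v
  E-K⇒ {u} {v} i j (inj₁ (inj₁ e)) with u ≟ y | v ≟ y
  ... | yes refl | _ = hub-B (nbr-y j e)
  ... | no _ | yes refl = B-hub (nbr-y i (E-sym e))
  ... | no u≢y | no v≢y = edge u≢y v≢y e
  E-K⇒ {u} {v} i j (inj₁ (inj₂ (u≢v , a , b))) with u ≟ y | v ≟ y
  ... | yes refl | _ = hub-A (x∈p∧x≢y⇒x∈p-y b (u≢v ∘ sym))
  ... | no u≢y | yes refl = A-hub (x∈p∧x≢y⇒x∈p-y a u≢y)
  ... | no u≢y | no v≢y = edge-A u≢v (x∈p∧x≢y⇒x∈p-y a u≢y) (x∈p∧x≢y⇒x∈p-y b v≢y)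
  E-K⇒ i j (inj₂ (u≢v , a , b)) with N-S′⁻ a | N-S′⁻ b
  ... | inj₁ a′ | inj₁ b′ = edge-B u≢v a′ b′
  ... | inj₁ a′ | inj₂ refl = B-hub a′
  ... | inj₂ refl | inj₁ b′ = hub-B b′
  ... | inj₂ refl | inj₂ refl = ⊥-elim (u≢v refl)

  y≢B : ∀ {v} → v ∈ B → y ≢ v
  y≢B v∈B refl = proj₁ (proj₂ (N⁻ S (proj₁ (B⁻ v∈B)))) y∈S

  E-K⇐ : ∀ {u v} → Edge-K u v → E K u v
  E-K⇐ (hub-A a) with A⁻ a
  ... | v∈N , v≢y = inj₁ (inj₂ (v≢y ∘ sym , y∈NR , v∈N))
  E-K⇐ (A-hub a) with A⁻ a
  ... | v∈N , v≢y = inj₁ (inj₂ (v≢y , v∈N , y∈NR))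
  E-K⇐ (edge _ _ e) = inj₁ (inj₁ e)
  E-K⇐ (edge-A u≢v a b) = inj₁ (inj₂ (u≢v , proj₁ (A⁻ a) , proj₁ (A⁻ b)))
  E-K⇐ (hub-B b) with inhabited? S′
  ... | yes (_ , s∈) = inj₂ (y≢B b , y∈N-S′ s∈ , B⊆N-S′ s∈ b)
  ... | no ¬s with N⁻ S (proj₁ (B⁻ b))
  ... | _ , _ , u , u∈S , e with u ≟ y
  ... | yes refl = inj₁ (inj₁ e)
  ... | no u≢y = ⊥-elim (¬s (u , S′⁺ u∈S u≢y))
  E-K⇐ (B-hub b) = System.E-sym K (E-K⇐ (hub-B b))
  E-K⇐ {u} {v} (edge-B u≢v a b) with inhabited? S′
  ... | yes (_ , s∈) = inj₂ (u≢v , B⊆N-S′ s∈ a , B⊆N-S′ s∈ b)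
  -- Here `S` is only `y`, and the absence of a claw enters: it gives an edge inside `N S`. The edge
  -- misses `x`, whose neighbours lie in `R` or in `N R` and hence not in `N S`; so it joins the two
  -- vertices of `B`.
  ... | no ¬s with S-nonclaw
  ... | inj₁ (p , q , p∈ , q∈ , p≢q) = ⊥-elim (p≢q (trans (≡y p∈) (sym (≡y q∈))))
    where
    ≡y : ∀ {s} → s ∈ S → s ≡ y
    ≡y {s} i with s ≟ y
    ... | yes e = e
    ... | no ne = ⊥-elim (¬s (s , S′⁺ i ne))
  ... | inj₂ (p , q , p∈ , q∈ , e) = pq-is-uv (∈B p∈ q∈ e) (∈B q∈ p∈ (E-sym e)) e
    where
    ∈B : ∀ {p q} → p ∈ N H S → q ∈ N H S → E H p q → p ∈ B
    ∈B {p} {q} p∈ q∈ e = x∈p∧x≢y⇒x∈p-y p∈ λ { refl → p≢x e }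
      where
      p≢x : E H x q → ⊥
      p≢x e with N⁻ S q∈ | q ∈? R
      ... | _ | yes q∈R with only-x q∈R q∈
      ... | refl = E-irrefl e
      p≢x e | q∈P , _ | no q∉R = N-disjoint (N⁺ R (q∈P , q∉R , x , x∈R , e)) q∈
    pq-is-uv : ∀ {p q} → p ∈ B → q ∈ B → E H p q → E K u v
    pq-is-uv {p} {q} p∈ q∈ e with u ≟ p | u ≟ q
    ... | yes refl | yes refl = ⊥-elim (E-irrefl e)
    ... | yes refl | no u≢q with v ≟ q
    ... | yes refl = inj₁ (inj₁ e)
    ... | no v≢q = ⊥-elim (third u≢q u≢v (v≢q ∘ sym) a q∈ b)
    pq-is-uv {p} {q} p∈ q∈ e | no u≢p | yes refl with v ≟ p
    ... | yes refl = inj₁ (inj₁ (E-sym e))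
    ... | no v≢p = ⊥-elim (third u≢p u≢v (v≢p ∘ sym) a p∈ b)
    pq-is-uv {p} {q} p∈ q∈ e | no u≢p | no u≢q = ⊥-elim (third u≢p u≢q (λ { refl → E-irrefl e }) a p∈ q∈)

  N-K : ∀ {Q} → Q ⊆ P K → N K Q ≡ N H (lift (Q₂.lift Q))
  N-K Q⊆ = trans (Q₂.N′≡N-lift Q⊆) (N′≡N-lift (Q₂.lift⊆P Q⊆))

  open Q₂ using () renaming (lift to lift₂; lift⁺ to lift₂⁺; lift⁻ to lift₂⁻)
  -- The set of `H` that `Q` stands for after both contractions. Since `S′` avoids `N R`, putting
  -- `S′` back never brings in `R`; this is why `L⁻` has only three cases.
  L : Subset m → Subset m
  L Q = lift (lift₂ Q)

  L⁻ : ∀ Q {v} → v ∈ L Q →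
    v ∈ Q ⊎ (v ∈ S′ × ∃[ w ] (w ∈ Q × (w ∈ B ⊎ w ≡ y))) ⊎ (v ∈ R × ∃[ w ] (w ∈ Q × w ∈ N H R))
  L⁻ Q i with lift⁻ (lift₂ Q) i
  L⁻ Q i | inj₁ j with lift₂⁻ Q j
  ... | inj₁ v∈Q = inj₁ v∈Q
  ... | inj₂ (v∈S′ , w , w∈Q , w∈N) = inj₂ (inj₁ (v∈S′ , w , w∈Q , N-S′⁻ w∈N))
  L⁻ Q i | inj₂ (v∈R , w , w∈ , w∈N) with lift₂⁻ Q w∈
  ... | inj₁ w∈Q = inj₂ (inj₂ (v∈R , w , w∈Q , w∈N))
  ... | inj₂ (w∈S′ , _) = ⊥-elim (S′-apart w∈S′ w∈N)

  L-Q : ∀ Q {v} → v ∈ Q → v ∈ L Q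
  L-Q Q i = lift⁺ (lift₂ Q) (inj₁ (lift₂⁺ Q (inj₁ i)))

  L-S′ : ∀ Q {v w} → v ∈ S′ → w ∈ Q → w ∈ B ⊎ w ≡ y → v ∈ L Q
  L-S′ Q v∈ w∈ wB = lift⁺ (lift₂ Q) (inj₁ (lift₂⁺ Q (inj₂ (v∈ , _ , w∈ , [ B⊆N-S′ v∈ , (λ { refl → y∈N-S′ v∈ }) ]′ wB))))

  L-R : ∀ Q {v w} → v ∈ R → w ∈ Q → w ∈ N H R → v ∈ L Q
  L-R Q v∈ w∈ w∈N = lift⁺ (lift₂ Q) (inj₂ (v∈ , _ , lift₂⁺ Q (inj₁ w∈) , w∈N))

  Small-K⁺ : ∀ {Q} → Q ⊆ P K → Small H (L Q) → Small K Q
  Small-K⁺ Q⊆ s = Q⊆ , Q₂.lift⊆P Q⊆ , s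

  Small-K⁻ : ∀ {Q} → Small K Q → Q ⊆ P K × Small H (L Q)
  Small-K⁻ (Q⊆ , _ , s) = Q⊆ , s

module Switch {H : System m} {R S : Subset m} {x y : Fin m}
  (R-red : Reducible H R) (S-red : Reducible H S) (c : Crossing H R S x y)
  (π : Fin m → Fin m) (πx≡y : π x ≡ y) (πy≡x : π y ≡ x) (π-fix : ∀ {v} → v ≢ x → v ≢ y → π v ≡ v) where
  open Crossing c
  open Cross R-red S-red c
  private
    module C′ = Cross S-red R-red (Crossing-sym c)

  fix-K : ∀ {v} → v ∈ P K → v ≢ y → π v ≡ v
  fix-K i = π-fix λ { refl → proj₁ (proj₂ (P-K⁻ i)) x∈R }

  fix-A : ∀ {v} → v ∈ A → π v ≡ v
  fix-A i with A⁻ i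
  ... | v∈N , v≢y = π-fix (λ { refl → System.N-disjoint H R v∈N x∈R }) v≢y

  fix-B : ∀ {v} → v ∈ B → π v ≡ v
  fix-B i with B⁻ i
  ... | v∈N , v≢x = π-fix v≢x λ { refl → System.N-disjoint H S v∈N y∈S }

  P→ : ∀ {v} → v ∈ P K → π v ∈ P C′.K
  P→ {v} i with v ≟ y | P-K⁻ i
  ... | yes refl | _ = subst (_∈ P C′.K) (sym πy≡x) (C′.P-K⁺ (System.N⊆P H S x∈NS)
    (System.N-disjoint H S x∈NS) λ j → proj₂ (C′.S′⁻ j) refl)
  ... | no v≢y | v∈P , v∉R , v∉S′ = subst (_∈ P C′.K) (sym (fix-K i v≢y))
    (C′.P-K⁺ v∈P (λ j → v∉S′ (S′⁺ j v≢y)) λ j → v∉R (proj₁ (C′.S′⁻ j)))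

  E→ : ∀ {u v} → u ∈ P K → v ∈ P K → E K u v → E C′.K (π u) (π v)
  E→ {u} {v} i j e = C′.E-K⇐ (convert i j (E-K⇒ i j e))
    where
    convert : ∀ {u v} → u ∈ P K → v ∈ P K → Edge-K u v → C′.Edge-K (π u) (π v)
    convert i j (hub-A a) rewrite πy≡x | fix-A a = C′.hub-B a
    convert i j (hub-B a) rewrite πy≡x | fix-B a = C′.hub-A a
    convert i j (A-hub a) rewrite πy≡x | fix-A a = C′.B-hub a
    convert i j (B-hub a) rewrite πy≡x | fix-B a = C′.A-hub a
    convert i j (edge u≢y v≢y e) rewrite fix-K i u≢y | fix-K j v≢y =
      C′.edge (λ { refl → proj₁ (proj₂ (P-K⁻ i)) x∈R }) (λ { refl → proj₁ (proj₂ (P-K⁻ j)) x∈R }) e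
    convert i j (edge-A u≢v a b) rewrite fix-A a | fix-A b = C′.edge-B u≢v a b
    convert i j (edge-B u≢v a b) rewrite fix-B a | fix-B b = C′.edge-A u≢v a b

module Switch₂ {H : System m} {R S : Subset m} {x y : Fin m}
  (R-red : Reducible H R) (S-red : Reducible H S) (c : Crossing H R S x y)
  (π : Fin m → Fin m) (π-invol : ∀ v → π (π v) ≡ v)
  (πx≡y : π x ≡ y) (πy≡x : π y ≡ x) (π-fix : ∀ {v} → v ≢ x → v ≢ y → π v ≡ v) where
  open System H using (N⁺; N⁻; N≤3; down; union)
  open Crossing c
  open Cross R-red S-red c
  private
    module C′ = Cross S-red R-red (Crossing-sym c)
    module S₁ = Switch R-red S-red c π πx≡y πy≡x π-fix
    module S₂ = Switch S-red R-red (Crossing-sym c) π πy≡x πx≡y (λ a b → π-fix b a)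

  -- The exchange preserves adjacency, so the exchanged set still has at most three neighbours, and
  -- by `down` it suffices to enclose `L′` in a small set. `L Q` serves if `Q` contains `y`, which
  -- brings in all of `R` and `S`, or if `Q` avoids `N S`; otherwise `L Q ∪ S` does.
  S→ : ∀ {Q} → Small K Q → Small C′.K (pre π Q)
  S→ {Q} Q-small = C′.Small-K⁺ Q*⊆P L′-small
    where
    Q⊆P : Q ⊆ P K
    Q⊆P = proj₁ (Small-K⁻ Q-small)
    L-small : Small H (L Q)
    L-small = proj₂ (Small-K⁻ Q-small)
    Q* : Subset m
    Q* = pre π Q
    x∉Q : x ∉ Q
    x∉Q j = proj₁ (proj₂ (P-K⁻ (Q⊆P j))) x∈R
    Q*⊆P : Q* ⊆ P C′.K
    Q*⊆P {v} i = subst (_∈ P C′.K) (π-invol v) (S₁.P→ (Q⊆P (∈pre⁻ π Q i)))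
    L′ : Subset m
    L′ = C′.L Q*
    N-K′⊆ : N C′.K Q* ⊆ pre π (N K Q)
    N-K′⊆ {v} i with System.N⁻ C′.K Q* i
    ... | v∈P , v∉ , u , u∈ , e = ∈pre⁺ π (N K Q) (System.N⁺ K Q
      (S₂.P→ v∈P , v∉ ∘ ∈pre⁺ π Q , π u , ∈pre⁻ π Q u∈ , S₂.E→ (Q*⊆P u∈) v∈P e))
    NL′≤3 : ∣ N H L′ ∣ ≤ 3
    NL′≤3 = subst (λ X → ∣ X ∣ ≤ 3) (C′.N-K Q*⊆P)
      (≤-trans (p⊆q⇒∣p∣≤∣q∣ N-K′⊆) (≤-trans
        (∣∣-injective π (λ e → trans (sym (π-invol _)) (trans (cong π e) (π-invol _)))
          (pre π (N K Q)) (N K Q) (∈pre⁻ π (N K Q)))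
        (≤-trans (≤-reflexive (cong ∣_∣ (N-K Q⊆P))) (N≤3 L-small))))

    L′-small : Small H L′
    L′-small with y ∈? Q
    ... | yes y∈Q = down L-small L′⊆L NL′≤3
      where
      R⊆L : R ⊆ L Q
      R⊆L i = L-R Q i y∈Q y∈NR
      L′⊆L : L′ ⊆ L Q
      L′⊆L {v} i with C′.L⁻ Q* i
      ... | inj₂ (inj₁ (v∈R′ , _)) = R⊆L (proj₁ (C′.S′⁻ v∈R′))
      L′⊆L {v} i | inj₂ (inj₂ (v∈S , _)) with v ≟ y
      ... | yes refl = L-Q Q y∈Q
      ... | no v≢y = L-S′ Q (S′⁺ v∈S v≢y) y∈Q (inj₂ refl)
      L′⊆L {v} i | inj₁ j with v ≟ x | v ≟ y
      ... | yes refl | _ = R⊆L x∈R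
      ... | no _ | yes refl = ⊥-elim (x∉Q (subst (_∈ Q) πy≡x (∈pre⁻ π Q j)))
      ... | no v≢x | no v≢y = L-Q Q (subst (_∈ Q) (π-fix v≢x v≢y) (∈pre⁻ π Q j))
    ... | no y∉Q with meets? Q (N H S)
    ... | no ¬meet = down L-small L′⊆L NL′≤3
      where
      Q*⊆Q : Q* ⊆ Q
      Q*⊆Q {v} j with v ≟ x | v ≟ y
      ... | yes refl | _ = ⊥-elim (y∉Q (subst (_∈ Q) πx≡y (∈pre⁻ π Q j)))
      ... | no _ | yes refl = ⊥-elim (x∉Q (subst (_∈ Q) πy≡x (∈pre⁻ π Q j)))
      ... | no v≢x | no v≢y = subst (_∈ Q) (π-fix v≢x v≢y) (∈pre⁻ π Q j)
      L′⊆L : L′ ⊆ L Q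
      L′⊆L {v} i with C′.L⁻ Q* i
      ... | inj₁ j = L-Q Q (Q*⊆Q j)
      ... | inj₂ (inj₁ (v∈R′ , w , w∈ , inj₁ w∈B′)) = L-R Q (proj₁ (C′.S′⁻ v∈R′)) (Q*⊆Q w∈) (proj₁ (A⁻ w∈B′))
      ... | inj₂ (inj₁ (_ , w , w∈ , inj₂ refl)) = ⊥-elim (x∉Q (Q*⊆Q w∈))
      ... | inj₂ (inj₂ (_ , w , w∈ , w∈N)) = ⊥-elim (¬meet (w , Q*⊆Q w∈ , w∈N))
    ... | yes (z , z∈Q , z∈NS) = down (union L-small S-small N≤) L′⊆L∪S NL′≤3
      where
      open Reducible S-red renaming (small to S-small)
      fix-Q : ∀ {v} → v ∈ Q → π v ≡ v
      fix-Q i = π-fix (λ { refl → x∉Q i }) (λ { refl → y∉Q i })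
      Q*⊆Q : Q* ⊆ Q
      Q*⊆Q {v} j = subst (_∈ Q) (trans (sym (fix-Q (∈pre⁻ π Q j))) (π-invol v)) (∈pre⁻ π Q j)
      Q⊆Q* : Q ⊆ Q*
      Q⊆Q* i = ∈pre⁺ π Q (subst (_∈ Q) (sym (fix-Q i)) i)
      z∈B : z ∈ B
      z∈B = x∈p∧x≢y⇒x∈p-y z∈NS λ { refl → x∉Q z∈Q }
      L′⊆L∪S : L′ ⊆ L Q ∪ S
      L′⊆L∪S {v} i with C′.L⁻ Q* i
      ... | inj₁ j = ∈∪ˡ (L-Q Q (Q*⊆Q j))
      ... | inj₂ (inj₁ (v∈R′ , w , w∈ , inj₁ w∈B′)) =
        ∈∪ˡ (L-R Q (proj₁ (C′.S′⁻ v∈R′)) (Q*⊆Q w∈) (proj₁ (A⁻ w∈B′)))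
      ... | inj₂ (inj₁ (_ , w , w∈ , inj₂ refl)) = ⊥-elim (x∉Q (Q*⊆Q w∈))
      ... | inj₂ (inj₂ (v∈S , _)) = ∈∪ʳ {p = L Q} v∈S
      -- If `Q` avoids `N R`, the union is `L′` itself. Otherwise `R` lies in `L Q`, so a neighbour
      -- of `S` outside the union is in `B`; as `B` is a clique of `K` and `z` is in both `B` and
      -- `Q`, it is already a neighbour of `L Q`.
      N≤ : ∣ N H (L Q ∪ S) ∣ ≤ 3
      N≤ with meets? Q (N H R)
      ... | no ¬meet = subst (λ X → ∣ N H X ∣ ≤ 3) (⊆-antisym L′⊆L∪S L∪S⊆L′) NL′≤3
        where
        S⊆L′ : S ⊆ L′
        S⊆L′ i = C′.L-R Q* i (Q⊆Q* z∈Q) z∈NS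
        L∪S⊆L′ : L Q ∪ S ⊆ L′
        L∪S⊆L′ i with ∈∪⁻ {p = L Q} i
        ... | inj₂ v∈S = S⊆L′ v∈S
        ... | inj₁ j with L⁻ Q j
        ... | inj₁ v∈Q = C′.L-Q Q* (Q⊆Q* v∈Q)
        ... | inj₂ (inj₁ (v∈S′ , _)) = S⊆L′ (proj₁ (S′⁻ v∈S′))
        ... | inj₂ (inj₂ (_ , w , w∈Q , w∈N)) = ⊥-elim (¬meet (w , w∈Q , w∈N))
      ... | yes (t , t∈Q , t∈NR) = ≤-trans (p⊆q⇒∣p∣≤∣q∣ N⊆) (N≤3 L-small)
        where
        N⊆ : N H (L Q ∪ S) ⊆ N H (L Q)
        N⊆ {v} i with N⁻ (L Q ∪ S) i
        ... | v∈P , v∉ , u , u∈ , e with ∈∪⁻ {p = L Q} u∈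
        ... | inj₁ u∈L = N⁺ (L Q) (v∈P , v∉ ∘ ∈∪ˡ , u , u∈L , e)
        ... | inj₂ u∈S = subst (v ∈_) (N-K Q⊆P) (System.N⁺ K Q
          ( P-K⁺ v∈P v∉R (λ j → v∉S (proj₁ (S′⁻ j))) , v∉ ∘ ∈∪ˡ ∘ L-Q Q , z , z∈Q
          , E-K⇐ (edge-B (λ { refl → v∉ (∈∪ˡ (L-Q Q z∈Q)) }) z∈B v∈B) ))
          where
          v∉S : v ∉ S
          v∉S = v∉ ∘ ∈∪ʳ {p = L Q}
          v∉R : v ∉ R
          v∉R j = v∉ (∈∪ˡ (L-R Q j t∈Q t∈NR))
          v∈B : v ∈ B
          v∈B = x∈p∧x≢y⇒x∈p-y (N⁺ S (v∈P , v∉S , u , u∈S , e)) λ { refl → v∉R x∈R }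

  forth : Half K C′.K π π
  forth = record { P→ = S₁.P→ ; E→ = S₁.E→ ; S→ = S→ }

transpose : Fin m → Fin m → Fin m → Fin m
transpose x y v with v ≟ x
... | yes _ = y
... | no _ with v ≟ y
... | yes _ = x
... | no _ = v

module _ (x y : Fin m) where

  transpose-x : transpose x y x ≡ y
  transpose-x with x ≟ x
  ... | yes _ = refl
  ... | no ne = ⊥-elim (ne refl)

  transpose-y : transpose x y y ≡ x
  transpose-y with y ≟ x
  ... | yes e = e
  ... | no _ with y ≟ y
  ... | yes _ = refl
  ... | no ne = ⊥-elim (ne refl)

  transpose-fix : ∀ {v} → v ≢ x → v ≢ y → transpose x y v ≡ v
  transpose-fix {v} v≢x v≢y with v ≟ x
  ... | yes e = ⊥-elim (v≢x e)
  ... | no _ with v ≟ y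
  ... | yes e = ⊥-elim (v≢y e)
  ... | no _ = refl

  transpose-involutive : ∀ v → transpose x y (transpose x y v) ≡ v
  transpose-involutive v = by-cases (v ≟ x) (v ≟ y)
    where
    by-cases : Dec (v ≡ x) → Dec (v ≡ y) → transpose x y (transpose x y v) ≡ v
    by-cases (yes refl) _ = trans (cong (transpose x y) transpose-x) transpose-y
    by-cases (no _) (yes refl) = trans (cong (transpose x y) transpose-y) transpose-x
    by-cases (no a) (no b) = trans (cong (transpose x y) (transpose-fix a b)) (transpose-fix a b)

-- The diamond property

module _ {H : System m} {R S : Subset m} (R-red : Reducible H R) (S-red : Reducible H S) where
  open System H using (N⁺; N⁻; N≥3; N≡3; N-union; N-submodular; small⊆P; E-sym)
  open Reducible R-red using () renaming (small to R-small; nonempty to R-nonempty)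
  open Reducible S-red using () renaming (small to S-small; nonempty to S-nonempty)

  join-crossing : ∀ {x y} → Crossing H R S x y → Joinable (H / R-small) (H / S-small)
  join-crossing {x} {y} c = C.K , C.reduces , ⇒?-Iso {K = C′.K} C′.reduces back
    where
    module C = Cross {H = H} R-red S-red c
    module C′ = Cross {H = H} S-red R-red (Crossing-sym {H = H} c)
    π : Fin m → Fin m
    π = transpose x y
    module S₁ = Switch₂ {H = H} R-red S-red c π (transpose-involutive x y)
      (transpose-x x y) (transpose-y x y) (transpose-fix x y)
    module S₂ = Switch₂ {H = H} S-red R-red (Crossing-sym {H = H} c) π (transpose-involutive x y)
      (transpose-y x y) (transpose-x x y) (λ a b → transpose-fix x y b a)
    back : Iso C′.K C.K
    back = record
      { to = π ; from = π ; from∘to = transpose-involutive x y ; to∘from = transpose-involutive x y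
      ; forth = S₂.forth ; back = S₁.forth }

  join-union : Small H (R ∪ S) → Joinable (H / R-small) (H / S-small)
  join-union M-small = H / M-small , Nested⊆.join {H = H} R-small M-small ∈∪ˡ R-nonempty
    , Nested⊆.join {H = H} S-small M-small (∈∪ʳ {p = R}) S-nonempty

  join-far : (∀ {v} → v ∈ R → v ∈ S → ⊥) → (∀ {v} → v ∈ S → v ∈ N H R → ⊥) →
    (∀ {v} → v ∈ R → v ∈ N H S → ⊥) → Joinable (H / R-small) (H / S-small)
  join-far disjoint apart apart′ = (H / R-small) / RS.small
    , inj₂ (S , RS.reducible-S S-red , Iso-refl)
    , inj₂ (R , SR.reducible-S R-red , Iso-id (Half-far {H = H} S-small R-small disjoint′ apart′ apart)
        (Half-far {H = H} R-small S-small disjoint apart apart′))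
    where
    disjoint′ : ∀ {v} → v ∈ S → v ∈ R → ⊥
    disjoint′ i j = disjoint j i
    module RS = Far {H = H} R-small S-small disjoint apart
    module SR = Far {H = H} S-small R-small disjoint′ apart′

  -- A common vertex forces three neighbours of `R ∩ S`, and submodularity leaves 3 + 3 - 3 for
  -- `R ∪ S`.
  cross-disjoint : ¬ (∣ N H (R ∪ S) ∣ ≤ 3) → ∀ {v} → v ∈ R → v ∈ S → ⊥
  cross-disjoint ¬≤3 {v} v∈R v∈S = ¬≤3 (+-cancelʳ-≤ 3 ∣ N H (R ∪ S) ∣ 3
    (≤-trans (+-monoʳ-≤ ∣ N H (R ∪ S) ∣ (N≥3 R-small (λ i → proj₁ (∈∩⁻ {p = R} i)) (∈∩⁺ v∈R v∈S)))
      (≤-trans (N-submodular R S) (≤-reflexive (cong₂ _+_ (N≡3 R-small v∈R) (N≡3 S-small v∈S))))))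

  touch-sym : (∀ {v} → v ∈ R → v ∈ S → ⊥) → ∀ {y} → y ∈ S → y ∈ N H R → ∃[ x ] (x ∈ R × x ∈ N H S)
  touch-sym disjoint {y} y∈S y∈N with N⁻ R y∈N
  ... | _ , _ , x , x∈R , e = x , x∈R , N⁺ S (small⊆P R-small x∈R , disjoint x∈R , y , y∈S , E-sym e)

  module _ (¬≤3 : ¬ (∣ N H (R ∪ S) ∣ ≤ 3)) {x y : Fin m}
    (x∈R : x ∈ R) (x∈NS : x ∈ N H S) (y∈S : y ∈ S) (y∈NR : y ∈ N H R) where
    private
      NR-y : ∣ N H R - y ∣ ≡ 2
      NR-y = suc-injective (trans (sym (∣─⁅⁆∣ (N H R) y∈NR)) (N≡3 R-small x∈R))
      NS-x : ∣ N H S - x ∣ ≡ 2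
      NS-x = suc-injective (trans (sym (∣─⁅⁆∣ (N H S) x∈NS)) (N≡3 S-small y∈S))

      ∉∪ : ∀ {w} → w ∈ N H (R ∪ S) → w ∉ R × w ∉ S
      ∉∪ i with N⁻ (R ∪ S) i
      ... | _ , w∉ , _ = w∉ ∘ ∈∪ˡ , w∉ ∘ ∈∪ʳ {p = R}

      too-few : ∀ p q → ∣ p ∣ + ∣ q ∣ ≤ 3 → N H (R ∪ S) ⊆ p ∪ q → ⊥
      too-few p q ≤3 sub = ¬≤3 (≤-trans (p⊆q⇒∣p∣≤∣q∣ sub) (≤-trans (∣p∪q∣≤ p q) ≤3))

    -- The neighbours of `R ∪ S` come from `N R` without `y` and `N S` without `x`, that is from 2 +
    -- 2 vertices. As there are more than three, nothing further may be lost: neither to a second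
    -- vertex of `S` in `N R` nor, in the next lemma, to an overlap.
    only-crossing : ∀ {v} → v ∈ S → v ∈ N H R → v ≡ y
    only-crossing {v} v∈S v∈N with v ≟ y
    ... | yes e = e
    ... | no v≢y = ⊥-elim (too-few (N H R - y - v) (N H S - x)
      (≤-reflexive (cong₂ _+_ (suc-injective (trans (sym (∣─⁅⁆∣ _ (x∈p∧x≢y⇒x∈p-y v∈N v≢y))) NR-y)) NS-x)) sub)
      where
      sub : N H (R ∪ S) ⊆ (N H R - y - v) ∪ (N H S - x)
      sub i with ∈∪⁻ {p = N H R} (N-union R S i) | ∉∪ i
      ... | inj₁ j | _ , w∉S =
        ∈∪ˡ (x∈p∧x≢y⇒x∈p-y (x∈p∧x≢y⇒x∈p-y j λ { refl → w∉S y∈S }) λ { refl → w∉S v∈S })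
      ... | inj₂ j | w∉R , _ = ∈∪ʳ {p = N H R - y - v} (x∈p∧x≢y⇒x∈p-y j λ { refl → w∉R x∈R })

    N-disjoint-crossing : ∀ {v} → v ∈ N H R → v ∈ N H S → ⊥
    N-disjoint-crossing {v} v∈NR v∈NS = too-few (N H R - y) (N H S - x - v)
      (≤-reflexive (cong₂ _+_ NR-y (suc-injective (trans (sym (∣─⁅⁆∣ _ (x∈p∧x≢y⇒x∈p-y v∈NS
        λ { refl → System.N-disjoint H R v∈NR x∈R }))) NS-x)))) sub
      where
      sub : N H (R ∪ S) ⊆ (N H R - y) ∪ (N H S - x - v)
      sub {w} i with ∈∪⁻ {p = N H R} (N-union R S i) | ∉∪ i | w ≟ v
      ... | inj₁ j | _ , w∉S | _ = ∈∪ˡ (x∈p∧x≢y⇒x∈p-y j λ { refl → w∉S y∈S })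
      ... | inj₂ j | _ | yes refl = ∈∪ˡ (x∈p∧x≢y⇒x∈p-y v∈NR λ { refl → System.N-disjoint H S j y∈S })
      ... | inj₂ j | w∉R , _ | no w≢v =
        ∈∪ʳ {p = N H R - y} (x∈p∧x≢y⇒x∈p-y (x∈p∧x≢y⇒x∈p-y j λ { refl → w∉R x∈R }) w≢v)

module _ {H : System m} {R S : Subset m} (R-red : Reducible H R) (S-red : Reducible H S) where
  open Reducible R-red using () renaming (small to R-small)
  open Reducible S-red using () renaming (small to S-small)

  private
    by-meeting : ¬ (∣ N H (R ∪ S) ∣ ≤ 3) → (∀ {v} → v ∈ R → v ∈ S → ⊥) → Dec (∃[ y ] (y ∈ S × y ∈ N H R)) →
      Joinable (H / R-small) (H / S-small)
    by-meeting ¬≤3 disjoint (no ¬meet) = join-far {H = H} R-red S-red disjoint (λ i j → ¬meet (_ , i , j))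
      λ i j → let y , y∈S , y∈N = touch-sym {H = H} S-red R-red (λ i j → disjoint j i) i j in ¬meet (y , y∈S , y∈N)
    by-meeting ¬≤3 disjoint (yes (y , y∈S , y∈NR)) =
      let x , x∈R , x∈NS = touch-sym {H = H} R-red S-red disjoint y∈S y∈NR in
      join-crossing {H = H} R-red S-red record
        { disjoint = disjoint ; x∈R = x∈R ; y∈S = y∈S ; x∈NS = x∈NS ; y∈NR = y∈NR
        ; only-x = only-crossing {H = H} S-red R-red
            (¬≤3 ∘ subst (λ X → ∣ N H X ∣ ≤ 3) (⊆-antisym ∪-swap ∪-swap)) y∈S y∈NR x∈R x∈NS
        ; only-y = only-crossing {H = H} R-red S-red ¬≤3 x∈R x∈NS y∈S y∈NR
        ; N-disjoint = N-disjoint-crossing {H = H} R-red S-red ¬≤3 x∈R x∈NS y∈S y∈NR }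
      where
      ∪-swap : ∀ {p q : Subset m} → p ∪ q ⊆ q ∪ p
      ∪-swap {p} {q} i = [ ∈∪ʳ {p = q} , ∈∪ˡ ]′ (∈∪⁻ {p = p} i)

    by-size : Dec (∣ N H (R ∪ S) ∣ ≤ 3) → Joinable (H / R-small) (H / S-small)
    by-size (yes ≤3) = join-union {H = H} R-red S-red (System.union H R-small S-small ≤3)
    by-size (no ¬≤3) = by-meeting ¬≤3 (cross-disjoint {H = H} R-red S-red ¬≤3) (meets? S (N H R))

  diamond : Joinable (H / R-small) (H / S-small)
  diamond = by-size (∣ N H (R ∪ S) ∣ ≤? 3)

-- Induction on the given sequence suffices because `diamond` answers with at most one step on the
-- side of `s`, and the induction hypothesis applies to that step and `rest`.
strip : {H T : System m} → Normal T → H ⇒* T → ∀ {R} (r : Reducible H R) → (H / Reducible.small r) ⇒* T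
strip normal (done i) r = ⊥-elim (normal _ (Reducible-iso i r))
strip normal (step s rest) r with diamond r s
... | K , r⇒K , inj₁ i = ⇒?-⇒* r⇒K (transport i rest)
... | K , r⇒K , inj₂ (_ , q , i) = ⇒?-⇒* r⇒K (transport i (strip normal rest q))

unique-normal-form : {H T T′ : System m} → Normal T → Normal T′ → H ⇒* T → H ⇒* T′ → Iso T T′
unique-normal-form normal normal′ (step r rest) t′ = unique-normal-form normal normal′ rest (strip normal′ t′ r)
unique-normal-form normal normal′ (done i) t′ with transport i t′
... | done j = j
... | step r _ = ⊥-elim (normal _ r)

-- Contracting a nested family

module Compatibility (G : System m) where
  private
    module G = System G

  Apart : Subset m → Subset m → Set
  Apart Q Q′ = ∀ {u v} → u ∈ Q → v ∈ Q′ → u ≢ v × ¬ E G u v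

  Apart-sym : ∀ {Q Q′} → Apart Q Q′ → Apart Q′ Q
  Apart-sym a i j = proj₁ (a j i) ∘ sym , proj₂ (a j i) ∘ G.E-sym

  -- Nested separations have four relative positions. For small sides the position in which the two
  -- sides together cover the graph cannot occur, and these three remain.
  data Compat (Q Q′ : Subset m) : Set where
    inside   : Q ⊆ Q′ → Compat Q Q′
    contains : Q′ ⊆ Q → Compat Q Q′
    apart    : Apart Q Q′ → Compat Q Q′

module Family {m ℓ : ℕ} (G : System m) (R : Fin ℓ → Subset m) where
  open Compatibility G
  private
    module G = System G

  -- Q ∩ P H is what the stage H has left of Q.
  record Trace (H : System m) (Q : Subset m) : Set where
    field
      small  : Small H (Q ∩ P H)
      -- A set that has vanished leaves behind the same clique as if it had been contracted itself,
      -- so it can be skipped when its turn comes.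
      clique : (∀ {v} → v ∈ Q → v ∉ P H) → ∀ {u v} → u ≢ v → u ∈ N G Q → v ∈ N G Q → u ∈ P H → v ∈ P H → E H u v
      N≡     : ∀ {v} → v ∈ Q → v ∈ P H → N H (Q ∩ P H) ≡ N G Q
      -- Either nothing of `Q` has been contracted, or a contraction inside `Q` has already left two
      -- vertices or an edge among the neighbours.
      rich   : ∀ {v} → v ∈ Q → v ∈ P H → Q ⊆ P H ⊎ System.NonClaw H (Q ∩ P H)

  -- The way back from the stage to `G`: for a maximal chop the hull of a reducible set will extend
  -- the chop. `compat` has no case for a hull inside `R j`, as the hull contains a vertex still
  -- present in `P H`.
  record Hull (k : ℕ) (H : System m) (Q : Subset m) : Set where
    field
      hull   : Subset m
      small  : Small G hull
      mem⁺   : Q ⊆ hull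
      mem⁻   : ∀ {v} → v ∈ hull → v ∈ P H → v ∈ Q
      N≡     : N G hull ≡ N H Q
      compat : ∀ j → toℕ j < k → R j ⊆ hull ⊎ Apart (R j) hull

  -- `path` is a continuation because contractions are appended at the end, while `_⇒*_` grows at
  -- its front.
  record Stage (k : ℕ) : Set₁ where
    field
      H       : System m
      path    : ∀ {T} → H ⇒* T → G ⇒* T
      P⁺      : ∀ {v} → v ∈ P G → (∀ j → toℕ j < k → v ∉ R j) → v ∈ P H
      P⁻      : ∀ {v} → v ∈ P H → v ∈ P G × (∀ j → toℕ j < k → v ∉ R j)
      E-old   : ∀ {u v} → E G u v → E H u v
      E-clique : ∀ j → toℕ j < k → ∀ {u v} → u ≢ v → u ∈ N G (R j) → v ∈ N G (R j) →
                u ∈ P H → v ∈ P H → E H u v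
      E⁻      : ∀ {u v} → E H u v → E G u v ⊎ ∃[ j ] (toℕ j < k × u ∈ N G (R j) × v ∈ N G (R j))
      trace   : ∀ {Q} → Small G Q → (∀ j → toℕ j < k → Compat Q (R j)) → Trace H Q
      hull    : ∀ {Q v} → Small H Q → v ∈ Q → Hull k H Q

  start : Stage 0
  start = record
    { H = G ; path = id ; P⁺ = λ i _ → i ; P⁻ = λ i → i , λ _ () ; E-old = id ; E-clique = λ _ ()
    ; E⁻ = inj₁
    ; trace = λ {Q} s _ → let Q∩P≡Q = ⊆-antisym (proj₁ ∘ ∈∩⁻ {p = Q}) (λ i → ∈∩⁺ i (G.small⊆P s i)) in record
        { small = subst (Small G) (sym Q∩P≡Q) s
        ; clique = λ empty _ u∈ → let (_ , _ , w , w∈ , _) = G.N⁻ Q u∈ in ⊥-elim (empty w∈ (G.small⊆P s w∈))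
        ; N≡ = λ _ _ → cong (N G) Q∩P≡Q
        ; rich = λ _ _ → inj₁ (G.small⊆P s) }
    ; hull = λ {Q} s _ → record
        { hull = Q ; small = s ; mem⁺ = id ; mem⁻ = λ i _ → i ; N≡ = refl ; compat = λ _ () } }

  module Next (R-small : ∀ i → Small G (R i)) (R-nonempty : ∀ i → ∃[ v ] v ∈ R i)
    (R-compat : ∀ i j → Compat (R i) (R j))
    (enabled : ∀ i → G.NonClaw (R i) ⊎ ∃[ j ] (toℕ j < toℕ i × ∃[ u ] ∃[ v ] (u ≢ v ×
      u ∈ N G (R i) × v ∈ N G (R i) × u ∈ N G (R j) × v ∈ N G (R j)))) where

    module _ (i : Fin ℓ) (σ : Stage (toℕ i)) where
      open Stage σ
      private
        k : ℕ
        k = toℕ i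
        module H = System H
        t : Trace H (R i)
        t = trace (R-small i) (λ j _ → R-compat i j)
        module t = Trace t

      below : ∀ {A : Fin ℓ → Set} → (∀ j → toℕ j < k → A j) → A i → ∀ j → toℕ j < suc k → A j
      below {A} a b j j<1+k with m<1+n⇒m<n∨m≡n j<1+k
      ... | inj₁ j<k = a j j<k
      ... | inj₂ j≡k = subst A (sym (toℕ-injective j≡k)) b

      weaken : ∀ {A : Fin ℓ → Set} → (∀ j → toℕ j < suc k → A j) → ∀ j → toℕ j < k → A j
      weaken a j j<k = a j (≤-trans j<k (n≤1+n k))

      now : ∀ {A : Fin ℓ → Set} → (∀ j → toℕ j < suc k → A j) → A i
      now a = a i ≤-refl

      module Extend (uncovered : ∀ j → toℕ j < k → ¬ (R i ⊆ R j)) where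

        -- By nestedness an earlier set that contains a neighbour of `R i` would have to contain
        -- `R i`.
        N⊆P-H : N G (R i) ⊆ P H
        N⊆P-H {u} u∈ with G.N⁻ (R i) u∈
        ... | u∈P , u∉R , r , r∈R , e = P⁺ u∈P not-in
          where
          not-in : ∀ j → toℕ j < k → u ∉ R j
          not-in j j<k u∈R with R-compat i j
          ... | inside s = uncovered j j<k s
          ... | contains s = u∉R (s u∈R)
          ... | apart a = proj₂ (a r∈R u∈R) e

        module _ {Q : Subset m} (Q-small : Small G Q) (compat : ∀ j → toℕ j < k → R j ⊆ Q ⊎ Apart (R j) Q) where

          -- The update of a hull that touches `N (R i)`. All of `N (R i)` then lies in the hull or
          -- next to it, so adding `R i` creates no new neighbour.
          module Absorb (NR⊆ : ∀ {u} → u ∈ N G (R i) → u ∈ Q ⊎ u ∈ N G Q) where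

            N⊆ : N G (Q ∪ R i) ⊆ N G Q
            N⊆ {u} u∈ with ∈∪⁻ {p = N G Q} (G.N-union Q (R i) u∈)
            ... | inj₁ h = h
            ... | inj₂ h with NR⊆ h
            ... | inj₁ u∈Q = ⊥-elim (G.N-disjoint (Q ∪ R i) u∈ (∈∪ˡ u∈Q))
            ... | inj₂ h′ = h′

            N≤ : ∣ N G (Q ∪ R i) ∣ ≤ 3
            N≤ = ≤-trans (p⊆q⇒∣p∣≤∣q∣ N⊆) (G.N≤3 Q-small)

            small : Small G (Q ∪ R i)
            small = G.union Q-small (R-small i) N≤

            N≡ : N G (Q ∪ R i) ≡ N G Q
            N≡ = squeeze N⊆ (G.N≥3 small id (∈∪ʳ {p = Q} (proj₂ (R-nonempty i)))) (G.N≤3 Q-small)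

            compat′ : ∀ j → toℕ j < suc k → R j ⊆ Q ∪ R i ⊎ Apart (R j) (Q ∪ R i)
            compat′ = below old (inj₁ (∈∪ʳ {p = Q}))
              where
              old : ∀ j → toℕ j < k → R j ⊆ Q ∪ R i ⊎ Apart (R j) (Q ∪ R i)
              old j j<k with compat j j<k | R-compat i j
              ... | inj₁ s | _ = inj₁ λ h → ∈∪ˡ (s h)
              ... | inj₂ _ | inside s = ⊥-elim (uncovered j j<k s)
              ... | inj₂ _ | contains s = inj₁ λ h → ∈∪ʳ {p = Q} (s h)
              ... | inj₂ a | apart b = inj₂ λ h h′ → [ a h , Apart-sym b h ]′ (∈∪⁻ {p = Q} h′)

          -- The update of a hull that avoids `N (R i)`. No edge joins its part inside `R i` to the
          -- remainder, so removing that part creates no new neighbour.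
          module Discard (untouched : ∀ {w} → w ∈ N G (R i) → w ∉ Q) where

            N⊆ : N G (Q ∖ R i) ⊆ N G Q
            N⊆ {u} u∈ with G.N⁻ (Q ∖ R i) u∈
            ... | u∈P , u∉ , q , q∈ , e with ∈∖⁻ {p = Q} q∈ | u ∈? Q
            ... | q∈Q , q∉R | no u∉Q = G.N⁺ Q (u∈P , u∉Q , q , q∈Q , e)
            ... | q∈Q , q∉R | yes u∈Q with u ∈? R i
            ... | no u∉R = ⊥-elim (u∉ (∈∖⁺ u∈Q u∉R))
            ... | yes u∈R = ⊥-elim (untouched (G.N⁺ (R i) (G.small⊆P Q-small q∈Q , q∉R , u , u∈R , G.E-sym e)) q∈Q)

            small : Small G (Q ∖ R i)
            small = G.down Q-small (proj₁ ∘ ∈∖⁻ {p = Q}) (≤-trans (p⊆q⇒∣p∣≤∣q∣ N⊆) (G.N≤3 Q-small))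

            N≡ : ∀ {v} → v ∈ Q ∖ R i → N G (Q ∖ R i) ≡ N G Q
            N≡ v∈ = squeeze N⊆ (G.N≥3 small id v∈) (G.N≤3 Q-small)

            R-apart : Apart (R i) (Q ∖ R i)
            R-apart r∈ q∈ with ∈∖⁻ {p = Q} q∈
            ... | q∈Q , q∉R = (λ { refl → q∉R r∈ }) ,
              λ e → untouched (G.N⁺ (R i) (G.small⊆P Q-small q∈Q , q∉R , _ , r∈ , e)) q∈Q

            compat′ : ∀ j → toℕ j < suc k → R j ⊆ Q ∖ R i ⊎ Apart (R j) (Q ∖ R i)
            compat′ = below old (inj₂ R-apart)
              where
              old : ∀ j → toℕ j < k → R j ⊆ Q ∖ R i ⊎ Apart (R j) (Q ∖ R i)
              old j j<k with compat j j<k | R-compat i j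
              ... | inj₂ a | _ = inj₂ λ h h′ → a h (proj₁ (∈∖⁻ {p = Q} h′))
              ... | inj₁ _ | inside s = ⊥-elim (uncovered j j<k s)
              ... | inj₁ _ | contains s = inj₂ λ h h′ → R-apart (s h) h′
              ... | inj₁ s | apart a = inj₁ λ h → ∈∖⁺ (s h) λ h′ → proj₁ (a h′ h) refl

      -- `R i` can vanish without lying in a single earlier set, for instance as a union of several.
      -- Nothing is contracted then, but the hulls must still be made compatible with `R i`.
      module Skip (gone : ∀ {v} → v ∈ R i → v ∉ P H) where

        hull′ : ∀ {Q v} → Small H Q → v ∈ Q → Hull (suc k) H Q
        hull′ {Q} {v} s v∈Q = by-cover (any? λ j → (suc (toℕ j) ≤? k) ×-dec (R i ⊆? R j))
          where
          h : Hull k H Q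
          h = hull s v∈Q
          module h = Hull h
          by-cover : Dec (∃[ j ] (toℕ j < k × R i ⊆ R j)) → Hull (suc k) H Q
          by-cover (yes (j , j<k , R⊆)) = record
            { hull = h.hull ; small = h.small ; mem⁺ = h.mem⁺ ; mem⁻ = h.mem⁻ ; N≡ = h.N≡
            ; compat = below h.compat (Sum.map (λ s {_} r → s (R⊆ r)) (λ a {_} {_} r → a (R⊆ r)) (h.compat j j<k)) }
          by-cover (no ¬cover) = by-touch (meets? Q (N G (R i)))
            where
            module X = Extend (λ j j<k R⊆ → ¬cover (j , j<k , R⊆))
            by-touch : Dec (∃[ w ] (w ∈ Q × w ∈ N G (R i))) → Hull (suc k) H Q
            by-touch (yes (w , w∈Q , w∈N)) = record
              { hull = h.hull ∪ R i ; small = A.small ; mem⁺ = λ x → ∈∪ˡ (h.mem⁺ x)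
              ; mem⁻ = λ x x∈P → [ (λ y → h.mem⁻ y x∈P) , (λ y → ⊥-elim (gone y x∈P)) ]′ (∈∪⁻ {p = h.hull} x)
              ; N≡ = trans A.N≡ h.N≡ ; compat = A.compat′ }
              where
              NR⊆ : ∀ {u} → u ∈ N G (R i) → u ∈ h.hull ⊎ u ∈ N G h.hull
              NR⊆ {u} u∈N with u ∈? Q
              ... | yes u∈Q = inj₁ (h.mem⁺ u∈Q)
              ... | no u∉Q = inj₂ (subst (u ∈_) (sym h.N≡) (H.N⁺ Q (X.N⊆P-H u∈N , u∉Q , w , w∈Q ,
                t.clique gone (λ { refl → u∉Q w∈Q }) w∈N u∈N (X.N⊆P-H w∈N) (X.N⊆P-H u∈N))))
              module A = X.Absorb h.small h.compat NR⊆
            by-touch (no ¬touch) = record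
              { hull = h.hull ∖ R i ; small = D.small ; mem⁺ = mem⁺
              ; mem⁻ = λ x x∈P → h.mem⁻ (proj₁ (∈∖⁻ {p = h.hull} x)) x∈P
              ; N≡ = trans (D.N≡ (mem⁺ v∈Q)) h.N≡ ; compat = D.compat′ }
              where
              module D = X.Discard h.small h.compat (λ w∈N w∈ → ¬touch (_ , h.mem⁻ w∈ (X.N⊆P-H w∈N) , w∈N))
              mem⁺ : Q ⊆ h.hull ∖ R i
              mem⁺ x = ∈∖⁺ (h.mem⁺ x) λ x∈R → gone x∈R (H.small⊆P s x)

        stage : Stage (suc k)
        stage = record
          { H = H ; path = path
          ; P⁺ = λ v∈P a → P⁺ v∈P (weaken a)
          ; P⁻ = λ v∈P → proj₁ (P⁻ v∈P) , below (proj₂ (P⁻ v∈P)) λ v∈R → gone v∈R v∈P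
          ; E-old = E-old
          ; E-clique = below {A = λ j → ∀ {u v} → u ≢ v → u ∈ N G (R j) → v ∈ N G (R j) → u ∈ P H → v ∈ P H → E H u v}
              E-clique (t.clique gone)
          ; E⁻ = λ e → Sum.map₂ (λ (j , j<k , r) → j , ≤-trans j<k (n≤1+n k) , r) (E⁻ e)
          ; trace = λ s c → trace s (weaken c)
          ; hull = hull′ }

      module Contract {s₀ : Fin m} (s₀∈R : s₀ ∈ R i) (s₀∈P : s₀ ∈ P H) where

        S : Subset m
        S = R i ∩ P H

        s₀∈S : s₀ ∈ S
        s₀∈S = ∈∩⁺ s₀∈R s₀∈P

        N-S : N H S ≡ N G (R i)
        N-S = t.N≡ s₀∈R s₀∈P

        S⁻ : ∀ {v} → v ∈ S → v ∈ R i × v ∈ P H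
        S⁻ = ∈∩⁻ {p = R i}

        -- The purpose of the order of the enumeration: two vertices shared with an earlier
        -- separator have been made adjacent by now. If instead `R i` had two vertices in `G`,
        -- either both are still present or `rich` applies.
        nonclaw : H.NonClaw S
        nonclaw with enabled i
        ... | inj₁ (inj₂ (u , v , u∈ , v∈ , e)) =
          inj₂ (u , v , subst (u ∈_) (sym N-S) u∈ , subst (v ∈_) (sym N-S) v∈ , E-old e)
        ... | inj₂ (j , j<k , u , v , u≢v , u∈ , v∈ , u∈′ , v∈′) =
          inj₂ (u , v , u∈S , v∈S , E-clique j j<k u≢v u∈′ v∈′ (H.N⊆P S u∈S) (H.N⊆P S v∈S))
          where
          u∈S : u ∈ N H S
          u∈S = subst (u ∈_) (sym N-S) u∈
          v∈S : v ∈ N H S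
          v∈S = subst (v ∈_) (sym N-S) v∈
        ... | inj₁ (inj₁ (u , v , u∈ , v∈ , u≢v)) with t.rich s₀∈R s₀∈P
        ... | inj₁ R⊆P = inj₁ (u , v , ∈∩⁺ u∈ (R⊆P u∈) , ∈∩⁺ v∈ (R⊆P v∈) , u≢v)
        ... | inj₂ nc = nc

        S-red : Reducible H S
        S-red = reducible t.small (s₀ , s₀∈S) nonclaw

        H′ : System m
        H′ = H / t.small

        private
          module Q = Quotient H S t.small
          module H′ = System H′

        P′⁻ : ∀ {v} → v ∈ P H′ → v ∈ P H × v ∉ R i
        P′⁻ v∈ with ∈∖⁻ {p = P H} v∈
        ... | v∈P , v∉S = v∈P , λ v∈R → v∉S (∈∩⁺ v∈R v∈P)

        P′⁺ : ∀ {v} → v ∈ P H → v ∉ R i → v ∈ P H′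
        P′⁺ v∈P v∉R = ∈∖⁺ v∈P λ v∈S → v∉R (proj₁ (S⁻ v∈S))

        E′-clique : ∀ {u v} → u ≢ v → u ∈ N G (R i) → v ∈ N G (R i) → E H′ u v
        E′-clique u≢v u∈ v∈ = inj₂ (u≢v , subst (_ ∈_) (sym N-S) u∈ , subst (_ ∈_) (sym N-S) v∈)

        module _ {Q : Subset m} (Q-small : Small G Q) (tQ : Trace H Q) where
          private
            module tQ = Trace tQ
            Q₀ : Subset m
            Q₀ = Q ∩ P H

          trace-inside : Q ⊆ R i → Trace H′ Q
          trace-inside Q⊆R = record
            { small = (λ v∈ → ⊥-elim (no-elt v∈)) , H.down t.small (λ v∈ → ⊥-elim (no-lift v∈))
                (≤-trans (p⊆q⇒∣p∣≤∣q∣ {q = N H S} λ v∈ → ⊥-elim (no-nbr v∈)) (H.N≤3 t.small))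
            ; clique = λ _ u≢v u∈ v∈ u∈P v∈P → E′-clique u≢v (NQ⊆NR u∈ u∈P) (NQ⊆NR v∈ v∈P)
            ; N≡ = λ v∈Q v∈P → ⊥-elim (proj₂ (P′⁻ v∈P) (Q⊆R v∈Q))
            ; rich = λ v∈Q v∈P → ⊥-elim (proj₂ (P′⁻ v∈P) (Q⊆R v∈Q)) }
            where
            no-elt : ∀ {v} → v ∉ Q ∩ P H′
            no-elt v∈ with ∈∩⁻ {p = Q} v∈
            ... | v∈Q , v∈P = proj₂ (P′⁻ v∈P) (Q⊆R v∈Q)
            no-lift : ∀ {v} → v ∉ Q.lift (Q ∩ P H′)
            no-lift v∈ with Q.lift⁻ (Q ∩ P H′) v∈
            ... | inj₁ j = no-elt j
            ... | inj₂ (_ , _ , j , _) = no-elt j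
            no-nbr : ∀ {v} → v ∉ N H (Q.lift (Q ∩ P H′))
            no-nbr v∈ with H.N⁻ (Q.lift (Q ∩ P H′)) v∈
            ... | _ , _ , _ , w∈ , _ = no-lift w∈
            NQ⊆NR : ∀ {u} → u ∈ N G Q → u ∈ P H′ → u ∈ N G (R i)
            NQ⊆NR u∈ u∈P with G.N⁻ Q u∈
            ... | u∈PG , _ , q , q∈ , e = G.N⁺ (R i) (u∈PG , proj₂ (P′⁻ u∈P) , q , Q⊆R q∈ , e)

          trace-contains : R i ⊆ Q → Trace H′ Q
          trace-contains R⊆Q = record
            { small = subst (Small H′) (sym Q₁≡D) D.D-small
            ; clique = clique
            ; N≡ = λ v∈Q v∈P → trans (cong (N H′) Q₁≡D) (trans (D.N-D (∈D v∈Q v∈P)) (tQ.N≡ v∈Q (proj₁ (P′⁻ v∈P))))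
            ; rich = λ v∈Q v∈P → inj₂ (subst H′.NonClaw (sym Q₁≡D)
                (Reducible.nonclaw (D.D-reducible (_ , ∈D v∈Q v∈P)))) }
            where
            S⊆Q₀ : S ⊆ Q₀
            S⊆Q₀ v∈ = ∈∩⁺ (R⊆Q (proj₁ (S⁻ v∈))) (proj₂ (S⁻ v∈))
            module D = Nested⊆ {H = H} t.small tQ.small S⊆Q₀ (s₀ , s₀∈S)
            ∈D : ∀ {v} → v ∈ Q → v ∈ P H′ → v ∈ D.D
            ∈D v∈Q v∈P = ∈∖⁺ (∈∩⁺ v∈Q (proj₁ (P′⁻ v∈P))) λ v∈S → proj₂ (P′⁻ v∈P) (proj₁ (S⁻ v∈S))
            Q₁≡D : Q ∩ P H′ ≡ D.D
            Q₁≡D = ⊆-antisym (λ v∈ → let (a , b) = ∈∩⁻ {p = Q} v∈ in ∈D a b)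
              λ v∈ → let (a , b) = ∈∖⁻ {p = Q₀} v∈ ; (c , d) = ∈∩⁻ {p = Q} a in ∈∩⁺ c (∈∖⁺ d b)
            clique : (∀ {v} → v ∈ Q → v ∉ P H′) → ∀ {u v} → u ≢ v → u ∈ N G Q → v ∈ N G Q →
              u ∈ P H′ → v ∈ P H′ → E H′ u v
            clique empty u≢v u∈ v∈ _ _ = inj₂ (u≢v , subst (_ ∈_) N≡ u∈ , subst (_ ∈_) N≡ v∈)
              where
              Q₀⊆S : Q₀ ⊆ S
              Q₀⊆S {w} w∈ with ∈∩⁻ {p = Q} w∈ | w ∈? R i
              ... | _ , w∈P | yes w∈R = ∈∩⁺ w∈R w∈P
              ... | w∈Q , w∈P | no w∉R = ⊥-elim (empty w∈Q (P′⁺ w∈P w∉R))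
              N≡ : N G Q ≡ N H S
              N≡ = trans (sym (tQ.N≡ (R⊆Q s₀∈R) s₀∈P)) (cong (N H) (⊆-antisym Q₀⊆S S⊆Q₀))

          trace-apart : Apart Q (R i) → Trace H′ Q
          trace-apart a = record
            { small = subst (Small H′) (sym Q₁≡) F.small
            ; clique = λ empty u≢v u∈ v∈ u∈P v∈P → inj₁ (tQ.clique
                (λ v∈Q v∈P → empty v∈Q (P′⁺ v∈P λ v∈R → proj₁ (a v∈Q v∈R) refl))
                u≢v u∈ v∈ (proj₁ (P′⁻ u∈P)) (proj₁ (P′⁻ v∈P)))
            ; N≡ = λ v∈Q v∈P → trans (cong (N H′) Q₁≡) (trans F.N-S (tQ.N≡ v∈Q (proj₁ (P′⁻ v∈P))))
            ; rich = λ v∈Q v∈P → Sum.map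
                (λ Q⊆P {w} w∈Q → P′⁺ (Q⊆P w∈Q) λ w∈R → proj₁ (a w∈Q w∈R) refl)
                (λ nc → subst H′.NonClaw (sym Q₁≡) (Reducible.nonclaw
                  (F.reducible-S (reducible tQ.small (_ , ∈∩⁺ v∈Q (proj₁ (P′⁻ v∈P))) nc))))
                (tQ.rich v∈Q (proj₁ (P′⁻ v∈P))) }
            where
            far : ∀ {v} → v ∈ Q₀ → v ∈ N H S → ⊥
            far {v} v∈ v∈N with G.N⁻ (R i) (subst (v ∈_) N-S v∈N)
            ... | _ , _ , r , r∈R , e = proj₂ (a (proj₁ (∈∩⁻ {p = Q} v∈)) r∈R) (G.E-sym e)
            module F = Far {H = H} t.small tQ.small
              (λ v∈S v∈Q → proj₁ (a (proj₁ (∈∩⁻ {p = Q} v∈Q)) (proj₁ (S⁻ v∈S))) refl) far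
            Q₁≡ : Q ∩ P H′ ≡ Q₀
            Q₁≡ = ⊆-antisym (λ v∈ → let (c , d) = ∈∩⁻ {p = Q} v∈ in ∈∩⁺ c (proj₁ (P′⁻ d)))
              λ v∈ → let (c , d) = ∈∩⁻ {p = Q} v∈ in ∈∩⁺ c (P′⁺ d λ v∈R → proj₁ (a c v∈R) refl)

        -- Relative to the set contracted last, `Q` has vanished, contains it as in `Nested⊆`, or is
        -- not changed at all as in `Far`.
        trace′ : ∀ {Q} → Small G Q → (∀ j → toℕ j < suc k → Compat Q (R j)) → Trace H′ Q
        trace′ s c with now c
        ... | inside h = trace-inside s (trace s (weaken c)) h
        ... | contains h = trace-contains s (trace s (weaken c)) h
        ... | apart h = trace-apart s (trace s (weaken c)) h

        hull′ : ∀ {Q v} → Small H′ Q → v ∈ Q → Hull (suc k) H′ Q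
        hull′ {Q} {v} (Q⊆P′ , s) v∈Q = by-touch (meets? Q (N H S))
          where
          h : Hull k H (Q.lift Q)
          h = hull s (Q.lift⁺ Q (inj₁ v∈Q))
          module h = Hull h
          module X = Extend (λ j j<k R⊆ → proj₂ (P⁻ s₀∈P) j j<k (R⊆ s₀∈R))
          N≡′ : N G h.hull ≡ N H′ Q
          N≡′ = trans h.N≡ (sym (Q.N′≡N-lift Q⊆P′))
          back : ∀ {w} → w ∈ h.hull → w ∈ P H′ → w ∈ Q
          back w∈ w∈P with Q.lift⁻ Q (h.mem⁻ w∈ (proj₁ (P′⁻ w∈P)))
          ... | inj₁ w∈Q = w∈Q
          ... | inj₂ (w∈S , _) = ⊥-elim (proj₂ (P′⁻ w∈P) (proj₁ (S⁻ w∈S)))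
          by-touch : Dec (∃[ w ] (w ∈ Q × w ∈ N H S)) → Hull (suc k) H′ Q
          by-touch (yes (w , w∈Q , w∈N)) = record
            { hull = h.hull ∪ R i ; small = A.small ; mem⁺ = λ x → ∈∪ˡ (h.mem⁺ (Q.lift⁺ Q (inj₁ x)))
            ; mem⁻ = λ x x∈P → [ (λ y → back y x∈P) , (λ y → ⊥-elim (proj₂ (P′⁻ x∈P) y)) ]′ (∈∪⁻ {p = h.hull} x)
            ; N≡ = trans A.N≡ N≡′ ; compat = A.compat′ }
            where
            NR⊆ : ∀ {u} → u ∈ N G (R i) → u ∈ h.hull ⊎ u ∈ N G h.hull
            NR⊆ {u} u∈N with u ∈? Q.lift Q | H.N⁻ S (subst (u ∈_) (sym N-S) u∈N)
            ... | yes u∈L | _ = inj₁ (h.mem⁺ u∈L)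
            ... | no u∉L | u∈P , _ , r , r∈S , e = inj₂ (subst (u ∈_) (sym h.N≡)
              (H.N⁺ (Q.lift Q) (u∈P , u∉L , r , Q.lift⁺ Q (inj₂ (r∈S , w , w∈Q , w∈N)) , e)))
            module A = X.Absorb h.small h.compat NR⊆
          by-touch (no ¬touch) = record
            { hull = h.hull ∖ R i ; small = D.small ; mem⁺ = mem⁺
            ; mem⁻ = λ x x∈P → back (proj₁ (∈∖⁻ {p = h.hull} x)) x∈P
            ; N≡ = trans (D.N≡ (mem⁺ v∈Q)) N≡′ ; compat = D.compat′ }
            where
            untouched : ∀ {w} → w ∈ N G (R i) → w ∉ h.hull
            untouched {w} w∈N w∈ with Q.lift⁻ Q (h.mem⁻ w∈ (X.N⊆P-H w∈N))
            ... | inj₁ w∈Q = ¬touch (w , w∈Q , subst (w ∈_) (sym N-S) w∈N)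
            ... | inj₂ (_ , t) = ¬touch t
            module D = X.Discard h.small h.compat untouched
            mem⁺ : Q ⊆ h.hull ∖ R i
            mem⁺ x = ∈∖⁺ (h.mem⁺ (Q.lift⁺ Q (inj₁ x))) (proj₂ (P′⁻ (Q⊆P′ x)))

        stage : Stage (suc k)
        stage = record
          { H = H′
          ; path = λ p → path (step S-red p)
          ; P⁺ = λ v∈P a → P′⁺ (P⁺ v∈P (weaken a)) (now a)
          ; P⁻ = λ v∈P → proj₁ (P⁻ (proj₁ (P′⁻ v∈P))) , below (proj₂ (P⁻ (proj₁ (P′⁻ v∈P)))) (proj₂ (P′⁻ v∈P))
          ; E-old = λ e → inj₁ (E-old e)
          ; E-clique = below {A = λ j → ∀ {u v} → u ≢ v → u ∈ N G (R j) → v ∈ N G (R j) → u ∈ P H′ → v ∈ P H′ → E H′ u v}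
              (λ j j<k u≢v a b c d → inj₁ (E-clique j j<k u≢v a b (proj₁ (P′⁻ c)) (proj₁ (P′⁻ d))))
              (λ u≢v a b _ _ → E′-clique u≢v a b)
          ; E⁻ = λ { (inj₁ e) → Sum.map₂ (λ (j , j<k , r) → j , ≤-trans j<k (n≤1+n k) , r) (E⁻ e)
                   ; (inj₂ (_ , a , b)) → inj₂ (i , ≤-refl , subst (_ ∈_) N-S a , subst (_ ∈_) N-S b) }
          ; trace = trace′
          ; hull = hull′ }

      next : Stage (suc k)
      next with meets? (R i) (P H)
      ... | yes (_ , s∈R , s∈P) = Contract.stage s∈R s∈P
      ... | no ¬meet = Skip.stage λ v∈R v∈P → ¬meet (_ , v∈R , v∈P)

    stages : ∀ k → k ≤ ℓ → Stage k
    stages zero _ = start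
    stages (suc k) k<ℓ =
      subst (Stage ∘ suc) (toℕ-fromℕ< k<ℓ) (next (fromℕ< k<ℓ) (subst Stage (sym (toℕ-fromℕ< k<ℓ)) (stages k (<⇒≤ k<ℓ))))

    final : Stage ℓ
    final = stages ℓ ≤-refl

-- Normal systems are internally 4-connected

module _ (H : System m) (normal : Normal H) (4<∣P∣ : ∣ P H ∣ > 4)
  {F : Fin m → Fin m → Set}
  (F⇒E : ∀ {u v} → u ∈ P H → v ∈ P H → F u v → E H u v)
  (E⇒F : ∀ {u v} → u ∈ P H → v ∈ P H → E H u v → F u v) where
  open System H hiding (P; E; N; Small; Reducible; reducible; Normal)

  private
    singleton : ∀ {Q u v} → Small H Q → u ∈ Q → v ∈ Q → u ≡ v
    singleton {Q} {u} {v} s u∈ v∈ with u ≟ v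
    ... | yes e = e
    ... | no ne = ⊥-elim (normal Q (reducible s (u , u∈) (inj₁ (u , v , u∈ , v∈ , ne))))

    ∈P : ∀ {S v} → v ∈ P H ─ S → v ∈ P H
    ∈P {S} i = proj₁ (∈─⁻ {p = P H} i)

    ∉S : ∀ {S v} → v ∈ P H ─ S → v ∉ S
    ∉S {S} i = proj₂ (∈─⁻ {p = P H} i)

    ∣N∣≤3 : ∀ {C S} → ∣ S ∣ ≤ 3 → N H C ⊆ S → ∣ N H C ∣ ≤ 3
    ∣N∣≤3 S≤3 N⊆ = ≤-trans (p⊆q⇒∣p∣≤∣q∣ N⊆) S≤3

    N-cut : ∀ {C S} → (∀ {a b} → a ∈ C → b ∈ P H ─ S → E H a b → b ∈ C) → N H C ⊆ S
    N-cut {C} {S} closed {b} b∈N with N⁻ C b∈N | b ∈? S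
    ... | _ | yes b∈S = b∈S
    ... | b∈P , b∉C , a , a∈C , e | no b∉S = ⊥-elim (b∉C (closed a∈C (∈─⁺ b∈P b∉S) e))

    small-side : ∀ {S} → ∣ S ∣ ≤ 3 → Cut E? (P H ─ S) → ∃[ Q ] ∃[ q ] (Small H Q × q ∈ Q × N H Q ⊆ S)
    small-side {S} S≤3 c with dich C (λ i → ∈P (C⊆X i)) (∣N∣≤3 S≤3 N⊆S)
      where
      open Cut c
      N⊆S : N H C ⊆ S
      N⊆S = N-cut closed
    ... | inj₁ s = Cut.C c , Cut.u c , s , Cut.u∈C c , N-cut (Cut.closed c)
    ... | inj₂ s = rest (Cut.C c) , Cut.v c , s
      , rest⁺ (Cut.C c) (∈P (Cut.v∈X c)) (Cut.v∉C c) (λ i → ∉S (Cut.v∈X c) (N-cut (Cut.closed c) i))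
      , λ i → N-cut (Cut.closed c) (N-rest (Cut.C c) i)

    kconnected : KConnected F 3 (P H)
    kconnected = ≤-trans (n≤1+n 4) 4<∣P∣ , connected
      where
      connected : ∀ S → S ⊆ P H → ∣ S ∣ < 3 → Connected F (P H ─ S)
      connected S S⊆P S<3 with connected-or-cut E? (P H ─ S)
      ... | inj₁ c = λ u v u∈ v∈ → Reach-map id (λ i j → E⇒F (∈P i) (∈P j)) (c u v u∈ v∈)
      ... | inj₂ c with small-side (<⇒≤ S<3) c
      ... | Q , q , s , q∈ , N⊆S = ⊥-elim (<⇒≱ S<3 (≤-trans (N≥3 s id q∈) (p⊆q⇒∣p∣≤∣q∣ N⊆S)))

    module _ {S : Subset m} (∣S∣≡3 : ∣ S ∣ ≡ 3) {Q : Subset m} {q : Fin m}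
      (Q-small : Small H Q) (q∈Q : q ∈ Q) (NQ⊆S : N H Q ⊆ S) where

      NQ≡S : N H Q ≡ S
      NQ≡S = squeeze NQ⊆S (N≥3 Q-small id q∈Q) (≤-reflexive ∣S∣≡3)

      S⊆NQ : S ⊆ N H Q
      S⊆NQ = subst (_ ∈_) (sym NQ≡S)

      independent : ∀ u v → u ∈ S → v ∈ S → ¬ F u v
      independent u v u∈ v∈ f = normal Q (reducible Q-small (q , q∈Q)
        (inj₂ (u , v , S⊆NQ u∈ , S⊆NQ v∈ , F⇒E (N⊆P Q (S⊆NQ u∈)) (N⊆P Q (S⊆NQ v∈)) f)))

      Q≡q : ∀ {v} → v ∈ Q → v ≡ q
      Q≡q i = singleton Q-small i q∈Q

      q∉S : q ∉ S
      q∉S i = N-disjoint Q (S⊆NQ i) q∈Q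

      q-nbr : ∀ {w} → w ∈ P H → E H q w → w ∈ S
      q-nbr {w} w∈P e = NQ⊆S (N⁺ Q (w∈P , (λ w∈Q → E-irrefl (subst (E H q) (Q≡q w∈Q) e)) , q , q∈Q , e))

      S-nbr-q : ∀ {v} → v ∈ S → E H q v
      S-nbr-q v∈S with N⁻ Q (S⊆NQ v∈S)
      ... | _ , _ , u , u∈Q , e = subst (λ u → E H u _) (Q≡q u∈Q) e

      q∈P : q ∈ P H
      q∈P = small⊆P Q-small q∈Q

      C₂ : Subset m
      C₂ = (P H ─ S) - q

      C₂⁻ : ∀ {v} → v ∈ C₂ → v ∈ P H × v ∉ S × v ≢ q
      C₂⁻ i with ∈-⁻ {p = P H ─ S} i
      ... | j , ne = ∈P j , ∉S j , ne

      C₂⁺ : ∀ {v} → v ∈ P H → v ∉ S → v ≢ q → v ∈ C₂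
      C₂⁺ a b c = x∈p∧x≢y⇒x∈p-y (∈─⁺ a b) c

      nonempty : ∃[ v ] v ∈ C₂
      nonempty with proper Q-small
      ... | v , v∈ with rest⁻ Q v∈
      ... | v∈P , v∉Q , v∉N = v , C₂⁺ v∈P (v∉N ∘ S⊆NQ) λ { refl → v∉Q q∈Q }

      C₂-step : ∀ {a w} → a ∈ C₂ → w ∈ P H ─ S → E H a w → w ∈ C₂
      C₂-step a∈ w∈ e with C₂⁻ a∈
      ... | a∈P , a∉S , _ = C₂⁺ (∈P w∈) (∉S w∈) λ { refl → a∉S (q-nbr a∈P (E-sym e)) }

      module _ {D : Subset m} {d e : Fin m} (D⊆ : D ⊆ C₂) (d∈ : d ∈ D) (e∈ : e ∈ C₂) (e∉ : e ∉ D)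
        (closed : ∀ {a b} → a ∈ D → b ∈ C₂ → E H a b → b ∈ D) where

        N-part : N H D ⊆ S
        N-part = N-cut λ a∈ b∈ e → closed a∈ (C₂-step (D⊆ a∈) b∈ e) e

        -- Otherwise `rest D` would be small; but it contains both `e` and `q`, and small sets of a
        -- normal system have at most one vertex.
        part-small : Small H D
        part-small with dich D (λ i → proj₁ (C₂⁻ (D⊆ i))) (∣N∣≤3 (≤-reflexive ∣S∣≡3) N-part)
        ... | inj₁ s = s
        ... | inj₂ s with C₂⁻ e∈
        ... | e∈P , e∉S , e≢q = ⊥-elim (e≢q (singleton s (rest⁺ D e∈P e∉ (e∉S ∘ N-part))
          (rest⁺ D q∈P (λ i → proj₂ (proj₂ (C₂⁻ (D⊆ i))) refl) (q∉S ∘ N-part))))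

      -- Both parts of a cut would be small by `part-small`. Together with `Q` they have all their
      -- neighbours in `S`, so their union is small, yet with `S` it exhausts `P H`, against
      -- `proper`.
      C₂-connected : Connected (E H) C₂
      C₂-connected with connected-or-cut E? C₂
      ... | inj₁ c = c
      ... | inj₂ c = ⊥-elim (all-small (proper (union Q-small (union D-small D′-small D∪D′≤3) U≤3)))
        where
        open Cut c renaming (C to D; C⊆X to D⊆; u to d; u∈C to d∈; v to e; v∈X to e∈; v∉C to e∉)
        D′ U : Subset m
        D′ = C₂ ∖ D
        U = Q ∪ (D ∪ D′)
        D′⊆ : D′ ⊆ C₂
        D′⊆ i = proj₁ (∈∖⁻ {p = C₂} i)
        D-small : Small H D
        D-small = part-small D⊆ d∈ e∈ e∉ closed
        closed′ : ∀ {a b} → a ∈ D′ → b ∈ C₂ → E H a b → b ∈ D′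
        closed′ a∈ b∈ e with ∈∖⁻ {p = C₂} a∈
        ... | a∈C , a∉D = ∈∖⁺ b∈ λ b∈D → a∉D (closed b∈D a∈C (E-sym e))
        D′-small : Small H D′
        D′-small = part-small D′⊆ (∈∖⁺ e∈ e∉) (D⊆ d∈) (λ i → proj₂ (∈∖⁻ {p = C₂} i) d∈) closed′
        D∪D′⊆S : N H (D ∪ D′) ⊆ S
        D∪D′⊆S i = [ N-part D⊆ d∈ e∈ e∉ closed
                   , N-part D′⊆ (∈∖⁺ e∈ e∉) (D⊆ d∈) (λ i → proj₂ (∈∖⁻ {p = C₂} i) d∈) closed′ ]′
          (∈∪⁻ {p = N H D} (N-union D D′ i))
        D∪D′≤3 : ∣ N H (D ∪ D′) ∣ ≤ 3
        D∪D′≤3 = ∣N∣≤3 (≤-reflexive ∣S∣≡3) D∪D′⊆S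
        U≤3 : ∣ N H U ∣ ≤ 3
        U≤3 = ∣N∣≤3 (≤-reflexive ∣S∣≡3)
          λ i → [ NQ⊆S , D∪D′⊆S ]′ (∈∪⁻ {p = N H Q} (N-union Q (D ∪ D′) i))
        all-small : ¬ (∃[ v ] v ∈ rest U)
        all-small (v , v∈) with rest⁻ U v∈
        ... | v∈P , v∉U , v∉N with v ∈? S | v ≟ q | v ∈? D
        ... | yes v∈S | _ | _ = v∉N (N⁺ U (v∈P , v∉U , q , ∈∪ˡ q∈Q , S-nbr-q v∈S))
        ... | no _ | yes refl | _ = v∉U (∈∪ˡ q∈Q)
        ... | no _ | no _ | yes v∈D = v∉U (∈∪ʳ {p = Q} (∈∪ˡ v∈D))
        ... | no v∉S | no v≢q | no v∉D = v∉U (∈∪ʳ {p = Q} (∈∪ʳ {p = D} (∈∖⁺ (C₂⁺ v∈P v∉S v≢q) v∉D)))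

      C₁-component : IsComponent F (P H ─ S) ⁅ q ⁆
      C₁-component = (q , x∈⁅x⁆ q) , (λ i → subst (_∈ P H ─ S) (sym (x∈⁅y⁆⇒x≡y q i)) (∈─⁺ q∈P q∉S))
        , (λ u v u∈ v∈ → subst (Reach F ⁅ q ⁆ u) (trans (x∈⁅y⁆⇒x≡y q u∈) (sym (x∈⁅y⁆⇒x≡y q v∈))) (Reach.here u∈))
        , λ u w u∈ w∈ f → ⊥-elim (∉S w∈ (q-nbr (∈P w∈)
            (F⇒E q∈P (∈P w∈) (subst (λ u → F u w) (x∈⁅y⁆⇒x≡y q u∈) f))))

      C₂⊆X : C₂ ⊆ P H ─ S
      C₂⊆X i = proj₁ (∈-⁻ {p = P H ─ S} i)

      C₂-component : IsComponent F (P H ─ S) C₂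
      C₂-component = nonempty , C₂⊆X
        , (λ u v u∈ v∈ → Reach-map id (λ i j → E⇒F (proj₁ (C₂⁻ i)) (proj₁ (C₂⁻ j))) (C₂-connected u v u∈ v∈))
        , λ u w u∈ w∈ f → C₂-step u∈ w∈ (F⇒E (proj₁ (C₂⁻ u∈)) (∈P w∈) f)

      two-components : ∀ C → IsComponent F (P H ─ S) C → C ≡ ⁅ q ⁆ ⊎ C ≡ C₂
      two-components C ((c , c∈) , C⊆X , conn , closed) with q ∈? C
      ... | yes q∈C = inj₁ (⊆-antisym C⊆q λ i → subst (_∈ C) (sym (x∈⁅y⁆⇒x≡y q i)) q∈C)
        where
        C⊆q : C ⊆ ⁅ q ⁆
        C⊆q {v} v∈ = Reach-closed (λ { {a} {b} a∈ b∈ f → ⊥-elim (∉S (C⊆X b∈) (q-nbr (∈P (C⊆X b∈))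
          (F⇒E q∈P (∈P (C⊆X b∈)) (subst (λ u → F u b) (x∈⁅y⁆⇒x≡y q a∈) f)))) }) (x∈⁅x⁆ q) (conn q v q∈C v∈)
      ... | no q∉C = inj₂ (⊆-antisym C⊆C₂ C₂⊆C)
        where
        C⊆C₂ : C ⊆ C₂
        C⊆C₂ i = x∈p∧x≢y⇒x∈p-y (C⊆X i) λ { refl → q∉C i }
        C₂⊆C : C₂ ⊆ C
        C₂⊆C {v} v∈ = Reach-closed (λ {a} {b} a∈ b∈ e → closed a b a∈ (C₂⊆X b∈) (E⇒F (∈P (C⊆X a∈)) (proj₁ (C₂⁻ b∈)) e))
          c∈ (C₂-connected c v (C⊆C₂ c∈) v∈)

  normal⇒internally-4-connected : InternallyFourConnected F (P H)
  normal⇒internally-4-connected = kconnected , 4<∣P∣ , separators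
    where
    separators : ∀ S → S ⊆ P H → ∣ S ∣ ≡ 3 → ¬ Connected F (P H ─ S) →
      (∀ u v → u ∈ S → v ∈ S → ¬ F u v) × _
    separators S S⊆P ∣S∣≡3 ¬conn with connected-or-cut E? (P H ─ S)
    ... | inj₁ c = ⊥-elim (¬conn λ u v u∈ v∈ → Reach-map id (λ i j → E⇒F (∈P i) (∈P j)) (c u v u∈ v∈))
    ... | inj₂ c with small-side (≤-reflexive ∣S∣≡3) c
    ... | Q , q , s , q∈ , N⊆S = independent ∣S∣≡3 s q∈ N⊆S
      , ⁅ q ⁆ , C₂ ∣S∣≡3 s q∈ N⊆S , C₁-component ∣S∣≡3 s q∈ N⊆S , C₂-component ∣S∣≡3 s q∈ N⊆S
      , (λ e → proj₂ (proj₂ (C₂⁻ ∣S∣≡3 s q∈ N⊆S (subst (q ∈_) e (x∈⁅x⁆ q)))) refl)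
      , two-components ∣S∣≡3 s q∈ N⊆S , ∣⁅x⁆∣≡1 q

-- The system of a tangle

module TangleSystem (G : Graph) (3-connected : ThreeConnected G) (τ : OSepSet G) (tangle : Tangle G 4 τ) where

  V : Set
  V = Fin (Graph.n G)

  VSet : Set
  VSet = Subset (Graph.n G)

  Edge? : ∀ u v → Dec (Edge G u v)
  Edge? u v = Graph.adj G u v Bool.≟ true

  Edge-sym : ∀ {u v} → Edge G u v → Edge G v u
  Edge-sym {u} {v} = trans (Graph.sym G v u)

  Edge-irrefl : ∀ {v} → ¬ Edge G v v
  Edge-irrefl {v} e with trans (sym e) (Graph.irref G v)
  ... | ()

  Nb : VSet → VSet
  Nb Q = neighbours ⊤ Edge? Q

  Nb⁺ : ∀ Q {u v} → v ∉ Q → u ∈ Q → Edge G u v → v ∈ Nb Q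
  Nb⁺ Q v∉ u∈ e = neighbours⁺ ⊤ Edge? Q (∈⊤ , v∉ , _ , u∈ , e)

  Nb⁻ : ∀ Q {v} → v ∈ Nb Q → v ∉ Q × ∃[ u ] (u ∈ Q × Edge G u v)
  Nb⁻ Q i = proj₂ (neighbours⁻ ⊤ Edge? Q i)

  side : VSet → OSep G
  side Q = Q ∪ Nb Q , ⊤ ∖ Q

  co⁺ : {Q : VSet} {v : V} → v ∉ Q → v ∈ ⊤ ∖ Q
  co⁺ = ∈∖⁺ ∈⊤

  co⁻ : {Q : VSet} {v : V} → v ∈ ⊤ ∖ Q → v ∉ Q
  co⁻ i = proj₂ (∈∖⁻ {p = ⊤} i)

  closed⁺ : ∀ Q {u v} → u ∈ Q → Edge G u v → v ∈ Q ∪ Nb Q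
  closed⁺ Q {v = v} u∈ e with v ∈? Q
  ... | yes v∈ = ∈∪ˡ v∈
  ... | no v∉ = ∈∪ʳ {p = Q} (Nb⁺ Q v∉ u∈ e)

  ∪-covers : (A B : VSet) → (∀ v → v ∈ A ⊎ v ∈ B) → A ∪ B ≡ ⊤
  ∪-covers A B h = ⊆-antisym (λ _ → ∈⊤) (λ {v} _ → x∈p∪q⁺ (h v))

  side-separation : ∀ Q → IsSeparation G (side Q)
  side-separation Q = ∪-covers (Q ∪ Nb Q) (⊤ ∖ Q) cover , no-edge
    where
    cover : ∀ v → v ∈ Q ∪ Nb Q ⊎ v ∈ ⊤ ∖ Q
    cover v with v ∈? Q
    ... | yes i = inj₁ (∈∪ˡ i)
    ... | no i = inj₂ (co⁺ i)
    no-edge : ∀ u v → u ∈ (Q ∪ Nb Q) ─ (⊤ ∖ Q) → v ∈ (⊤ ∖ Q) ─ (Q ∪ Nb Q) → ¬ Edge G u v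
    no-edge u v u∈ v∈ e with u ∈? Q
    ... | yes u∈Q = proj₂ (∈─⁻ {p = ⊤ ∖ Q} v∈) (closed⁺ Q u∈Q e)
    ... | no u∉Q = proj₂ (∈─⁻ {p = Q ∪ Nb Q} u∈) (co⁺ u∉Q)

  side-separator : ∀ Q → separator G (side Q) ≡ Nb Q
  side-separator Q = ⊆-antisym to λ i → ∈∩⁺ (∈∪ʳ {p = Q} i) (co⁺ (proj₁ (Nb⁻ Q i)))
    where
    to : separator G (side Q) ⊆ Nb Q
    to i with ∈∩⁻ {p = Q ∪ Nb Q} i
    ... | a , b = [ (λ v∈Q → ⊥-elim (co⁻ b v∈Q)) , id ]′ (∈∪⁻ {p = Q} a)

  side-order : ∀ Q → order G (side Q) ≡ ∣ Nb Q ∣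
  side-order Q = cong ∣_∣ (side-separator Q)

  swap-separation : ∀ {s} → IsSeparation G s → IsSeparation G (swap G s)
  swap-separation {A , B} (c , ne) =
    ∪-covers B A (λ v → Sum.swap (∈∪⁻ {p = A} (subst (v ∈_) (sym c) ∈⊤))) , λ u v u∈ v∈ e → ne v u v∈ u∈ (Edge-sym e)

  swap-order : ∀ s → order G (swap G s) ≡ order G s
  swap-order (A , B) = cong ∣_∣ (⊆-antisym (flip∩ {B} {A}) (flip∩ {A} {B}))
    where
    flip∩ : ∀ {A B : VSet} → A ∩ B ⊆ B ∩ A
    flip∩ {A} i = let (a , b) = ∈∩⁻ {p = A} i in ∈∩⁺ b a

  τ-order : ∀ {s} → τ s → order G s ≤ 3
  τ-order t = ≤-pred (proj₂ (proj₁ tangle _ t))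

  orient : ∀ {s} → IsSeparation G s → order G s ≤ 3 → τ s ⊎ τ (swap G s)
  orient sep ≤3 = proj₁ (proj₂ tangle) _ sep (s≤s ≤3)

  no-cover₃ : ∀ {s₁ s₂ s₃} → τ s₁ → τ s₂ → τ s₃ →
    (∀ v → v ∈ proj₁ s₁ ⊎ v ∈ proj₁ s₂ ⊎ v ∈ proj₁ s₃) →
    ¬ (∀ u v → Edge G u v → (u ∈ proj₁ s₁ × v ∈ proj₁ s₁) ⊎ (u ∈ proj₁ s₂ × v ∈ proj₁ s₂) ⊎
                            (u ∈ proj₁ s₃ × v ∈ proj₁ s₃))
  no-cover₃ t₁ t₂ t₃ cv ce = proj₂ (proj₂ (proj₂ tangle)) _ _ _ t₁ t₂ t₃
    (∪-covers _ _ (λ v → Sum.map₂ x∈p∪q⁺ (cv v)) , ce)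

  no-cover₂ : ∀ {s₁ s₂} → τ s₁ → τ s₂ → (∀ v → v ∈ proj₁ s₁ ⊎ v ∈ proj₁ s₂) →
    ¬ (∀ u v → Edge G u v → (u ∈ proj₁ s₁ × v ∈ proj₁ s₁) ⊎ (u ∈ proj₁ s₂ × v ∈ proj₁ s₂))
  no-cover₂ t₁ t₂ cv ce = no-cover₃ t₁ t₂ t₂ (λ v → Sum.map₂ inj₁ (cv v)) λ u v e → Sum.map₂ inj₁ (ce u v e)

  many-neighbours : ∀ {D d w} → d ∈ D → w ∉ D → w ∉ Nb D → 3 ≤ ∣ Nb D ∣
  many-neighbours {D} {d} {w} d∈ w∉D w∉N with 3 ≤? ∣ Nb D ∣
  ... | yes h = h
  ... | no h = ⊥-elim (w∉D (Reach-closed closed d∈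
    (proj₂ 3-connected (Nb D) (λ _ → ∈⊤) (≰⇒> h) d w (∈─⁺ ∈⊤ (λ i → proj₁ (Nb⁻ D i) d∈)) (∈─⁺ ∈⊤ w∉N))))
    where
    closed : ∀ {a b} → a ∈ D → b ∈ ⊤ ─ Nb D → Edge G a b → b ∈ D
    closed {b = b} a∈ b∈ e with b ∈? D
    ... | yes b∈D = b∈D
    ... | no b∉D = ⊥-elim (proj₂ (∈─⁻ {p = ⊤} b∈) (Nb⁺ D b∉D a∈ e))

  SmallSet : VSet → Set
  SmallSet Q = τ (side Q)

  far : VSet → VSet
  far Q = (⊤ ∖ Q) ∖ Nb Q

  far⁺ : ∀ Q {v} → v ∉ Q → v ∉ Nb Q → v ∈ far Q
  far⁺ Q a b = ∈∖⁺ (co⁺ a) b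

  far⁻ : ∀ Q {v} → v ∈ far Q → v ∉ Q × v ∉ Nb Q
  far⁻ Q i with ∈∖⁻ {p = ⊤ ∖ Q} i
  ... | a , b = co⁻ a , b

  orient-side : ∀ Q → ∣ Nb Q ∣ ≤ 3 → SmallSet Q ⊎ τ (swap G (side Q))
  orient-side Q ≤3 = orient (side-separation Q) (≤-trans (≤-reflexive (side-order Q)) ≤3)

  edge-cover : ∀ {X : Set} Q u v → Edge G u v →
    (u ∈ Q ∪ Nb Q → v ∈ Q ∪ Nb Q → X) → (u ∉ Q → v ∉ Q → X) → X
  edge-cover Q u v e f g with u ∈? Q | v ∈? Q
  ... | yes u∈ | _ = f (∈∪ˡ u∈) (closed⁺ Q u∈ e)
  ... | no _ | yes v∈ = f (closed⁺ Q v∈ (Edge-sym e)) (∈∪ˡ v∈)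
  ... | no u∉ | no v∉ = g u∉ v∉

  cover-co : ∀ {A Q} → (∀ {v} → v ∈ Q → v ∈ A) → ∀ v → v ∈ A ⊎ v ∈ ⊤ ∖ Q
  cover-co {Q = Q} h v with v ∈? Q
  ... | yes i = inj₁ (h i)
  ... | no i = inj₂ (co⁺ i)

  private
    far-nonempty : ∀ {Q} → SmallSet Q → ∃[ v ] v ∈ far Q
    far-nonempty {Q} s with inhabited? (far Q)
    ... | yes v = v
    ... | no ¬v = ⊥-elim (no-cover₂ s s (λ v → inj₁ (all v)) λ u v _ → inj₁ (all u , all v))
      where
      all : ∀ v → v ∈ Q ∪ Nb Q
      all v with v ∈? Q | v ∈? Nb Q
      ... | yes i | _ = ∈∪ˡ i
      ... | no _ | yes i = ∈∪ʳ {p = Q} i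
      ... | no a | no b = ⊥-elim (¬v (v , far⁺ Q a b))

    Nb≥3 : ∀ {Q Q′ v} → SmallSet Q → Q′ ⊆ Q → v ∈ Q′ → 3 ≤ ∣ Nb Q′ ∣
    Nb≥3 {Q} {Q′} s Q′⊆Q v∈ with far-nonempty s
    ... | w , w∈ with far⁻ Q w∈
    ... | w∉Q , w∉N = many-neighbours v∈ (w∉Q ∘ Q′⊆Q) λ i →
      let (_ , u , u∈ , e) = Nb⁻ Q′ i in w∉N (Nb⁺ Q w∉Q (Q′⊆Q u∈) e)

    down′ : ∀ {Q Q′} → SmallSet Q → Q′ ⊆ Q → ∣ Nb Q′ ∣ ≤ 3 → SmallSet Q′
    down′ {Q} {Q′} s Q′⊆Q ≤3 with orient-side Q′ ≤3
    ... | inj₁ s′ = s′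
    ... | inj₂ t = ⊥-elim (no-cover₂ s t (cover-co (∈∪ˡ ∘ Q′⊆Q)) λ u v e →
      edge-cover Q u v e (λ a b → inj₁ (a , b)) λ a b → inj₂ (co⁺ (a ∘ Q′⊆Q) , co⁺ (b ∘ Q′⊆Q)))

    union′ : ∀ {Q Q′} → SmallSet Q → SmallSet Q′ → ∣ Nb (Q ∪ Q′) ∣ ≤ 3 → SmallSet (Q ∪ Q′)
    union′ {Q} {Q′} s s′ ≤3 with orient-side (Q ∪ Q′) ≤3
    ... | inj₁ t = t
    ... | inj₂ t = ⊥-elim (no-cover₃ s s′ t cover λ u v e →
      edge-cover Q u v e (λ a b → inj₁ (a , b)) λ u∉ v∉ →
      edge-cover Q′ u v e (λ a b → inj₂ (inj₁ (a , b))) λ u∉′ v∉′ →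
        inj₂ (inj₂ (co⁺ ([ u∉ , u∉′ ]′ ∘ ∈∪⁻ {p = Q}) , co⁺ ([ v∉ , v∉′ ]′ ∘ ∈∪⁻ {p = Q}))))
      where
      cover : ∀ v → v ∈ Q ∪ Nb Q ⊎ v ∈ Q′ ∪ Nb Q′ ⊎ v ∈ ⊤ ∖ (Q ∪ Q′)
      cover v with v ∈? Q | v ∈? Q′
      ... | yes i | _ = inj₁ (∈∪ˡ i)
      ... | no _ | yes i = inj₂ (inj₁ (∈∪ˡ i))
      ... | no a | no b = inj₂ (inj₂ (co⁺ ([ a , b ]′ ∘ ∈∪⁻ {p = Q})))

    -- `swap (side Q)` need not be `side (far Q)`, as a neighbour of `Q` may have no neighbour in
    -- `far Q`. The tangle closes the gap: if neither set were small, the complements of `Q` and of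
    -- `far Q` would cover `G`.
    dich′ : ∀ Q → Q ⊆ ⊤ → ∣ Nb Q ∣ ≤ 3 → SmallSet Q ⊎ SmallSet (far Q)
    dich′ Q _ ≤3 with orient-side Q ≤3
    ... | inj₁ s = inj₁ s
    ... | inj₂ t with orient-side (far Q) (≤-trans (p⊆q⇒∣p∣≤∣q∣ sub) ≤3)
      where
      sub : Nb (far Q) ⊆ Nb Q
      sub {v} i with Nb⁻ (far Q) i | v ∈? Nb Q | v ∈? Q
      ... | _ | yes j | _ = j
      ... | v∉ , _ | no a | no b = ⊥-elim (v∉ (far⁺ Q b a))
      ... | _ , u , u∈ , e | no _ | yes v∈Q with far⁻ Q u∈
      ... | u∉Q , u∉N = ⊥-elim (u∉N (Nb⁺ Q u∉Q v∈Q (Edge-sym e)))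
    ... | inj₁ s = inj₂ s
    ... | inj₂ t′ = ⊥-elim (no-cover₂ t t′ (λ v → Sum.swap (cover-co (λ i → co⁺ λ j → proj₁ (far⁻ Q j) i) v))
      λ u v e → edge-cover Q u v e
        (λ a b → inj₂ (co⁺ (not-far a) , co⁺ (not-far b))) λ a b → inj₁ (co⁺ a , co⁺ b))
      where
      not-far : ∀ {v} → v ∈ Q ∪ Nb Q → v ∉ far Q
      not-far i j with far⁻ Q j | ∈∪⁻ {p = Q} i
      ... | a , _ | inj₁ v∈Q = a v∈Q
      ... | _ , b | inj₂ v∈N = b v∈N

  base : System (Graph.n G)
  base .System.P = ⊤
  base .System.E = Edge G
  base .System.E? = Edge?
  base .System.E-sym = Edge-sym
  base .System.E-irrefl = Edge-irrefl
  base .System.Small = SmallSet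
  base .System.small⊆P _ _ = ∈⊤
  base .System.N≤3 {Q} s = ≤-trans (≤-reflexive (sym (side-order Q))) (τ-order s)
  base .System.N≥3 = Nb≥3
  base .System.down = down′
  base .System.union = union′
  base .System.dich = dich′
  base .System.proper = far-nonempty

  record Oriented (s : OSep G) : Set where
    field
      R        : VSet
      small    : SmallSet R
      nonempty : ∃[ v ] v ∈ R
      is-side  : s ≡ side R

  -- 3-connectivity leaves no slack: the neighbours of `A ─ B` lie in the separator, are at least
  -- three, and hence are all of it. So a single vertex set determines the separation.
  τ⇒Oriented : ∀ {s} → Proper3 G s → τ s → Oriented s
  τ⇒Oriented {A , B} ((c , no-edge) , ((r , r∈) , (w , w∈)) , ord) t = record
    { R = A ─ B ; small = subst τ s≡ t ; nonempty = r , r∈ ; is-side = s≡ }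
    where
    R : VSet
    R = A ─ B
    R⁻ : ∀ {v} → v ∈ R → v ∈ A × v ∉ B
    R⁻ = ∈─⁻ {p = A}
    in-B : ∀ {v} → v ∉ R → v ∈ B
    in-B {v} v∉ with v ∈? B | ∈∪⁻ {p = A} (subst (v ∈_) (sym c) ∈⊤)
    ... | yes i | _ = i
    ... | no _ | inj₂ i = i
    ... | no i | inj₁ j = ⊥-elim (v∉ (∈─⁺ j i))
    N⊆A∩B : Nb R ⊆ A ∩ B
    N⊆A∩B {v} i with Nb⁻ R i | v ∈? A
    ... | v∉ , _ | yes v∈A = ∈∩⁺ v∈A (in-B v∉)
    ... | v∉ , u , u∈ , e | no v∉A = ⊥-elim (no-edge u v u∈ (∈─⁺ (in-B v∉) v∉A) e)
    w∉A : w ∉ A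
    w∉A = proj₂ (∈─⁻ {p = B} w∈)
    N≡A∩B : Nb R ≡ A ∩ B
    N≡A∩B = squeeze N⊆A∩B (many-neighbours r∈ (w∉A ∘ proj₁ ∘ R⁻) (λ i → w∉A (proj₁ (∈∩⁻ {p = A} (N⊆A∩B i)))))
      (≤-reflexive ord)
    A≡ : A ≡ R ∪ Nb R
    A≡ = ⊆-antisym to λ i → [ proj₁ ∘ R⁻ , proj₁ ∘ ∈∩⁻ {p = A} ∘ N⊆A∩B ]′ (∈∪⁻ {p = R} i)
      where
      to : A ⊆ R ∪ Nb R
      to {v} i with v ∈? B
      ... | yes j = ∈∪ʳ {p = R} (subst (v ∈_) (sym N≡A∩B) (∈∩⁺ i j))
      ... | no j = ∈∪ˡ (∈─⁺ i j)
    s≡ : (A , B) ≡ side R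
    s≡ = cong₂ _,_ A≡ (⊆-antisym (λ i → co⁺ λ j → proj₂ (R⁻ j) i) (in-B ∘ co⁻))

  swap-proper3 : ∀ {s} → Proper3 G s → Proper3 G (swap G s)
  swap-proper3 {s} (sep , (a , b) , ord) = swap-separation sep , (b , a) , trans (swap-order s) ord

  oriented : ∀ {s} → Proper3 G s → Oriented s ⊎ Oriented (swap G s)
  oriented {s} p@(sep , _ , ord) = Sum.map (τ⇒Oriented p) (τ⇒Oriented (swap-proper3 {s} p)) (orient sep (≤-reflexive ord))

  side-proper3 : ∀ {R v} → SmallSet R → v ∈ R → Proper3 G (side R)
  side-proper3 {R} {v} s v∈R with System.proper base s
  ... | w , w∈ with far⁻ R w∈
  ... | w∉R , w∉N = side-separation R
    , ((v , ∈─⁺ (∈∪ˡ v∈R) (λ i → co⁻ i v∈R)) , (w , ∈─⁺ (co⁺ w∉R) ([ w∉R , w∉N ]′ ∘ ∈∪⁻ {p = R})))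
    , trans (side-order R) (System.N≡3 base s v∈R)

  private
    ≤ₛ-swap-impossible : ∀ {R R′} → SmallSet R → SmallSet R′ → ¬ (⊤ ∖ R ⊆ R′ ∪ Nb R′)
    ≤ₛ-swap-impossible {R} s s′ h = no-cover₂ s s′
      (λ v → Sum.map₂ h (cover-co ∈∪ˡ v))
      λ u v e → edge-cover R u v e (λ a b → inj₁ (a , b)) λ a b → inj₂ (h (co⁺ a) , h (co⁺ b))

  open Compatibility base

  side-≤ : ∀ {R R′} → SmallSet R → SmallSet R′ →
    _≤ₛ_ G (side R) (side R′) ⊎ _≤ₛ_ G (swap G (side R)) (side R′) → R ⊆ R′
  side-≤ s s′ (inj₁ (_ , h)) {v} v∈ with v ∈? _
  ... | yes i = i
  ... | no i = ⊥-elim (co⁻ (h (co⁺ i)) v∈)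
  side-≤ s s′ (inj₂ (h , _)) = ⊥-elim (≤ₛ-swap-impossible s s′ h)

  Nested⇒Compat : ∀ {R R′} → SmallSet R → SmallSet R′ → Nested G (side R) (side R′) → Compat R R′
  Nested⇒Compat s s′ (inj₁ h) = inside (side-≤ s s′ (inj₁ h))
  Nested⇒Compat {R} {R′} s s′ (inj₂ (inj₁ (h , _))) =
    apart λ u∈ v∈ → (λ { refl → co⁻ (h (∈∪ˡ u∈)) v∈ }) , λ e → co⁻ (h (closed⁺ R u∈ e)) v∈
  Nested⇒Compat s s′ (inj₂ (inj₂ (inj₁ h))) = ⊥-elim (≤ₛ-swap-impossible s s′ (proj₁ h))
  Nested⇒Compat s s′ (inj₂ (inj₂ (inj₂ (h , h′)))) = contains (side-≤ s′ s (inj₁ (h′ , h)))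

  Compat⇒Nested : ∀ {R R′} → Compat R R′ → Nested G (side R) (side R′)
  Compat⇒Nested {R} {R′} (inside h) = inj₁ (sub , λ i → co⁺ (co⁻ i ∘ h))
    where
    sub : R ∪ Nb R ⊆ R′ ∪ Nb R′
    sub i with ∈∪⁻ {p = R} i
    ... | inj₁ v∈R = ∈∪ˡ (h v∈R)
    ... | inj₂ v∈N = let (_ , u , u∈ , e) = Nb⁻ R v∈N in closed⁺ R′ (h u∈) e
  Compat⇒Nested {R} {R′} (contains h) = inj₂ (inj₂ (inj₂ ((λ i → co⁺ (co⁻ i ∘ h)) , sub)))
    where
    sub : R′ ∪ Nb R′ ⊆ R ∪ Nb R
    sub i with ∈∪⁻ {p = R′} i
    ... | inj₁ v∈R = ∈∪ˡ (h v∈R)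
    ... | inj₂ v∈N = let (_ , u , u∈ , e) = Nb⁻ R′ v∈N in closed⁺ R (h u∈) e
  Compat⇒Nested {R} {R′} (apart a) = inj₂ (inj₁ (sub a , sub (Apart-sym a)))
    where
    sub : ∀ {R R′} → Apart R R′ → R ∪ Nb R ⊆ ⊤ ∖ R′
    sub {R} a i with ∈∪⁻ {p = R} i
    ... | inj₁ v∈R = co⁺ λ v∈R′ → proj₁ (a v∈R v∈R′) refl
    ... | inj₂ v∈N = let (_ , u , u∈ , e) = Nb⁻ R v∈N in co⁺ λ v∈R′ → proj₂ (a u∈ v∈R′) e

  Nested-swapˡ : ∀ {s t} → Nested G s t → Nested G (swap G s) t
  Nested-swapˡ (inj₁ h) = inj₂ (inj₂ (inj₁ h))
  Nested-swapˡ (inj₂ (inj₁ h)) = inj₂ (inj₂ (inj₂ h))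
  Nested-swapˡ (inj₂ (inj₂ (inj₁ h))) = inj₁ h
  Nested-swapˡ (inj₂ (inj₂ (inj₂ h))) = inj₂ (inj₁ h)

  Nested-swapʳ : ∀ {s t} → Nested G s t → Nested G s (swap G t)
  Nested-swapʳ (inj₁ h) = inj₂ (inj₁ h)
  Nested-swapʳ (inj₂ (inj₁ h)) = inj₁ h
  Nested-swapʳ (inj₂ (inj₂ (inj₁ h))) = inj₂ (inj₂ (inj₂ h))
  Nested-swapʳ (inj₂ (inj₂ (inj₂ h))) = inj₂ (inj₂ (inj₁ h))

-- Cycles

module _ {E : Fin m → Fin m → Set} (X : Subset m) where

  data Walk : Fin m → List (Fin m) → Fin m → Set where
    stop : ∀ {u} → u ∈ X → Walk u [] u
    go   : ∀ {u w v xs} → u ∈ X → E u w → Walk w xs v → Walk u (w ∷ xs) v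

  Path : Fin m → Fin m → Set
  Path u v = ∃[ xs ] (Walk u xs v × Unique (u ∷ xs))

  suffix : ∀ {u w v xs} → u ∈ₗ w ∷ xs → Walk w xs v → Unique (w ∷ xs) → Path u v
  suffix (here refl) p q = _ , p , q
  suffix (there i) (go _ _ p) (_ ∷ q) = suffix i p q

  Reach⇒Path : ∀ {u v} → Reach E X u v → Path u v
  Reach⇒Path (Reach.here i) = [] , stop i , [] ∷ []
  Reach⇒Path (Reach.step {u} {w} u∈ e r) with Reach⇒Path r
  ... | xs , p , q with Any.any? (u ≟_) (w ∷ xs)
  ... | yes i = suffix i p q
  ... | no i = w ∷ xs , go u∈ e p , ¬Any⇒All¬ _ i ∷ q

  Walk-All : ∀ {u v xs} → Walk u xs v → All (_∈ X) (u ∷ xs)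
  Walk-All (stop i) = i ∷ []
  Walk-All (go i _ p) = i ∷ Walk-All p

  Walk-chain : {F : Fin m → Fin m → Set} → (∀ {a b} → E a b → F a b) →
    ∀ {u v c xs} → Walk u xs v → F v c → AdjChain F (u ∷ xs ++ c ∷ [])
  Walk-chain h (stop _) f = f , _
  Walk-chain h (go _ e p) f = h e , Walk-chain h p f

module _ {E : Fin m → Fin m → Set} (E? : ∀ u v → Dec (E u v)) (E-sym : ∀ {u v} → E u v → E v u)
  (X : Subset m) {u v : Fin m} (u∈X : u ∈ X) (u≢v : u ≢ v) (e : E u v) where
  private
    E⁻ : Fin m → Fin m → Set
    E⁻ a b = E a b × ¬ (a ≡ u × b ≡ v) × ¬ (a ≡ v × b ≡ u)

    E⁻? : ∀ a b → Dec (E⁻ a b)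
    E⁻? a b = E? a b ×-dec ¬? ((a ≟ u) ×-dec (b ≟ v)) ×-dec ¬? ((a ≟ v) ×-dec (b ≟ u))

    close : Path {E = E⁻} X u v → HasCycle E X
    close ([] , stop _ , _) = ⊥-elim (u≢v refl)
    close (_ ∷ [] , go _ (_ , ne , _) (stop _) , _) = ⊥-elim (ne (refl , refl))
    close (x ∷ y ∷ xs , p , q) = u , x ∷ y ∷ xs , s≤s (s≤s z≤n) , q , Walk-All X p , Walk-chain X proj₁ p (E-sym e)

  -- Explore from `u` without the edge `uv`. If `v` is reached, the path has an inner vertex and
  -- closes to a cycle; otherwise `uv` is the only edge of `X` that leaves the explored set.
  cycle-or-bridge : HasCycle E X ⊎
    Σ (Subset m) λ D → u ∈ D × v ∉ D × (∀ {a b} → a ∈ D → b ∈ X → b ∉ D → E a b → a ≡ u × b ≡ v)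
  cycle-or-bridge with closure E⁻? X u∈X
  ... | c with v ∈? Closure.C c
  ... | yes v∈C = inj₁ (close (Reach⇒Path X (Reach-map C⊆X (λ _ _ e → e) (reach v∈C))))
    where open Closure c
  ... | no v∉C = inj₂ (C , u∈C , v∉C , only)
    where
    open Closure c
    only : ∀ {a b} → a ∈ C → b ∈ X → b ∉ C → E a b → a ≡ u × b ≡ v
    only {a} {b} a∈ b∈ b∉ f with (a ≟ u) ×-dec (b ≟ v) | (a ≟ v) ×-dec (b ≟ u)
    ... | yes r | _ = r
    ... | no _ | yes (_ , refl) = ⊥-elim (b∉ u∈C)
    ... | no r | no r′ = ⊥-elim (b∉ (closed a∈ b∈ (f , r , r′)))

-- Claws and cycles in closed neighbourhoods

module ClosedNeighbourhoods (G : Graph) (3-connected : ThreeConnected G) (τ : OSepSet G) (tangle : Tangle G 4 τ) where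
  open TangleSystem G 3-connected τ tangle

  NonClaw : VSet → Set
  NonClaw = System.NonClaw base

  -- Bounds on neighbourhoods replace smallness, so that the result also applies to the far side of
  -- a small set.
  module _ {R : VSet} (Nb≥3 : ∀ {D d} → D ⊆ R → d ∈ D → 3 ≤ ∣ Nb D ∣) (Nb≤3 : ∣ Nb R ∣ ≤ 3) where
    private
      X : VSet
      X = R ∪ Nb R

      Nb-disjoint : ∀ {v} → v ∈ Nb R → v ∈ R → ⊥
      Nb-disjoint i = proj₁ (Nb⁻ R i)

    -- If ab were a bridge of G[X], both sides of R would see at least two vertices of Nb R,
    -- disjointly.
    cycle-from-edge : ∀ {a b} → a ∈ R → b ∈ R → Edge G a b → HasCycle (Edge G) X
    cycle-from-edge {a} {b} a∈R b∈R e
      with cycle-or-bridge Edge? Edge-sym X (∈∪ˡ a∈R) (λ { refl → Edge-irrefl e }) e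
    ... | inj₁ c = c
    ... | inj₂ (D , a∈D , b∉D , only) = ⊥-elim (<⇒≱ 6≤ (≤-trans (≤-reflexive count) (s≤s (s≤s ≤3))))
      where
      D₁ D₂ S₁ S₂ : VSet
      D₁ = D ∩ R
      D₂ = R ∖ D
      S₁ = D ∩ Nb R
      S₂ = Nb R ∖ D
      sub₁ : Nb D₁ ⊆ S₁ ∪ ⁅ b ⁆
      sub₁ {v} i with Nb⁻ D₁ i
      ... | v∉ , u , u∈ , f with ∈∩⁻ {p = D} u∈ | v ∈? D
      ... | u∈D , u∈R | no v∉D with only u∈D (closed⁺ R u∈R f) v∉D f
      ... | _ , refl = ∈∪ʳ {p = S₁} (x∈⁅x⁆ v)
      sub₁ {v} i | v∉ , u , u∈ , f | u∈D , u∈R | yes v∈D =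
        ∈∪ˡ (∈∩⁺ v∈D (Nb⁺ R (λ v∈R → v∉ (∈∩⁺ v∈D v∈R)) u∈R f))
      sub₂ : Nb D₂ ⊆ S₂ ∪ ⁅ a ⁆
      sub₂ {v} i with Nb⁻ D₂ i
      ... | v∉ , u , u∈ , f with ∈∖⁻ {p = R} u∈ | v ∈? D
      ... | u∈R , u∉D | yes v∈D with only v∈D (∈∪ˡ u∈R) u∉D (Edge-sym f)
      ... | refl , _ = ∈∪ʳ {p = S₂} (x∈⁅x⁆ v)
      sub₂ {v} i | v∉ , u , u∈ , f | u∈R , u∉D | no v∉D =
        ∈∪ˡ (∈∖⁺ (Nb⁺ R (λ v∈R → v∉ (∈∖⁺ v∈R v∉D)) u∈R f) v∉D)
      bound : ∀ {D d c} {S : VSet} → D ⊆ R → d ∈ D → Nb D ⊆ S ∪ ⁅ c ⁆ → 3 ≤ ∣ S ∣ + 1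
      bound {c = c} {S} D⊆ d∈ sub = ≤-trans (Nb≥3 D⊆ d∈) (≤-trans (p⊆q⇒∣p∣≤∣q∣ sub)
        (≤-trans (∣p∪q∣≤ S ⁅ c ⁆) (≤-reflexive (cong (∣ S ∣ +_) (∣⁅x⁆∣≡1 c)))))
      6≤ : 6 ≤ (∣ S₁ ∣ + 1) + (∣ S₂ ∣ + 1)
      6≤ = +-mono-≤ (bound (proj₂ ∘ ∈∩⁻ {p = D}) (∈∩⁺ a∈D a∈R) sub₁) (bound (proj₁ ∘ ∈∖⁻ {p = R}) (∈∖⁺ b∈R b∉D) sub₂)
      ≤3 : ∣ S₁ ∣ + ∣ S₂ ∣ ≤ 3
      ≤3 = ≤-trans (≤-reflexive (sym (disjoint-∪ S₁ S₂ λ i j →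
          proj₂ (∈∖⁻ {p = Nb R} j) (proj₁ (∈∩⁻ {p = D} i)))))
        (≤-trans (p⊆q⇒∣p∣≤∣q∣ (λ i → [ proj₂ ∘ ∈∩⁻ {p = D} , proj₁ ∘ ∈∖⁻ {p = Nb R} ]′ (∈∪⁻ {p = S₁} i))) Nb≤3)
      count : (∣ S₁ ∣ + 1) + (∣ S₂ ∣ + 1) ≡ suc (suc (∣ S₁ ∣ + ∣ S₂ ∣))
      count = trans (cong₂ _+_ (+-comm ∣ S₁ ∣ 1) (+-comm ∣ S₂ ∣ 1)) (cong suc (+-suc ∣ S₁ ∣ ∣ S₂ ∣))

    module _ (no-edge : ∀ {a b} → a ∈ R → b ∈ R → ¬ Edge G a b) where

      -- With no edge inside `R`, the neighbours of `r` lie in `Nb R`. There are at least three of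
      -- them and `Nb R` has at most three elements.
      adjacent-to-all : ∀ {r s} → r ∈ R → s ∈ Nb R → Edge G r s
      adjacent-to-all {r} {s} r∈ s∈ with Nb⁻ ⁅ r ⁆ (subst (s ∈_) (sym Nb-r) s∈)
        where
        r⊆R : ⁅ r ⁆ ⊆ R
        r⊆R i = subst (_∈ R) (sym (x∈⁅y⁆⇒x≡y r i)) r∈
        Nb-r⊆ : Nb ⁅ r ⁆ ⊆ Nb R
        Nb-r⊆ i with Nb⁻ ⁅ r ⁆ i
        ... | _ , u , u∈ , e = Nb⁺ R (λ v∈R → no-edge (r⊆R u∈) v∈R e) (r⊆R u∈) e
        Nb-r : Nb ⁅ r ⁆ ≡ Nb R
        Nb-r = squeeze Nb-r⊆ (Nb≥3 r⊆R (x∈⁅x⁆ r)) Nb≤3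
      ... | _ , u , u∈ , e = subst (λ u → Edge G u s) (x∈⁅y⁆⇒x≡y r u∈) e

      square : ∀ {r r′} → r ∈ R → r′ ∈ R → r ≢ r′ → HasCycle (Edge G) X
      square {r} {r′} r∈ r′∈ r≢r′ with pick₂ (Nb R) (≤-trans (s≤s (s≤s z≤n)) (Nb≥3 id r∈))
      ... | s , s′ , s∈ , s′∈ , s≢s′ = r , s ∷ r′ ∷ s′ ∷ [] , s≤s (s≤s z≤n)
        , (ne r∈ s∈ ∷ r≢r′ ∷ ne r∈ s′∈ ∷ []) ∷ ((ne r′∈ s∈ ∘ sym) ∷ s≢s′ ∷ []) ∷ (ne r′∈ s′∈ ∷ []) ∷ [] ∷ []
        , ∈∪ˡ r∈ ∷ ∈∪ʳ {p = R} s∈ ∷ ∈∪ˡ r′∈ ∷ ∈∪ʳ {p = R} s′∈ ∷ []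
        , adjacent-to-all r∈ s∈ , Edge-sym (adjacent-to-all r′∈ s∈) , adjacent-to-all r′∈ s′∈
        , Edge-sym (adjacent-to-all r∈ s′∈) , _
        where
        ne : ∀ {r s} → r ∈ R → s ∈ Nb R → r ≢ s
        ne r∈ s∈ refl = Nb-disjoint s∈ r∈

      triangle : ∀ {r s s′} → r ∈ R → s ∈ Nb R → s′ ∈ Nb R → Edge G s s′ → HasCycle (Edge G) X
      triangle {r} {s} {s′} r∈ s∈ s′∈ e = r , s ∷ s′ ∷ [] , s≤s (s≤s z≤n)
        , ((λ { refl → Nb-disjoint s∈ r∈ }) ∷ (λ { refl → Nb-disjoint s′∈ r∈ }) ∷ [])
          ∷ ((λ { refl → Edge-irrefl e }) ∷ []) ∷ [] ∷ []
        , ∈∪ˡ r∈ ∷ ∈∪ʳ {p = R} s∈ ∷ ∈∪ʳ {p = R} s′∈ ∷ []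
        , adjacent-to-all r∈ s∈ , e , Edge-sym (adjacent-to-all r∈ s′∈) , _

    nonclaw⇒cycle : ∀ {r} → r ∈ R → NonClaw R → HasCycle (Edge G) X
    nonclaw⇒cycle r∈ nc with any? (λ a → any? (λ b → (a ∈? R) ×-dec (b ∈? R) ×-dec Edge? a b))
    ... | yes (a , b , a∈ , b∈ , e) = cycle-from-edge a∈ b∈ e
    nonclaw⇒cycle r∈ (inj₁ (u , v , u∈ , v∈ , u≢v)) | no ¬e = square (λ a∈ b∈ e → ¬e (_ , _ , a∈ , b∈ , e)) u∈ v∈ u≢v
    nonclaw⇒cycle r∈ (inj₂ (s , s′ , s∈ , s′∈ , e)) | no ¬e =
      triangle (λ a∈ b∈ e → ¬e (_ , _ , a∈ , b∈ , e)) r∈ s∈ s′∈ e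

  private
    edge-off : ∀ {R r} → r ∈ R → (∀ {v} → v ∈ R → v ≡ r) → ∀ {u v} → u ∈ R ∪ Nb R → v ∈ R ∪ Nb R →
      r ≢ u → r ≢ v → Edge G u v → NonClaw R
    edge-off {R} {r} r∈ only {u} {v} u∈ v∈ r≢u r≢v e = inj₂ (u , v , ∈N u∈ r≢u , ∈N v∈ r≢v , e)
      where
      ∈N : ∀ {u} → u ∈ R ∪ Nb R → r ≢ u → u ∈ Nb R
      ∈N u∈ r≢u = [ (λ u∈R → ⊥-elim (r≢u (sym (only u∈R)))) , id ]′ (∈∪⁻ {p = R} u∈)

  -- If `R` is only `r`, every cycle still has an edge that avoids `r`, and both ends of that edge
  -- are in `Nb R`.
  cycle⇒nonclaw : ∀ {R r} → r ∈ R → HasCycle (Edge G) (R ∪ Nb R) → NonClaw R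
  cycle⇒nonclaw {R} {r} r∈ c with any? (λ r′ → (r′ ∈? R) ×-dec ¬? (r′ ≟ r))
  ... | yes (r′ , r′∈ , ne) = inj₁ (r′ , r , r′∈ , r∈ , ne)
  ... | no ¬two = by-cycle c
    where
    only : ∀ {v} → v ∈ R → v ≡ r
    only {v} v∈ with v ≟ r
    ... | yes e = e
    ... | no ne = ⊥-elim (¬two (v , v∈ , ne))
    by-cycle : HasCycle (Edge G) (R ∪ Nb R) → NonClaw R
    by-cycle (_ , _ ∷ [] , s≤s () , _)
    by-cycle (x , y ∷ z ∷ zs , _ , ((x≢y ∷ x≢z ∷ x≢zs) ∷ (y≢z ∷ y≢zs) ∷ _) , (x∈ ∷ y∈ ∷ z∈ ∷ zs∈) , xy , yz , chain)
      with r ≟ x | r ≟ y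
    ... | no r≢x | no r≢y = edge-off r∈ only x∈ y∈ r≢x r≢y xy
    ... | yes refl | _ = edge-off r∈ only y∈ z∈ x≢y x≢z yz
    -- The edge taken is the one after `z`; in a triangle it returns to `x`.
    ... | no r≢x | yes refl = after zs zs∈ y≢zs chain
      where
      after : ∀ zs → All (_∈ R ∪ Nb R) zs → All (y ≢_) zs → AdjChain (Edge G) (z ∷ zs ++ x ∷ []) → NonClaw R
      after [] _ _ (zx , _) = edge-off r∈ only z∈ x∈ y≢z r≢x zx
      after (w ∷ _) (w∈ ∷ _) (y≢w ∷ _) (zw , _) = edge-off r∈ only z∈ w∈ y≢z y≢w zw

-- Maximal chops

lookup-∷ʳ : {A : Set} (xs : List A) (x : A) (i : Fin (length (xs ++ x ∷ []))) →
  (∃[ j ] (toℕ j ≡ toℕ i × lookup (xs ++ x ∷ []) i ≡ lookup xs j)) ⊎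
  (toℕ i ≡ length xs × lookup (xs ++ x ∷ []) i ≡ x)
lookup-∷ʳ [] x Fin.zero = inj₂ (refl , refl)
lookup-∷ʳ (y ∷ xs) x Fin.zero = inj₁ (Fin.zero , refl , refl)
lookup-∷ʳ (y ∷ xs) x (Fin.suc i) with lookup-∷ʳ xs x i
... | inj₁ (j , e , e′) = inj₁ (Fin.suc j , cong suc e , e′)
... | inj₂ (e , e′) = inj₂ (cong suc e , e′)

inject-∷ʳ : {A : Set} (xs : List A) (x : A) (j : Fin (length xs)) →
  ∃[ i ] (toℕ {length (xs ++ x ∷ [])} i ≡ toℕ j × lookup (xs ++ x ∷ []) i ≡ lookup xs j)
inject-∷ʳ (y ∷ xs) x Fin.zero = Fin.zero , refl , refl
inject-∷ʳ (y ∷ xs) x (Fin.suc j) with inject-∷ʳ xs x j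
... | i , e , e′ = Fin.suc i , cong suc e , e′

module Chop (G : Graph) (3-connected : ThreeConnected G) (τ : OSepSet G) (tangle : Tangle G 4 τ)
  (N : List (OSep G)) (maximal : MaximalThreeChop G N) where
  open TangleSystem G 3-connected τ tangle
  open ClosedNeighbourhoods G 3-connected τ tangle
  open Compatibility base

  private
    _∈ᴺ_ : OSep G → List (OSep G) → Set
    _∈ᴺ_ = _∈ₛ_ G

  swap-∈ : ∀ {s M} → s ∈ᴺ M → swap G s ∈ᴺ M
  swap-∈ = Any.map λ { (inj₁ e) → inj₂ e ; (inj₂ e) → inj₁ e }

  all-proper3 : ∀ {M s} → All (Proper3 G) M → s ∈ᴺ M → Proper3 G s
  all-proper3 (p ∷ _) (here (inj₁ refl)) = p
  all-proper3 {s = s} (p ∷ _) (here (inj₂ refl)) = swap-proper3 {swap G s} p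
  all-proper3 (_ ∷ ps) (there i) = all-proper3 ps i

  lookup-∈ : ∀ M (i : Fin (length M)) → lookup M i ∈ᴺ M
  lookup-∈ (s ∷ M) Fin.zero = here (inj₁ refl)
  lookup-∈ (s ∷ M) (Fin.suc i) = there (lookup-∈ M i)

  _Bounds_ : VSet → OSep G → Set
  R Bounds s = s ≡ side R ⊎ s ≡ swap G (side R)

  record OpenSide (s : OSep G) : Set where
    field
      R        : VSet
      small    : SmallSet R
      nonempty : ∃[ v ] v ∈ R
      bounds   : R Bounds s

  abstract
    open-side : ∀ {s} → Proper3 G s → OpenSide s
    open-side {s} p with oriented {s} p
    ... | inj₁ o = record { R = R ; small = small ; nonempty = nonempty ; bounds = inj₁ is-side }
      where open Oriented o
    ... | inj₂ o = record { R = R ; small = small ; nonempty = nonempty ; bounds = inj₂ (cong (swap G) is-side) }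
      where open Oriented o

  bounds-separator : ∀ {R s} → R Bounds s → separator G s ≡ Nb R
  bounds-separator {R} (inj₁ refl) = side-separator R
  bounds-separator {R} (inj₂ refl) = trans (⊆-antisym (λ i → let (a , b) = ∈∩⁻ {p = ⊤ ∖ R} i in ∈∩⁺ b a)
    (λ i → let (a , b) = ∈∩⁻ {p = R ∪ Nb R} i in ∈∩⁺ b a)) (side-separator R)

  bounds-nested : ∀ {R R′ s t} → R Bounds s → R′ Bounds t → Compat R R′ → Nested G s t
  bounds-nested (inj₁ refl) (inj₁ refl) c = Compat⇒Nested c
  bounds-nested (inj₁ refl) (inj₂ refl) c = Nested-swapʳ (Compat⇒Nested c)
  bounds-nested (inj₂ refl) (inj₁ refl) c = Nested-swapˡ (Compat⇒Nested c)
  bounds-nested (inj₂ refl) (inj₂ refl) c = Nested-swapˡ (Nested-swapʳ (Compat⇒Nested c))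

  bounds-side : ∀ {R s M} → R Bounds s → s ∈ᴺ M → side R ∈ᴺ M
  bounds-side (inj₁ refl) i = i
  bounds-side (inj₂ refl) i = swap-∈ i

  bounds-clawfree : ∀ {R s} → R Bounds s → ClawFree G s → HasCycle (Edge G) (R ∪ Nb R)
  bounds-clawfree (inj₁ refl) = proj₁
  bounds-clawfree (inj₂ refl) = proj₂

  bounds-swap : ∀ {R s} → R Bounds (swap G s) → R Bounds s
  bounds-swap (inj₁ e) = inj₂ (cong (swap G) e)
  bounds-swap (inj₂ e) = inj₁ (cong (swap G) e)

  τ-bounds : ∀ {R s} → SmallSet R → R Bounds s → τ s → s ≡ side R
  τ-bounds _ (inj₁ e) _ = e
  τ-bounds {R} small (inj₂ refl) t =
    ⊥-elim (proj₁ (proj₂ (proj₂ tangle)) (side R) (side-separation R) (s≤s (τ-order small)) small t)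

  open Σ (proj₁ maximal) renaming (proj₁ to N-proper; proj₂ to nested×freeable)
  open Σ nested×freeable renaming (proj₁ to N-nested; proj₂ to freeable)
  open Σ freeable renaming (proj₁ to L; proj₂ to L-enumerates)
  open Σ L-enumerates renaming (proj₁ to L⊆N; proj₂ to L-enumerates′)
  open Σ L-enumerates′ renaming (proj₁ to N⊆L; proj₂ to L-order)

  ℓ : ℕ
  ℓ = length L

  module _ (i : Fin ℓ) where
    L∈N : lookup L i ∈ᴺ N
    L∈N = L⊆N _ (lookup-∈ L i)

    open OpenSide (open-side {lookup L i} (all-proper3 N-proper L∈N)) public

    R∈N : side R ∈ᴺ N
    R∈N = bounds-side bounds L∈N

  R-compat : ∀ i j → Compat (R i) (R j)
  R-compat i j = Nested⇒Compat (small i) (small j) (N-nested _ _ (R∈N i) (R∈N j))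

  enabled : ∀ i → System.NonClaw base (R i) ⊎ ∃[ j ] (toℕ j < toℕ i × ∃[ u ] ∃[ v ] (u ≢ v ×
      u ∈ Nb (R i) × v ∈ Nb (R i) × u ∈ Nb (R j) × v ∈ Nb (R j)))
  enabled i with L-order i
  ... | inj₁ cf = inj₁ (cycle⇒nonclaw (proj₂ (nonempty i)) (bounds-clawfree (bounds i) cf))
  ... | inj₂ (j , j<i , 2≤) with pick₂ _ 2≤
  ... | u , v , u∈ , v∈ , u≢v with ∈∩⁻ {p = separator G (lookup L j)} u∈ | ∈∩⁻ {p = separator G (lookup L j)} v∈
  ... | u∈j , u∈i | v∈j , v∈i = inj₂ (j , j<i , u , v , u≢v ,
    at i u∈i , at i v∈i , at j u∈j , at j v∈j)
    where
    at : ∀ i {u} → u ∈ separator G (lookup L i) → u ∈ Nb (R i)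
    at i = subst (_ ∈_) (bounds-separator (bounds i))

  index : ∀ {s} → s ∈ᴺ N → ∃[ j ] R j Bounds s
  index {s} i with Any.index (N⊆L s i) | lookup-index (N⊆L s i)
  ... | j | inj₁ e = j , subst (R j Bounds_) e (bounds j)
  ... | j | inj₂ e = j , bounds-swap (subst (R j Bounds_) e (bounds j))

  open Family base R using (module Next; Stage; Hull)

  abstract
    final : Stage ℓ
    final = Next.final small nonempty R-compat enabled

  open Stage final public

  HasCycle-mono : ∀ {X Y : VSet} → X ⊆ Y → HasCycle (Edge G) X → HasCycle (Edge G) Y
  HasCycle-mono X⊆Y (x , xs , l , u , a , c) = x , xs , l , u , All.map X⊆Y a , c

  small-triple : ∀ Y → ∣ Y ∣ ≤ 3 → τ (Y , ⊤)
  small-triple Y ≤3 with orient {Y , ⊤} (∪-covers Y ⊤ (λ _ → inj₂ ∈⊤) , λ u v u∈ _ _ → proj₂ (∈─⁻ {p = Y} u∈) ∈⊤)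
    (≤-trans (p⊆q⇒∣p∣≤∣q∣ (proj₁ ∘ ∈∩⁻ {p = Y})) ≤3)
  ... | inj₁ t = t
  ... | inj₂ t = ⊥-elim (no-cover₂ t t (λ _ → inj₁ ∈⊤) λ _ _ _ → inj₁ (∈⊤ , ∈⊤))

  module _ {X : VSet} {x : V} (X-small : SmallSet X) (x∈X : x ∈ X) where
    private
      C : VSet
      C = far X

      C-Nb≥3 : ∀ {D d} → D ⊆ C → d ∈ D → 3 ≤ ∣ Nb D ∣
      C-Nb≥3 {D} D⊆C d∈D = many-neighbours d∈D (λ x∈D → proj₁ (far⁻ X (D⊆C x∈D)) x∈X) λ x∈N →
        let (_ , u , u∈ , e) = Nb⁻ D x∈N ; (u∉X , u∉N) = far⁻ X (D⊆C u∈) in u∉N (Nb⁺ X u∉X x∈X (Edge-sym e))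

      NC⊆NX : Nb C ⊆ Nb X
      NC⊆NX = System.N-rest base X

      NC≤3 : ∣ Nb C ∣ ≤ 3
      NC≤3 = ≤-trans (p⊆q⇒∣p∣≤∣q∣ NC⊆NX) (System.N≤3 base X-small)

    -- If the far side were a single claw, then N[X] and two sets of at most three vertices would cover G.
    far-nonclaw : NonClaw C
    far-nonclaw with System.proper base X-small
    ... | w , w∈C with any? (λ w′ → (w′ ∈? C) ×-dec ¬? (w′ ≟ w))
    ... | yes (w′ , w′∈ , ne) = inj₁ (w′ , w , w′∈ , w∈C , ne)
    ... | no ¬two with pick (Nb C) (≤-trans (s≤s z≤n) (C-Nb≥3 id w∈C))
    ... | s , s∈ = ⊥-elim (no-cover₃ X-small (small-triple T₁ T₁≤3) (small-triple T₂ T₂≤3) covers edges)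
      where
      only : ∀ {v} → v ∈ C → v ≡ w
      only {v} v∈ with v ≟ w
      ... | yes e = e
      ... | no ne = ⊥-elim (¬two (v , v∈ , ne))
      T₁ T₂ : VSet
      -- The closed star of `w` may have four vertices, one more than `small-triple` allows, so its
      -- edges are divided between two sets that both contain `w`.
      T₁ = ⁅ w ⁆ ∪ (Nb C - s)
      T₂ = ⁅ w ⁆ ∪ ⁅ s ⁆
      T₁≤3 : ∣ T₁ ∣ ≤ 3
      T₁≤3 = ≤-trans (∣p∪q∣≤ ⁅ w ⁆ (Nb C - s)) (≤-trans (≤-reflexive (cong (_+ ∣ Nb C - s ∣) (∣⁅x⁆∣≡1 w)))
        (≤-trans (≤-reflexive (sym (∣─⁅⁆∣ (Nb C) s∈))) NC≤3))
      T₂≤3 : ∣ T₂ ∣ ≤ 3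
      T₂≤3 = ≤-trans (∣p∪q∣≤ ⁅ w ⁆ ⁅ s ⁆) (≤-trans (≤-reflexive (cong₂ _+_ (∣⁅x⁆∣≡1 w) (∣⁅x⁆∣≡1 s))) (n≤1+n 2))
      covers : ∀ v → v ∈ X ∪ Nb X ⊎ v ∈ T₁ ⊎ v ∈ T₂
      covers v with v ∈? X ∪ Nb X
      ... | yes i = inj₁ i
      ... | no i with only (far⁺ X (i ∘ ∈∪ˡ) (i ∘ ∈∪ʳ {p = X}))
      ... | refl = inj₂ (inj₁ (∈∪ˡ (x∈⁅x⁆ v)))
      star : ∀ {v} → Edge G w v → (w ∈ T₁ × v ∈ T₁) ⊎ (w ∈ T₂ × v ∈ T₂)
      star {v} e with v ≟ s
      ... | yes refl = inj₂ (∈∪ˡ (x∈⁅x⁆ w) , ∈∪ʳ {p = ⁅ w ⁆} (x∈⁅x⁆ v))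
      ... | no v≢s = inj₁ (∈∪ˡ (x∈⁅x⁆ w) , ∈∪ʳ {p = ⁅ w ⁆} (x∈p∧x≢y⇒x∈p-y
        (Nb⁺ C (λ v∈C → Edge-irrefl (subst (Edge G w) (only v∈C) e)) w∈C e) v≢s))
      edges : ∀ u v → Edge G u v →
        (u ∈ X ∪ Nb X × v ∈ X ∪ Nb X) ⊎ (u ∈ T₁ × v ∈ T₁) ⊎ (u ∈ T₂ × v ∈ T₂)
      edges u v e with u ∈? X ∪ Nb X | v ∈? X ∪ Nb X
      ... | yes i | yes j = inj₁ (i , j)
      ... | no i | _ with only (far⁺ X (i ∘ ∈∪ˡ) (i ∘ ∈∪ʳ {p = X}))
      ... | refl = inj₂ (star e)
      edges u v e | yes _ | no j with only (far⁺ X (j ∘ ∈∪ˡ) (j ∘ ∈∪ʳ {p = X}))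
      ... | refl = inj₂ (Sum.map (λ (a , b) → b , a) (λ (a , b) → b , a) (star (Edge-sym e)))

    nonclaw⇒clawfree : NonClaw X → ClawFree G (side X)
    nonclaw⇒clawfree nc = nonclaw⇒cycle (System.N≥3 base X-small) (System.N≤3 base X-small) x∈X nc
      , HasCycle-mono sub (nonclaw⇒cycle C-Nb≥3 NC≤3 (proj₂ (System.proper base X-small)) far-nonclaw)
      where
      sub : C ∪ Nb C ⊆ ⊤ ∖ X
      sub i with ∈∪⁻ {p = C} i
      ... | inj₁ j = co⁺ (proj₁ (far⁻ X j))
      ... | inj₂ j = co⁺ (proj₁ (Nb⁻ X (NC⊆NX j)))

  -- `side X` goes to the end of the enumeration, where it may refer to any `R j` while all earlier
  -- conditions stay as they were. The vertex `x`, outside every `R j`, shows that the separation is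
  -- new.
  module Extension {X : VSet} {x : V} (X-small : SmallSet X) (x∈X : x ∈ X) (x∉R : ∀ j → x ∉ R j)
    (X-compat : ∀ j → R j ⊆ X ⊎ Apart (R j) X)
    (X-enabled : NonClaw X ⊎ ∃[ j ] ∃[ u ] ∃[ v ] (u ≢ v × u ∈ Nb X × v ∈ Nb X × u ∈ Nb (R j) × v ∈ Nb (R j))) where

    s : OSep G
    s = side X

    M L′ : List (OSep G)
    M = s ∷ N
    L′ = L ++ s ∷ []

    s∉N : ¬ (s ∈ᴺ N)
    s∉N i with index i
    ... | j , b = x∉R j (same (cong proj₂ (τ-bounds (small j) b X-small)))
      where
      same : ⊤ ∖ X ≡ ⊤ ∖ R j → x ∈ R j
      same e with x ∈? R j
      ... | yes x∈ = x∈
      ... | no x∉ = ⊥-elim (co⁻ (subst (x ∈_) (sym e) (co⁺ x∉)) x∈X)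

    Member : VSet → Set
    Member Y = Y ≡ X ⊎ ∃[ j ] Y ≡ R j

    member : ∀ {t} → t ∈ᴺ M → ∃[ Y ] (Y Bounds t × Member Y)
    member (here (inj₁ e)) = X , inj₁ (sym e) , inj₁ refl
    member (here (inj₂ e)) = X , inj₂ (cong (swap G) (sym e)) , inj₁ refl
    member (there i) with index i
    ... | j , b = R j , b , inj₂ (j , refl)

    member-compat : ∀ {Y Y′} → Member Y → Member Y′ → Compat Y Y′
    member-compat (inj₁ refl) (inj₁ refl) = inside id
    member-compat (inj₂ (i , refl)) (inj₂ (j , refl)) = R-compat i j
    member-compat (inj₁ refl) (inj₂ (j , refl)) with X-compat j
    ... | inj₁ h = contains h
    ... | inj₂ h = apart (Apart-sym h)
    member-compat (inj₂ (j , refl)) (inj₁ refl) with X-compat j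
    ... | inj₁ h = inside h
    ... | inj₂ h = apart h

    M-nested : ∀ t t′ → t ∈ᴺ M → t′ ∈ᴺ M → Nested G t t′
    M-nested t t′ i i′ with member i | member i′
    ... | Y , b , h | Y′ , b′ , h′ = bounds-nested b b′ (member-compat h h′)

    L′⊆M : _⊆ₛ_ G L′ M
    L′⊆M t i with ++⁻ L i
    ... | inj₁ j = there (L⊆N t j)
    ... | inj₂ (here e) = here e

    M⊆L′ : _⊆ₛ_ G M L′
    M⊆L′ t (here e) = ++⁺ʳ L (here e)
    M⊆L′ t (there i) = ++⁺ˡ (N⊆L t i)

    Enabled : (K : List (OSep G)) → Fin (length K) → Set
    Enabled K i = ClawFree G (lookup K i) ⊎
      (Σ (Fin (length K)) λ j → toℕ j < toℕ i × 2 ≤ ∣ separator G (lookup K j) ∩ separator G (lookup K i) ∣)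

    earlier : ∀ i (j : Fin ℓ) → toℕ j < toℕ i → 2 ≤ ∣ separator G (lookup L j) ∩ separator G (lookup L′ i) ∣ → Enabled L′ i
    earlier i j j<i 2≤ with inject-∷ʳ L s j
    ... | j′ , e , e′ = inj₂ (j′ , subst (_< toℕ i) (sym e) j<i
      , subst (λ t → 2 ≤ ∣ separator G t ∩ separator G (lookup L′ i) ∣) (sym e′) 2≤)

    L′-order : ∀ i → Enabled L′ i
    L′-order i with lookup-∷ʳ L s i
    ... | inj₁ (i′ , e , e′) = old (L-order i′)
      where
      old : Enabled L i′ → Enabled L′ i
      old (inj₁ c) = inj₁ (subst (ClawFree G) (sym e′) c)
      old (inj₂ (j , j<i , 2≤)) = earlier i j (subst (toℕ j <_) e j<i)
        (subst (λ t → 2 ≤ ∣ separator G (lookup L j) ∩ separator G t ∣) (sym e′) 2≤)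
    ... | inj₂ (e , e′) = new X-enabled
      where
      new : NonClaw X ⊎ ∃[ j ] ∃[ u ] ∃[ v ] (u ≢ v × u ∈ Nb X × v ∈ Nb X × u ∈ Nb (R j) × v ∈ Nb (R j)) → Enabled L′ i
      new (inj₁ nc) = inj₁ (subst (ClawFree G) (sym e′) (nonclaw⇒clawfree X-small x∈X nc))
      new (inj₂ (j , u , v , u≢v , u∈ , v∈ , u∈′ , v∈′)) = earlier i j (subst (toℕ j <_) (sym e) (toℕ<n j))
        (≢⇒2≤ _ (both u∈ u∈′) (both v∈ v∈′) u≢v)
        where
        both : ∀ {u} → u ∈ Nb X → u ∈ Nb (R j) → u ∈ separator G (lookup L j) ∩ separator G (lookup L′ i)
        both a b = ∈∩⁺ (subst (_ ∈_) (sym (bounds-separator (bounds j))) b)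
          (subst (λ t → _ ∈ separator G t) (sym e′) (subst (_ ∈_) (sym (side-separator X)) a))

    contradiction : ⊥
    contradiction = s∉N (proj₂ maximal M
      (side-proper3 X-small x∈X ∷ N-proper , M-nested , L′ , L′⊆M , M⊆L′ , L′-order)
      (λ _ → there) s (here (inj₁ refl)))

  -- The hull of a reducible set would extend the chop. Two vertices of the set, or an edge of `G`
  -- among its neighbours, make the new separation claw-free; an edge added by a contraction gives
  -- two vertices shared with the separator of some `R j`.
  normal : Normal H
  normal Q (reducible Q-small (v , v∈Q) nc) = Extension.contradiction h.small (h.mem⁺ v∈Q)
    (λ j → proj₂ (P⁻ (System.small⊆P H Q-small v∈Q)) j (toℕ<n j)) (λ j → h.compat j (toℕ<n j)) (enabled′ nc)
    where
    module h = Hull (hull Q-small v∈Q)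
    enabled′ : System.NonClaw H Q → NonClaw h.hull ⊎
      ∃[ j ] ∃[ u ] ∃[ v ] (u ≢ v × u ∈ Nb h.hull × v ∈ Nb h.hull × u ∈ Nb (R j) × v ∈ Nb (R j))
    enabled′ (inj₁ (a , b , a∈ , b∈ , a≢b)) = inj₁ (inj₁ (a , b , h.mem⁺ a∈ , h.mem⁺ b∈ , a≢b))
    enabled′ (inj₂ (a , b , a∈ , b∈ , e)) with subst (a ∈_) (sym h.N≡) a∈ | subst (b ∈_) (sym h.N≡) b∈ | E⁻ e
    ... | a∈′ | b∈′ | inj₁ f = inj₁ (inj₂ (a , b , a∈′ , b∈′ , f))
    ... | a∈′ | b∈′ | inj₂ (j , _ , c , d) =
      inj₂ (j , a , b , (λ { refl → System.E-irrefl H e }) , a∈′ , b∈′ , c , d)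

-- Torsos

module Torso (G : Graph) (3-connected : ThreeConnected G) (τ : OSepSet G) (tangle : Tangle G 4 τ)
  (N : List (OSep G)) (maximal : MaximalThreeChop G N)
  (σ : List (OSep G)) (splitting : SplittingStar G N σ) (σ⊆τ : All τ σ) where
  open TangleSystem G 3-connected τ tangle
  open Chop G 3-connected τ tangle N maximal

  private
    star : Star G σ
    star = proj₁ splitting
    P₀ : VSet
    P₀ = P H

  P⁻′ : ∀ {v} j → v ∈ P₀ → v ∉ R j
  P⁻′ j v∈P = proj₂ (P⁻ v∈P) j (toℕ<n j)

  σ-index : ∀ {s} → s ∈ₗ σ → ∃[ j ] s ≡ side (R j)
  σ-index {s} s∈ with index (proj₁ (proj₂ splitting) s s∈)
  ... | j , b = j , τ-bounds (small j) b (All.lookup σ⊆τ s∈)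

  above : ∀ i → ∃[ j ] (R i ⊆ R j × side (R j) ∈ₗ σ)
  above i with proj₂ (proj₂ splitting) (side (R i)) (R∈N i)
  ... | s , s∈ , h with σ-index s∈
  ... | j , refl = j , (λ {x} → side-≤ (small i) (small j) h {x}) , s∈

  ∈bag⁻ : ∀ {ρ s v} → v ∈ bag G ρ → s ∈ₗ ρ → v ∈ proj₂ s
  ∈bag⁻ {t ∷ ρ} v∈ (here refl) = proj₁ (∈∩⁻ {p = proj₂ t} v∈)
  ∈bag⁻ {t ∷ ρ} v∈ (there i) = ∈bag⁻ {ρ} (proj₂ (∈∩⁻ {p = proj₂ t} v∈)) i

  ∈bag⁺ : ∀ ρ {v} → (∀ {s} → s ∈ₗ ρ → v ∈ proj₂ s) → v ∈ bag G ρ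
  ∈bag⁺ [] h = ∈⊤
  ∈bag⁺ (s ∷ ρ) h = ∈∩⁺ (h (here refl)) (∈bag⁺ ρ (h ∘ there))

  P≡bag : P₀ ≡ bag G σ
  P≡bag = ⊆-antisym to from
    where
    to : P₀ ⊆ bag G σ
    to v∈P = ∈bag⁺ σ λ s∈ → let (j , e) = σ-index s∈ in subst (λ s → _ ∈ proj₂ s) (sym e) (co⁺ (P⁻′ j v∈P))
    from : bag G σ ⊆ P₀
    from v∈ = P⁺ ∈⊤ λ i _ v∈R → let (j , h , s∈) = above i in co⁻ (∈bag⁻ {σ} v∈ s∈) (h v∈R)

  E⇒Torso : ∀ {u v} → u ∈ P₀ → v ∈ P₀ → E H u v → TorsoEdge G σ u v
  E⇒Torso u∈ v∈ e with E⁻ e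
  ... | inj₁ f = inj₁ f
  ... | inj₂ (i , _ , a , b) with above i
  ... | j , h , s∈ = inj₂ ((λ { refl → System.E-irrefl H e }) , side (R j) , s∈ , at u∈ a , at v∈ b)
    where
    at : ∀ {w} → w ∈ P₀ → w ∈ Nb (R i) → w ∈ separator G (side (R j))
    at {w} w∈P w∈N = let (_ , x , x∈ , f) = Nb⁻ (R i) w∈N in
      subst (w ∈_) (sym (side-separator (R j))) (Nb⁺ (R j) (P⁻′ j w∈P) (h x∈) f)

  Torso⇒E : ∀ {u v} → u ∈ P₀ → v ∈ P₀ → TorsoEdge G σ u v → E H u v
  Torso⇒E u∈ v∈ (inj₁ e) = E-old e
  Torso⇒E u∈ v∈ (inj₂ (u≢v , s , s∈ , a , b)) with σ-index s∈
  ... | j , refl = E-clique j (toℕ<n j) u≢v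
    (subst (_ ∈_) (side-separator (R j)) a) (subst (_ ∈_) (side-separator (R j)) b) u∈ v∈

  -- Take an element of the star above a set containing `v`. The star condition keeps its closed
  -- neighbourhood off the small sides of the other elements, so its neighbours remain in the bag.
  star-cover : ∀ {v} → v ∉ P₀ → ∃[ j ] (v ∈ R j × Nb (R j) ⊆ P₀)
  star-cover {v} v∉P with any? (λ i → v ∈? R i)
  ... | no ¬i = ⊥-elim (v∉P (P⁺ ∈⊤ λ i _ v∈ → ¬i (i , v∈)))
  ... | yes (i , v∈R) with above i
  ... | j , h , s∈ = j , h v∈R , λ {x} x∈N → P⁺ ∈⊤ λ i′ _ x∈R → uncovered x∈N (above i′) x∈R
    where
    uncovered : ∀ {x i′} → x ∈ Nb (R j) → ∃[ j′ ] (R i′ ⊆ R j′ × side (R j′) ∈ₗ σ) → x ∉ R i′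
    uncovered {x} x∈N (j′ , h′ , s∈′) x∈R = co⁻ (proj₁ (star (side (R j)) (side (R j′)) s∈ s∈′ distinct) (∈∪ʳ {p = R j} x∈N)) (h′ x∈R)
      where
      distinct : side (R j) ≢ side (R j′)
      distinct e = co⁻ (subst (λ s → x ∈ proj₂ s) e (co⁺ (proj₁ (Nb⁻ (R j) x∈N)))) (h′ x∈R)

  -- The tangle axiom forbids covers by three small sides only. Therefore all `R j` whose neighbours
  -- lie in `Y` are merged, one index at a time, into a single separation of the tangle with
  -- separator inside `Y`.
  module Attached (Y : VSet) (Y≤3 : ∣ Y ∣ ≤ 3) where

    In : ℕ → V → Set
    In k v = ∃[ j ] (toℕ j < k × Nb (R j) ⊆ Y × v ∈ R j)

    W : ℕ → VSet
    W k = ⟪ (λ v → any? λ j → (suc (toℕ j) ≤? k) ×-dec (Nb (R j) ⊆? Y) ×-dec (v ∈? R j)) ⟫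

    W⁺ : ∀ {k v} → In k v → v ∈ W k
    W⁺ {k} = ∈⟪⟫⁺ (λ v → any? λ j → (suc (toℕ j) ≤? k) ×-dec (Nb (R j) ⊆? Y) ×-dec (v ∈? R j))

    W⁻ : ∀ {k v} → v ∈ W k → In k v
    W⁻ {k} = ∈⟪⟫⁻ (λ v → any? λ j → (suc (toℕ j) ≤? k) ×-dec (Nb (R j) ⊆? Y) ×-dec (v ∈? R j))

    sep : ℕ → OSep G
    sep k = W k ∪ Y , ⊤ ∖ W k

    leaves : ∀ {k u v} → u ∈ W k → v ∉ W k → Edge G u v → v ∈ Y
    leaves u∈ v∉ e with W⁻ u∈
    ... | j , j<k , N⊆Y , u∈R = N⊆Y (Nb⁺ (R j) (λ v∈R → v∉ (W⁺ (j , j<k , (λ {x} → N⊆Y {x}) , v∈R))) u∈R e)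

    sep-separation : ∀ k → IsSeparation G (sep k)
    sep-separation k = ∪-covers (W k ∪ Y) (⊤ ∖ W k) (cover-co ∈∪ˡ) , no-edge
      where
      no-edge : ∀ u v → u ∈ (W k ∪ Y) ─ (⊤ ∖ W k) → v ∈ (⊤ ∖ W k) ─ (W k ∪ Y) → ¬ Edge G u v
      no-edge u v u∈ v∈ e with u ∈? W k
      ... | yes u∈W = proj₂ (∈─⁻ {p = ⊤ ∖ W k} v∈) (∈∪ʳ {p = W k} (leaves u∈W (co⁻ (proj₁ (∈─⁻ {p = ⊤ ∖ W k} v∈))) e))
      ... | no u∉W = proj₂ (∈─⁻ {p = W k ∪ Y} u∈) (co⁺ u∉W)

    sep-order : ∀ k → order G (sep k) ≤ 3
    sep-order k = ≤-trans (p⊆q⇒∣p∣≤∣q∣ sub) Y≤3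
      where
      sub : (W k ∪ Y) ∩ (⊤ ∖ W k) ⊆ Y
      sub i with ∈∩⁻ {p = W k ∪ Y} i
      ... | a , b = [ (λ c → ⊥-elim (co⁻ b c)) , id ]′ (∈∪⁻ {p = W k} a)

    edge-in : ∀ {k u v} → Edge G u v → u ∈ W k → u ∈ W k ∪ Y × v ∈ W k ∪ Y
    edge-in {k} {u} {v} e u∈ with v ∈? W k
    ... | yes v∈ = ∈∪ˡ u∈ , ∈∪ˡ v∈
    ... | no v∉ = ∈∪ˡ u∈ , ∈∪ʳ {p = W k} (leaves u∈ v∉ e)

    sep-τ : ∀ k → τ (sep k)
    sep-τ k with orient (sep-separation k) (sep-order k)
    ... | inj₁ t = t
    -- `W 0` is empty, so the opposite orientation would have all of `G` as its small side.
    sep-τ zero | inj₂ t = ⊥-elim (no-cover₂ t t (λ v → inj₁ (all v)) λ u v _ → inj₁ (all u , all v))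
      where
      all : ∀ v → v ∈ ⊤ ∖ W 0
      all v = co⁺ λ v∈ → none (W⁻ v∈)
        where
        none : ∀ {v} → ¬ In 0 v
        none (_ , () , _)
    sep-τ (suc k) | inj₂ t with suc k ≤? ℓ
    ... | no k≮ℓ = ⊥-elim (no-cover₂ (sep-τ k) t (λ v → Sum.map₂ (λ i → co⁺ (co⁻ i ∘ old)) (cover-co ∈∪ˡ v)) edges)
      where
      old : ∀ {v} → v ∈ W (suc k) → v ∈ W k
      old v∈ with W⁻ v∈
      ... | j , j<1+k , r with m<1+n⇒m<n∨m≡n j<1+k
      ... | inj₁ j<k = W⁺ (j , j<k , r)
      ... | inj₂ refl = ⊥-elim (k≮ℓ (toℕ<n j))
      edges : ∀ u v → Edge G u v → (u ∈ W k ∪ Y × v ∈ W k ∪ Y) ⊎ (u ∈ ⊤ ∖ W (suc k) × v ∈ ⊤ ∖ W (suc k))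
      edges u v e with u ∈? W k | v ∈? W k
      ... | yes u∈ | _ = inj₁ (edge-in e u∈)
      ... | no _ | yes v∈ = let (a , b) = edge-in (Edge-sym e) v∈ in inj₁ (b , a)
      ... | no u∉ | no v∉ = inj₂ (co⁺ (u∉ ∘ old) , co⁺ (v∉ ∘ old))
    -- If the new separation had the opposite orientation, its complement, the closed neighbourhood
    -- of `R i` and the previous merged side would be three small sides covering `G`.
    ... | yes k<ℓ = ⊥-elim (no-cover₃ (sep-τ k) (small i) t cover edges)
      where
      i : Fin ℓ
      i = fromℕ< k<ℓ
      old : ∀ {v} → v ∈ W (suc k) → v ∈ W k ⊎ v ∈ R i
      old {v} v∈ with W⁻ v∈
      ... | j , j<1+k , r with m<1+n⇒m<n∨m≡n j<1+k
      ... | inj₁ j<k = inj₁ (W⁺ (j , j<k , r))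
      ... | inj₂ j≡k = inj₂ (subst (λ j → v ∈ R j) (toℕ-injective (trans j≡k (sym (toℕ-fromℕ< k<ℓ)))) (proj₂ r))
      cover : ∀ v → v ∈ W k ∪ Y ⊎ v ∈ R i ∪ Nb (R i) ⊎ v ∈ ⊤ ∖ W (suc k)
      cover v with v ∈? W (suc k)
      ... | no v∉ = inj₂ (inj₂ (co⁺ v∉))
      ... | yes v∈ = Sum.map ∈∪ˡ (inj₁ ∘ ∈∪ˡ) (old v∈)
      edges : ∀ u v → Edge G u v → (u ∈ W k ∪ Y × v ∈ W k ∪ Y) ⊎
        (u ∈ R i ∪ Nb (R i) × v ∈ R i ∪ Nb (R i)) ⊎ (u ∈ ⊤ ∖ W (suc k) × v ∈ ⊤ ∖ W (suc k))
      edges u v e with u ∈? W k | v ∈? W k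
      ... | yes u∈ | _ = inj₁ (edge-in e u∈)
      ... | no _ | yes v∈ = let (a , b) = edge-in (Edge-sym e) v∈ in inj₁ (b , a)
      ... | no u∉ | no v∉ = edge-cover (R i) u v e (λ a b → inj₂ (inj₁ (a , b)))
        λ a b → inj₂ (inj₂ (co⁺ ([ u∉ , a ]′ ∘ old) , co⁺ ([ v∉ , b ]′ ∘ old)))

    A : VSet
    A = W ℓ ∪ Y

    A-Y : ∀ {v} → v ∈ Y → v ∈ A
    A-Y = ∈∪ʳ {p = W ℓ}

    A-R : ∀ {j v} → Nb (R j) ⊆ Y → v ∈ R j ∪ Nb (R j) → v ∈ A
    A-R {j} N⊆Y v∈ = [ (λ v∈R → ∈∪ˡ (W⁺ (j , toℕ<n j , (λ {x} → N⊆Y {x}) , v∈R))) , A-Y ∘ N⊆Y ]′ (∈∪⁻ {p = R j} v∈)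

    A-τ : τ (A , ⊤ ∖ W ℓ)
    A-τ = sep-τ ℓ

  -- A bag of at most three vertices could itself be taken as `Y`, and by `star-cover` the one
  -- merged side would be all of `G`.
  4≤∣P∣ : 4 ≤ ∣ P₀ ∣
  4≤∣P∣ with 4 ≤? ∣ P₀ ∣
  ... | yes h = h
  ... | no h = ⊥-elim (no-cover₂ A-τ A-τ (λ v → inj₁ (all v)) λ u v _ → inj₁ (all u , all v))
    where
    open Attached P₀ (≤-pred (≰⇒> h))
    all : ∀ v → v ∈ A
    all v with v ∈? P₀
    ... | yes v∈P = A-Y v∈P
    ... | no v∉P with star-cover v∉P
    ... | j , v∈R , N⊆P = A-R (λ {x} → N⊆P {x}) (∈∪ˡ v∈R)

  module Four (∣P∣≡4 : ∣ P₀ ∣ ≡ 4) where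

    Avoiding : V → Set
    Avoiding q = ∃[ j ] (Nb (R j) ⊆ P₀ × q ∉ Nb (R j))

    Avoiding? : ∀ q → Dec (Avoiding q)
    Avoiding? q = any? λ j → (Nb (R j) ⊆? P₀) ×-dec ¬? (q ∈? Nb (R j))

    P-q≡3 : ∀ {q} → q ∈ P₀ → ∣ P₀ - q ∣ ≡ 3
    P-q≡3 q∈ = suc-injective (trans (sym (∣─⁅⁆∣ P₀ q∈)) ∣P∣≡4)

    ∣P-three∣≡1 : ∀ {p q₁ q₂} → p ∈ P₀ → q₁ ∈ P₀ - p → q₂ ∈ P₀ - p → q₁ ≢ q₂ → ∣ P₀ - p - q₁ - q₂ ∣ ≡ 1
    ∣P-three∣≡1 p∈ q₁∈ q₂∈ q₁≢q₂ = suc-injective (trans (sym (∣─⁅⁆∣ _ (x∈p∧x≢y⇒x∈p-y q₂∈ (q₁≢q₂ ∘ sym))))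
      (suc-injective (trans (sym (∣─⁅⁆∣ _ q₁∈)) (P-q≡3 p∈))))

    Nb⊆P-q : ∀ {j q} → Nb (R j) ⊆ P₀ → q ∉ Nb (R j) → Nb (R j) ⊆ P₀ - q
    Nb⊆P-q N⊆P q∉ i = x∈p∧x≢y⇒x∈p-y (N⊆P i) λ { refl → q∉ i }

    -- Otherwise each relevant `R j` has `p` among its neighbours and so is attached to a triple of
    -- `P₀` that contains `p`. These three triples cover every pair in `P₀`, so the three merged
    -- sides would cover `G`.
    all-avoided : ∀ {p} → p ∈ P₀ → Avoiding p
    all-avoided {p} p∈P with Avoiding? p
    ... | yes h = h
    ... | no ¬p with pick₂ (P₀ - p) (≤-trans (n≤1+n 2) (≤-reflexive (sym (P-q≡3 p∈P))))
    ... | q₁ , q₂ , q₁∈ , q₂∈ , q₁≢q₂ with pick (P₀ - p - q₁ - q₂) (≤-reflexive (sym (∣P-three∣≡1 p∈P q₁∈ q₂∈ q₁≢q₂)))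
    ... | q₃ , q₃∈ = ⊥-elim (no-cover₃ (Q.A-τ q₁∈) (Q.A-τ q₂∈) (Q.A-τ q₃∈′) cover edges)
      where
      q₃∈′ : q₃ ∈ P₀ - p
      q₃∈′ = proj₁ (∈-⁻ {p = P₀ - p} (proj₁ (∈-⁻ {p = P₀ - p - q₁} q₃∈)))
      module Q {q} (q∈ : q ∈ P₀ - p) =
        Attached (P₀ - q) (≤-reflexive (P-q≡3 (proj₁ (∈-⁻ {p = P₀} q∈))))
      which : ∀ {q} → q ∈ P₀ - p → q ≡ q₁ ⊎ q ≡ q₂ ⊎ q ≡ q₃
      which {q} q∈ with q ≟ q₁ | q ≟ q₂
      ... | yes e | _ = inj₁ e
      ... | no _ | yes e = inj₂ (inj₁ e)
      ... | no a | no b = inj₂ (inj₂ (∣p∣≤1⇒≡ (P₀ - p - q₁ - q₂) (≤-reflexive (∣P-three∣≡1 p∈P q₁∈ q₂∈ q₁≢q₂))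
          (x∈p∧x≢y⇒x∈p-y (x∈p∧x≢y⇒x∈p-y q∈ a) b) q₃∈))
      spread : {B : VSet → Set} → ∀ {q} (q∈ : q ∈ P₀ - p) → B (Q.A q∈) →
        B (Q.A q₁∈) ⊎ B (Q.A q₂∈) ⊎ B (Q.A q₃∈′)
      spread {B} q∈ b with which q∈
      ... | inj₁ refl = inj₁ b
      ... | inj₂ (inj₁ refl) = inj₂ (inj₁ b)
      ... | inj₂ (inj₂ refl) = inj₂ (inj₂ b)
      off : ∀ u v → ∃[ q ] (q ∈ P₀ - p × u ≢ q × v ≢ q)
      off u v with pick-outside (P₀ - p) (⁅ u ⁆ ∪ ⁅ v ⁆) (≤-trans (s≤s (≤-trans (∣p∪q∣≤ ⁅ u ⁆ ⁅ v ⁆)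
        (≤-reflexive (cong₂ _+_ (∣⁅x⁆∣≡1 u) (∣⁅x⁆∣≡1 v))))) (≤-reflexive (sym (P-q≡3 p∈P))))
      ... | q , q∈ , q∉ = q , q∈ , (λ { refl → q∉ (∈∪ˡ (x∈⁅x⁆ u)) }) , λ { refl → q∉ (∈∪ʳ {p = ⁅ u ⁆} (x∈⁅x⁆ v)) }
      place : ∀ {j} → Nb (R j) ⊆ P₀ → ∃[ q ] (q ∈ P₀ - p × Nb (R j) ⊆ P₀ - q)
      place {j} N⊆P with pick-outside P₀ (Nb (R j)) (≤-trans (s≤s (System.N≤3 base (small j))) (≤-reflexive (sym ∣P∣≡4)))
      ... | q , q∈ , q∉ = q , x∈p∧x≢y⇒x∈p-y q∈ (λ { refl → ¬p (j , (λ {x} → N⊆P {x}) , q∉) })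
        , Nb⊆P-q (λ {x} → N⊆P {x}) q∉
      cover : ∀ v → v ∈ Q.A q₁∈ ⊎ v ∈ Q.A q₂∈ ⊎ v ∈ Q.A q₃∈′
      cover v with v ∈? P₀
      ... | yes v∈P with off v v
      ... | q , q∈ , v≢q , _ = spread {v ∈_} q∈ (Q.A-Y q∈ (x∈p∧x≢y⇒x∈p-y v∈P v≢q))
      cover v | no v∉P with star-cover v∉P
      ... | j , v∈R , N⊆P with place (λ {x} → N⊆P {x})
      ... | q , q∈ , N⊆ = spread {v ∈_} q∈ (Q.A-R q∈ (λ {x} → N⊆ {x}) (∈∪ˡ v∈R))
      edges : ∀ u v → Edge G u v → (u ∈ Q.A q₁∈ × v ∈ Q.A q₁∈) ⊎ (u ∈ Q.A q₂∈ × v ∈ Q.A q₂∈) ⊎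
        (u ∈ Q.A q₃∈′ × v ∈ Q.A q₃∈′)
      edges u v e with u ∈? P₀ | v ∈? P₀
      ... | yes u∈P | yes v∈P with off u v
      ... | q , q∈ , u≢q , v≢q = spread {λ A → u ∈ A × v ∈ A} q∈
        (Q.A-Y q∈ (x∈p∧x≢y⇒x∈p-y u∈P u≢q) , Q.A-Y q∈ (x∈p∧x≢y⇒x∈p-y v∈P v≢q))
      edges u v e | no u∉P | _ with star-cover u∉P
      ... | j , u∈R , N⊆P with place (λ {x} → N⊆P {x})
      ... | q , q∈ , N⊆ = spread {λ A → u ∈ A × v ∈ A} q∈
        (Q.A-R q∈ (λ {x} → N⊆ {x}) (∈∪ˡ u∈R) , Q.A-R q∈ (λ {x} → N⊆ {x}) (closed⁺ (R j) u∈R e))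
      edges u v e | yes _ | no v∉P with star-cover v∉P
      ... | j , v∈R , N⊆P with place (λ {x} → N⊆P {x})
      ... | q , q∈ , N⊆ = spread {λ A → u ∈ A × v ∈ A} q∈
        (Q.A-R q∈ (λ {x} → N⊆ {x}) (closed⁺ (R j) v∈R (Edge-sym e)) , Q.A-R q∈ (λ {x} → N⊆ {x}) (∈∪ˡ v∈R))

    module _ {C : VSet} (C-comp : IsComponent (Edge G) (⊤ ─ P₀) C) where
      private
        C⊆ : C ⊆ ⊤ ─ P₀
        C⊆ = proj₁ (proj₂ C-comp)
        C-closed : ∀ u w → u ∈ C → w ∈ ⊤ ─ P₀ → Edge G u w → w ∈ C
        C-closed = proj₂ (proj₂ (proj₂ C-comp))

      component-within : ∀ {j c} → Nb (R j) ⊆ P₀ → c ∈ C → c ∈ R j → C ⊆ R j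
      component-within {j} {c} N⊆P c∈C c∈R {x} x∈C =
        Reach-closed closed c∈R (proj₁ (proj₂ (proj₂ C-comp)) c x c∈C x∈C)
        where
        closed : ∀ {a b} → a ∈ R j → b ∈ C → Edge G a b → b ∈ R j
        closed {b = b} a∈ b∈ e with b ∈? R j
        ... | yes i = i
        ... | no i = ⊥-elim (proj₂ (∈─⁻ {p = ⊤} (C⊆ b∈)) (N⊆P (Nb⁺ (R j) i a∈ e)))

      component-Nb⊆P : Nb C ⊆ P₀
      component-Nb⊆P {v} v∈ with Nb⁻ C v∈ | v ∈? P₀
      ... | _ | yes i = i
      ... | v∉C , u , u∈ , e | no i = ⊥-elim (v∉C (C-closed u v u∈ (∈─⁺ ∈⊤ i) e))

      component-Nb : ∀ {j c} → Nb (R j) ⊆ P₀ → c ∈ C → c ∈ R j → Nb C ≡ Nb (R j)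
      component-Nb {j} {c} N⊆P c∈C c∈R = squeeze sub (System.N≥3 base (small j) C⊆R c∈C) (System.N≤3 base (small j))
        where
        C⊆R : C ⊆ R j
        C⊆R = component-within {j} (λ {x} → N⊆P {x}) c∈C c∈R
        sub : Nb C ⊆ Nb (R j)
        sub {v} v∈ with Nb⁻ C v∈
        ... | _ , u , u∈ , e = Nb⁺ (R j) (P⁻′ j (component-Nb⊆P v∈)) (C⊆R u∈) e

    NbhdIs⇒≡ : ∀ {C Y} → NbhdIs G C Y → Y ≡ Nb C
    NbhdIs⇒≡ {C} h = ⊆-antisym (λ {v} v∈ → let (a , u , u∈ , e) = proj₁ (h v) v∈ in Nb⁺ C a u∈ e)
      λ {v} v∈ → let (a , r) = Nb⁻ C v∈ in proj₂ (h v) a r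

    Nb-NbhdIs : ∀ C → NbhdIs G C (Nb C)
    Nb-NbhdIs C v = Nb⁻ C , λ a (u , u∈ , e) → Nb⁺ C a u∈ e

    components-cubic : ∀ C Y → IsComponent (Edge G) (⊤ ─ P₀) C → NbhdIs G C Y → Y ⊆ P₀ × ∣ Y ∣ ≡ 3
    components-cubic C Y comp@((c , c∈) , C⊆ , _) h with NbhdIs⇒≡ h | star-cover (proj₂ (∈─⁻ {p = ⊤} (C⊆ c∈)))
    ... | refl | j , c∈R , N⊆P = component-Nb⊆P comp
      , trans (cong ∣_∣ (component-Nb comp (λ {x} → N⊆P {x}) c∈ c∈R)) (System.N≡3 base (small j) c∈R)

    -- `Y` omits one vertex `q`, and a set `R j` avoiding `q` has neighbourhood exactly `Y`. Any
    -- component inside `R j` has the same neighbourhood, since it needs three neighbours as well.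
    triples-cubic : ∀ Y → Y ⊆ P₀ → ∣ Y ∣ ≡ 3 → Σ VSet λ C → IsComponent (Edge G) (⊤ ─ P₀) C × NbhdIs G C Y
    triples-cubic Y Y⊆P ∣Y∣≡3
      with pick-outside P₀ Y (≤-trans (s≤s (≤-reflexive ∣Y∣≡3)) (≤-reflexive (sym ∣P∣≡4)))
    ... | q , q∈ , q∉Y with all-avoided q∈
    ... | j , N⊆P , q∉N with nonempty j
    ... | r , r∈R with closure Edge? (⊤ ─ P₀) (∈─⁺ ∈⊤ (λ r∈P → P⁻′ j r∈P r∈R))
    ... | c = C , comp , subst (NbhdIs G C) (trans (component-Nb comp (λ {x} → N⊆P {x}) u∈C r∈R) Nb≡Y) (Nb-NbhdIs C)
      where
      open Closure c
      comp : IsComponent (Edge G) (⊤ ─ P₀) C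
      comp = (r , u∈C) , C⊆X , (λ u v u∈ v∈ → Reach-trans (Reach-sym Edge-sym (reach u∈)) (reach v∈)) , λ u w → closed
      Nb≡Y : Nb (R j) ≡ Y
      Nb≡Y = trans (squeeze (Nb⊆P-q {j} (λ {x} → N⊆P {x}) q∉N) (System.N≥3 base (small j) id r∈R) (≤-reflexive (P-q≡3 q∈)))
        (sym (squeeze (λ i → x∈p∧x≢y⇒x∈p-y (Y⊆P i) λ { refl → q∉Y i }) (≤-reflexive (sym ∣Y∣≡3)) (≤-reflexive (P-q≡3 q∈))))

    cubic : CubicTangle G τ
    cubic = σ , star , σ⊆τ , All.tabulate order≡3
      , subst (Cubic G) P≡bag (∣P∣≡4 , components-cubic , triples-cubic)
      where
      order≡3 : ∀ {s} → s ∈ₗ σ → order G s ≡ 3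
      order≡3 s∈ with σ-index s∈
      ... | j , refl = trans (side-order (R j)) (System.N≡3 base (small j) (proj₂ (nonempty j)))

  module _ (not-cubic : ¬ CubicTangle G τ) where

    4<∣P∣ : ∣ P₀ ∣ > 4
    4<∣P∣ with m≤n⇒m<n∨m≡n 4≤∣P∣
    ... | inj₁ h = h
    ... | inj₂ e = ⊥-elim (not-cubic (Four.cubic (sym e)))

    internally-4-connected : InternallyFourConnected (TorsoEdge G σ) (bag G σ)
    internally-4-connected = subst (InternallyFourConnected (TorsoEdge G σ)) P≡bag
      (normal⇒internally-4-connected H normal 4<∣P∣ Torso⇒E E⇒Torso)

theorem4p1 : (G : Graph) → ThreeConnected G →
    (τ : OSepSet G) → Tangle G 4 τ → ¬ CubicTangle G τ →
    (N₁ N₂ : List (OSep G)) → MaximalThreeChop G N₁ → MaximalThreeChop G N₂ →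
    (σ₁ σ₂ : List (OSep G)) →
    SplittingStar G N₁ σ₁ → All τ σ₁ →
    SplittingStar G N₂ σ₂ → All τ σ₂ →
    InternallyFourConnected (TorsoEdge G σ₁) (bag G σ₁) ×
    InternallyFourConnected (TorsoEdge G σ₂) (bag G σ₂) ×
    Isomorphic (TorsoEdge G σ₁) (bag G σ₁) (TorsoEdge G σ₂) (bag G σ₂)
theorem4p1 G 3-connected τ tangle not-cubic N₁ N₂ max₁ max₂ σ₁ σ₂ split₁ σ₁⊆τ split₂ σ₂⊆τ =
  T₁.internally-4-connected not-cubic , T₂.internally-4-connected not-cubic ,
  subst₂ (λ P Q → Isomorphic (TorsoEdge G σ₁) P (TorsoEdge G σ₂) Q) T₁.P≡bag T₂.P≡bag
    ( I.to , I.from , (λ _ → F.P→) , (λ _ → B.P→) , (λ v _ → I.from∘to v) , (λ v _ → I.to∘from v)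
    , λ u v u∈ v∈ → (λ e → T₂.E⇒Torso (F.P→ u∈) (F.P→ v∈) (F.E→ u∈ v∈ (T₁.Torso⇒E u∈ v∈ e)))
                  , λ e → T₁.E⇒Torso u∈ v∈ (subst₂ (E C₁.H) (I.from∘to u) (I.from∘to v)
                      (B.E→ (F.P→ u∈) (F.P→ v∈) (T₂.Torso⇒E (F.P→ u∈) (F.P→ v∈) e))) )
  where
  module C₁ = Chop G 3-connected τ tangle N₁ max₁
  module C₂ = Chop G 3-connected τ tangle N₂ max₂
  module T₁ = Torso G 3-connected τ tangle N₁ max₁ σ₁ split₁ σ₁⊆τ
  module T₂ = Torso G 3-connected τ tangle N₂ max₂ σ₂ split₂ σ₂⊆τ
  -- Both sequences start from the same `base`, which depends on `G` and the tangle but on neither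
  -- chop.
  module I = Iso (unique-normal-form C₁.normal C₂.normal (C₁.path (done Iso-refl)) (C₂.path (done Iso-refl)))
  module F = Half I.forth
  module B = Half I.back
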